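{- Let $M$ be a term of XTT in the empty context with $\cdot \vdash M : \mathsf{bool}$. Then either $\cdot \vdash M = \mathsf{tt} : \mathsf{bool}$ or $\cdot \vdash M = \mathsf{ff} : \mathsf{bool}$ (judgmental equality).
   Context: XTT is the dependent type theory (considered as its syntax, i.e. the bi-initial model: terms modulo judgmental equality) given by the following rules. Judgments are $\Gamma\ \mathsf{ctx}$, $\Gamma\vdash A\ \mathsf{type}$, $\Gamma\vdash a : A$, and judgmental equality of types and of terms; judgmental equality is a congruence and there is a conversion rule (if $A=A'$ and $a:A$ then $a:A'$). Contexts are built from the empty context $\cdot$ by extending with a dimension variable $i:\mathbb{I}$, with the assumption of a face formula $\phi$, or with a term variable $x:A$, and obey the usual structural rules. Dimensions $r,s$ are dimension variables or the constants $0,1$. Face formulas are $r=s$ and $\phi\lor\psi$, with the evident intuitionistic rules (introduction and elimination of disjunction; formulas identified when interprovable); assuming $r=s$ makes $r$ and $s$ judgmentally equal. Under the (false) formula $0=1$ every type has an element $\mathsf{abort}$ and all elements are equal; if $\phi\lor\psi$ holds and $a_\phi$, $a_\psi$ are elements of $A$ under $\phi$, resp. $\psi$, that agree under both, there is an element $[\phi\to a_\phi\mid\psi\to a_\psi]$ of $A$ equal to $a_\phi$ when $\phi$ holds and to $a_\psi$ when $\psi$ holds, and $a=[\phi\to a\mid\psi\to a]$. Write $\partial r$ for $r=0\lor r=1$. Type formers: dependent products $\Pi$ (with $\lambda$, application, $\beta$ and $\eta$); dependent sums $\Sigma$ (pairing, projections, $\beta$, $\eta$); a type $\mathsf{bool}$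 with $\mathsf{tt},\mathsf{ff}$ and a dependent eliminator $\mathsf{if}$ with the two $\beta$-rules; dependent path types $\mathsf{Path}(i.A;a_0,a_1)$ for $\Gamma,i:\mathbb{I}\vdash A$, $a_0:A[0/i]$, $a_1:A[1/i]$, with introduction $\lambda i.a : \mathsf{Path}(i.A; a[0/i],a[1/i])$ for $\Gamma,i:\mathbb{I}\vdash a:A$, elimination $p(r):A[r/i]$ with $p(0)=a_0$, $p(1)=a_1$, and $\beta$, $\eta$ rules; and a universe $U$ à la Tarski with decoding $\mathsf{El}$, containing codes for $\Pi$, $\Sigma$, $\mathsf{Path}$ and $\mathsf{bool}$ that decode to the corresponding types. Elements of $U$ satisfy boundary separation: if $\Gamma\vdash\hat A:U$, $\Gamma\vdash r:\mathbb{I}$ and $\Gamma,\partial r\vdash a=b:\mathsf{El}(\hat A)$, then $\Gamma\vdash a=b:\mathsf{El}(\hat A)$. For lines $i:\mathbb{I}\vdash \hat A:U$ there are coercion $\mathsf{coe}^{r\to r'}_{i.\hat A}(a)$ (equal to $a$ when $r=r'$) and composition $\mathsf{com}^{r\to r';s}_{i.\hat A}(i.a)$ operations (for $a$ given on $i=r\lor\partial s$, restricting to $a$ on $r'=r\lor \partial s$), satisfying regularity (coercion along a line of codes not depending on $i$ is the identity) and the standard equations computing coercion at the codes for $\Pi$, $\Sigma$ and $\mathsf{Path}$; and $U$ has a typecase eliminator (case analysis on codes for $\Pi,\Sigma,\mathsf{Path},\mathsf{bool}$) with its computation rules. -}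

module Defs where

-- Extrinsic (raw syntax + derivable judgments) presentation of XTT.
-- Single-sorted raw syntax with de Bruijn indices; contexts contain
-- dimension variables, face-formula assumptions and term variables, each
-- occupying one de Bruijn slot.

open import Data.Nat using (ℕ; zero; suc; _+_)

-- Raw syntax
--
-- Binding conventions (number of variables bound in each argument):
--   Pi A B, Sg A B, cPi a b, cSg a b : B / b binds 1 (term var)
--   Path A a0 a1, cPath a x y        : A / a binds 1 (dim var)
--   lam b : 1 ;  plam a : 1 (dim)
--   if C b t f : C binds 1
--   split φ a ψ b : a, b bind 1 (face slot)
--   coe r r' A a : A binds 1 (dim)
--   com r r' s A a : A binds 1 (dim), a binds 2 (dim, then face slot)
--   tcase C cpi csg cpath cbool x : C binds 1, cpi 2, csg 2, cpath 5

data Tm : Set where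
  var   : ℕ → Tm
  i0 i1 : Tm
  _≐_   : Tm → Tm → Tm
  _∨_   : Tm → Tm → Tm
  Pi Sg : Tm → Tm → Tm
  Bool  : Tm
  Path  : Tm → Tm → Tm → Tm
  U     : Tm
  El    : Tm → Tm
  lam   : Tm → Tm
  app   : Tm → Tm → Tm
  pair  : Tm → Tm → Tm
  fst snd : Tm → Tm
  tt ff : Tm
  if    : Tm → Tm → Tm → Tm → Tm
  plam  : Tm → Tm
  papp  : Tm → Tm → Tm
  abort : Tm
  split : Tm → Tm → Tm → Tm → Tm
  cPi cSg : Tm → Tm → Tm
  cBool : Tm
  cPath : Tm → Tm → Tm → Tm
  coe   : Tm → Tm → Tm → Tm → Tm
  com   : Tm → Tm → Tm → Tm → Tm → Tm
  tcase : Tm → Tm → Tm → Tm → Tm → Tm → Tm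

infix 6 _≐_
infixr 5 _∨_

Ren : Set
Ren = ℕ → ℕ

liftR : Ren → Ren
liftR ρ zero = zero
liftR ρ (suc n) = suc (ρ n)

liftRⁿ : ℕ → Ren → Ren
liftRⁿ zero ρ = ρ
liftRⁿ (suc k) ρ = liftR (liftRⁿ k ρ)

ren : Ren → Tm → Tm
ren ρ (var x) = var (ρ x)
ren ρ i0 = i0
ren ρ i1 = i1
ren ρ (r ≐ s) = ren ρ r ≐ ren ρ s
ren ρ (φ ∨ ψ) = ren ρ φ ∨ ren ρ ψ
ren ρ (Pi A B) = Pi (ren ρ A) (ren (liftR ρ) B)
ren ρ (Sg A B) = Sg (ren ρ A) (ren (liftR ρ) B)
ren ρ Bool = Bool
ren ρ (Path A a b) = Path (ren (liftR ρ) A) (ren ρ a) (ren ρ b)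
ren ρ U = U
ren ρ (El a) = El (ren ρ a)
ren ρ (lam b) = lam (ren (liftR ρ) b)
ren ρ (app f a) = app (ren ρ f) (ren ρ a)
ren ρ (pair a b) = pair (ren ρ a) (ren ρ b)
ren ρ (fst p) = fst (ren ρ p)
ren ρ (snd p) = snd (ren ρ p)
ren ρ tt = tt
ren ρ ff = ff
ren ρ (if C b t f) = if (ren (liftR ρ) C) (ren ρ b) (ren ρ t) (ren ρ f)
ren ρ (plam a) = plam (ren (liftR ρ) a)
ren ρ (papp p r) = papp (ren ρ p) (ren ρ r)
ren ρ abort = abort
ren ρ (split φ a ψ b) = split (ren ρ φ) (ren (liftR ρ) a) (ren ρ ψ) (ren (liftR ρ) b)
ren ρ (cPi a b) = cPi (ren ρ a) (ren (liftR ρ) b)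
ren ρ (cSg a b) = cSg (ren ρ a) (ren (liftR ρ) b)
ren ρ cBool = cBool
ren ρ (cPath a x y) = cPath (ren (liftR ρ) a) (ren ρ x) (ren ρ y)
ren ρ (coe r r' A a) = coe (ren ρ r) (ren ρ r') (ren (liftR ρ) A) (ren ρ a)
ren ρ (com r r' s A a) =
  com (ren ρ r) (ren ρ r') (ren ρ s) (ren (liftR ρ) A) (ren (liftRⁿ 2 ρ) a)
ren ρ (tcase C p s q b x) =
  tcase (ren (liftR ρ) C) (ren (liftRⁿ 2 ρ) p) (ren (liftRⁿ 2 ρ) s)
        (ren (liftRⁿ 5 ρ) q) (ren ρ b) (ren ρ x)

Sub : Set
Sub = ℕ → Tm

liftS : Sub → Sub
liftS σ zero = var zero
liftS σ (suc n) = ren suc (σ n)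

liftSⁿ : ℕ → Sub → Sub
liftSⁿ zero σ = σ
liftSⁿ (suc k) σ = liftS (liftSⁿ k σ)

sub : Sub → Tm → Tm
sub σ (var x) = σ x
sub σ i0 = i0
sub σ i1 = i1
sub σ (r ≐ s) = sub σ r ≐ sub σ s
sub σ (φ ∨ ψ) = sub σ φ ∨ sub σ ψ
sub σ (Pi A B) = Pi (sub σ A) (sub (liftS σ) B)
sub σ (Sg A B) = Sg (sub σ A) (sub (liftS σ) B)
sub σ Bool = Bool
sub σ (Path A a b) = Path (sub (liftS σ) A) (sub σ a) (sub σ b)
sub σ U = U
sub σ (El a) = El (sub σ a)
sub σ (lam b) = lam (sub (liftS σ) b)
sub σ (app f a) = app (sub σ f) (sub σ a)
sub σ (pair a b) = pair (sub σ a) (sub σ b)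
sub σ (fst p) = fst (sub σ p)
sub σ (snd p) = snd (sub σ p)
sub σ tt = tt
sub σ ff = ff
sub σ (if C b t f) = if (sub (liftS σ) C) (sub σ b) (sub σ t) (sub σ f)
sub σ (plam a) = plam (sub (liftS σ) a)
sub σ (papp p r) = papp (sub σ p) (sub σ r)
sub σ abort = abort
sub σ (split φ a ψ b) = split (sub σ φ) (sub (liftS σ) a) (sub σ ψ) (sub (liftS σ) b)
sub σ (cPi a b) = cPi (sub σ a) (sub (liftS σ) b)
sub σ (cSg a b) = cSg (sub σ a) (sub (liftS σ) b)
sub σ cBool = cBool
sub σ (cPath a x y) = cPath (sub (liftS σ) a) (sub σ x) (sub σ y)
sub σ (coe r r' A a) = coe (sub σ r) (sub σ r') (sub (liftS σ) A) (sub σ a)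
sub σ (com r r' s A a) =
  com (sub σ r) (sub σ r') (sub σ s) (sub (liftS σ) A) (sub (liftSⁿ 2 σ) a)
sub σ (tcase C p s q b x) =
  tcase (sub (liftS σ) C) (sub (liftSⁿ 2 σ) p) (sub (liftSⁿ 2 σ) s)
        (sub (liftSⁿ 5 σ) q) (sub σ b) (sub σ x)

infixr 5 _∷ₛ_
_∷ₛ_ : Tm → Sub → Sub
(t ∷ₛ σ) zero = t
(t ∷ₛ σ) (suc n) = σ n

wk : Tm → Tm
wk = ren suc

wkn : ℕ → Tm → Tm
wkn n = ren (λ k → n + k)

_[_]₀ : Tm → Tm → Tm
t [ u ]₀ = sub (u ∷ₛ var) t

-- instantiate a face slot (variable 0, never used by well-typed terms)
instF : Tm → Tm
instF a = a [ i0 ]₀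

∂ : Tm → Tm
∂ r = (r ≐ i0) ∨ (r ≐ i1)

partialCof : Tm → Tm → Tm
partialCof r s = (var 0 ≐ wk r) ∨ ∂ (wk s)

-- coe^{r→r'}_{i.Π(A,B)}(f) = λx. coe^{r→r'}_{i.B[i, coe^{r'→i}_A(x)]}(f (coe^{r'→r}_A x))
coePiRHS : Tm → Tm → Tm → Tm → Tm → Tm
coePiRHS r r' A B f =
  lam (coe (wk r) (wk r') (sub σB B)
           (app (wk f) (coe (wk r') (wk r) (ren (liftR suc) A) (var 0))))
  where
  σB : Sub
  σB zero = coe (wkn 2 r') (var 0) (ren (liftR (λ k → 2 + k)) A) (var 1)
  σB (suc zero) = var 0
  σB (suc (suc k)) = var (suc (suc k))

-- coe^{r→r'}_{i.Σ(A,B)}(p) =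
--   (coe^{r→r'}_A(fst p), coe^{r→r'}_{i.B[i, coe^{r→i}_A(fst p)]}(snd p))
coeSgRHS : Tm → Tm → Tm → Tm → Tm → Tm
coeSgRHS r r' A B p =
  pair (coe r r' A (fst p)) (coe r r' (sub σB B) (snd p))
  where
  σB : Sub
  σB zero = coe (wk r) (var 0) (ren (liftR suc) A) (fst (wk p))
  σB (suc zero) = var 0
  σB (suc (suc k)) = var (suc k)

-- coe^{r→r'}_{i.Path(j.A; a0, a1)}(p) =
--   λj. com^{r→r';j}_{i.A}(i. [ i=r → p(j) | ∂j → [ j=0 → a0 | j=1 → a1 ] ])
-- (A has scope Γ,i,j ; a0, a1 have scope Γ,i)
coePathRHS : Tm → Tm → Tm → Tm → Tm → Tm → Tm
coePathRHS r r' A a0 a1 p =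
  plam (com (wk r) (wk r') (var 0) (ren swap A) sys)
  where
  swap : Ren
  swap zero = 1
  swap (suc zero) = 0
  swap (suc (suc k)) = suc (suc k)
  -- scope of sys: Γ, j, i, (i = r ∨ ∂j)   (face slot 0, i = 1, j = 2)
  ρ : Ren
  ρ zero = 3
  ρ (suc k) = suc k + 4
  sys : Tm
  sys = split (var 1 ≐ wk (wk (wk r))) (papp (wkn 4 p) (var 3))
              ((var 2 ≐ i0) ∨ (var 2 ≐ i1))
              (split (var 3 ≐ i0) (ren ρ a0) (var 3 ≐ i1) (ren ρ a1))

data Entry : Set where
  dim : Entry
  cof : Tm → Entry
  ty  : Tm → Entry

wkE : Entry → Entry
wkE dim = dim
wkE (cof φ) = cof (wk φ)
wkE (ty A) = ty (wk A)

infixl 5 _▷_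
data Ctx : Set where
  ε   : Ctx
  _▷_ : Ctx → Entry → Ctx

data _∋_⦂_ : Ctx → ℕ → Entry → Set where
  here  : ∀ {Γ e} → (Γ ▷ e) ∋ zero ⦂ wkE e
  there : ∀ {Γ e e' x} → Γ ∋ x ⦂ e → (Γ ▷ e') ∋ suc x ⦂ wkE e

-- scope Γ, A:U, B:El A → U ; the code Π(A,B)
σtcPi : Sub
σtcPi zero = cPi (var 1) (app (var 1) (var 0))
σtcPi (suc k) = var (suc (suc k))

σtcSg : Sub
σtcSg zero = cSg (var 1) (app (var 1) (var 0))
σtcSg (suc k) = var (suc (suc k))

-- scope Γ, A0:U, A1:U, Ap:Path(_.U;A0,A1), a0:El A0, a1:El A1 ;
-- the code Path(i.Ap(i); a0, a1)
σtcPath : Sub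
σtcPath zero = cPath (papp (var 3) (var 0)) (var 1) (var 0)
σtcPath (suc k) = var (suc k + 4)

ctxPi : Ctx → Ctx
ctxPi Γ = Γ ▷ ty U ▷ ty (Pi (El (var 0)) U)

ctxPath : Ctx → Ctx
ctxPath Γ = Γ ▷ ty U ▷ ty U ▷ ty (Path U (var 1) (var 0))
              ▷ ty (El (var 2)) ▷ ty (El (var 2))

infix 3 ⊢_ _⊢ᵈ_ _⊢ᶠ_ _⊨_ _⊢ᵗ_ _⊢ᵗ_≡_ _⊢_∶_ _⊢_≡_∶_

data ⊢_ : Ctx → Set
data _⊢ᵈ_ : Ctx → Tm → Set
data _⊢ᶠ_ : Ctx → Tm → Set
data _⊨_ : Ctx → Tm → Set
data _⊢ᵗ_ : Ctx → Tm → Set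
data _⊢ᵗ_≡_ : Ctx → Tm → Tm → Set
data _⊢_∶_ : Ctx → Tm → Tm → Set
data _⊢_≡_∶_ : Ctx → Tm → Tm → Tm → Set

data ⊢_ where
  ε-ok   : ⊢ ε
  dim-ok : ∀ {Γ} → ⊢ Γ → ⊢ Γ ▷ dim
  cof-ok : ∀ {Γ φ} → Γ ⊢ᶠ φ → ⊢ Γ ▷ cof φ
  ty-ok  : ∀ {Γ A} → Γ ⊢ᵗ A → ⊢ Γ ▷ ty A

data _⊢ᵈ_ where
  d-0   : ∀ {Γ} → ⊢ Γ → Γ ⊢ᵈ i0
  d-1   : ∀ {Γ} → ⊢ Γ → Γ ⊢ᵈ i1
  d-var : ∀ {Γ x} → ⊢ Γ → Γ ∋ x ⦂ dim → Γ ⊢ᵈ var x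

data _⊢ᶠ_ where
  f-eq : ∀ {Γ r s} → Γ ⊢ᵈ r → Γ ⊢ᵈ s → Γ ⊢ᶠ r ≐ s
  f-or : ∀ {Γ φ ψ} → Γ ⊢ᶠ φ → Γ ⊢ᶠ ψ → Γ ⊢ᶠ φ ∨ ψ

data _⊨_ where
  ⊨-hyp   : ∀ {Γ x φ} → ⊢ Γ → Γ ∋ x ⦂ cof φ → Γ ⊨ φ
  ⊨-refl  : ∀ {Γ r} → Γ ⊢ᵈ r → Γ ⊨ r ≐ r
  ⊨-sym   : ∀ {Γ r s} → Γ ⊨ r ≐ s → Γ ⊨ s ≐ r
  ⊨-trans : ∀ {Γ r s t} → Γ ⊨ r ≐ s → Γ ⊨ s ≐ t → Γ ⊨ r ≐ t
  ⊨-inl   : ∀ {Γ φ ψ} → Γ ⊨ φ → Γ ⊢ᶠ ψ → Γ ⊨ φ ∨ ψ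
  ⊨-inr   : ∀ {Γ φ ψ} → Γ ⊢ᶠ φ → Γ ⊨ ψ → Γ ⊨ φ ∨ ψ
  ⊨-elim  : ∀ {Γ φ ψ χ} → Γ ⊨ φ ∨ ψ → Γ ⊢ᶠ χ →
            Γ ▷ cof φ ⊨ wk χ → Γ ▷ cof ψ ⊨ wk χ → Γ ⊨ χ
  ⊨-abort : ∀ {Γ χ} → Γ ⊨ i0 ≐ i1 → Γ ⊢ᶠ χ → Γ ⊨ χ

data _⊢ᵗ_ where
  T-Pi   : ∀ {Γ A B} → Γ ⊢ᵗ A → Γ ▷ ty A ⊢ᵗ B → Γ ⊢ᵗ Pi A B
  T-Sg   : ∀ {Γ A B} → Γ ⊢ᵗ A → Γ ▷ ty A ⊢ᵗ B → Γ ⊢ᵗ Sg A B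
  T-Bool : ∀ {Γ} → ⊢ Γ → Γ ⊢ᵗ Bool
  T-Path : ∀ {Γ A a0 a1} → Γ ▷ dim ⊢ᵗ A →
           Γ ⊢ a0 ∶ A [ i0 ]₀ → Γ ⊢ a1 ∶ A [ i1 ]₀ → Γ ⊢ᵗ Path A a0 a1
  T-U    : ∀ {Γ} → ⊢ Γ → Γ ⊢ᵗ U
  T-El   : ∀ {Γ a} → Γ ⊢ a ∶ U → Γ ⊢ᵗ El a

data _⊢ᵗ_≡_ where
  Ty-refl  : ∀ {Γ A} → Γ ⊢ᵗ A → Γ ⊢ᵗ A ≡ A
  Ty-sym   : ∀ {Γ A B} → Γ ⊢ᵗ A ≡ B → Γ ⊢ᵗ B ≡ A
  Ty-trans : ∀ {Γ A B C} → Γ ⊢ᵗ A ≡ B → Γ ⊢ᵗ B ≡ C → Γ ⊢ᵗ A ≡ C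
  Pi-cong  : ∀ {Γ A A' B B'} → Γ ⊢ᵗ A → Γ ⊢ᵗ A ≡ A' → Γ ▷ ty A ⊢ᵗ B ≡ B' →
             Γ ⊢ᵗ Pi A B ≡ Pi A' B'
  Sg-cong  : ∀ {Γ A A' B B'} → Γ ⊢ᵗ A → Γ ⊢ᵗ A ≡ A' → Γ ▷ ty A ⊢ᵗ B ≡ B' →
             Γ ⊢ᵗ Sg A B ≡ Sg A' B'
  Path-cong : ∀ {Γ A A' a0 a0' a1 a1'} → Γ ▷ dim ⊢ᵗ A ≡ A' →
              Γ ⊢ a0 ≡ a0' ∶ A [ i0 ]₀ → Γ ⊢ a1 ≡ a1' ∶ A [ i1 ]₀ →
              Γ ⊢ᵗ Path A a0 a1 ≡ Path A' a0' a1'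
  El-cong  : ∀ {Γ a a'} → Γ ⊢ a ≡ a' ∶ U → Γ ⊢ᵗ El a ≡ El a'
  El-cPi   : ∀ {Γ a b} → Γ ⊢ a ∶ U → Γ ▷ ty (El a) ⊢ b ∶ U →
             Γ ⊢ᵗ El (cPi a b) ≡ Pi (El a) (El b)
  El-cSg   : ∀ {Γ a b} → Γ ⊢ a ∶ U → Γ ▷ ty (El a) ⊢ b ∶ U →
             Γ ⊢ᵗ El (cSg a b) ≡ Sg (El a) (El b)
  El-cPath : ∀ {Γ a x y} → Γ ▷ dim ⊢ a ∶ U →
             Γ ⊢ x ∶ El (a [ i0 ]₀) → Γ ⊢ y ∶ El (a [ i1 ]₀) →
             Γ ⊢ᵗ El (cPath a x y) ≡ Path (El a) x y
  El-cBool : ∀ {Γ} → ⊢ Γ → Γ ⊢ᵗ El cBool ≡ Bool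

data _⊢_∶_ where
  t-var  : ∀ {Γ x A} → ⊢ Γ → Γ ∋ x ⦂ ty A → Γ ⊢ var x ∶ A
  t-conv : ∀ {Γ a A B} → Γ ⊢ a ∶ A → Γ ⊢ᵗ A ≡ B → Γ ⊢ a ∶ B
  t-lam  : ∀ {Γ A B b} → Γ ⊢ᵗ A → Γ ▷ ty A ⊢ b ∶ B → Γ ⊢ lam b ∶ Pi A B
  t-app  : ∀ {Γ A B f a} → Γ ⊢ f ∶ Pi A B → Γ ⊢ a ∶ A → Γ ⊢ app f a ∶ B [ a ]₀
  t-pair : ∀ {Γ A B a b} → Γ ▷ ty A ⊢ᵗ B → Γ ⊢ a ∶ A → Γ ⊢ b ∶ B [ a ]₀ →
           Γ ⊢ pair a b ∶ Sg A B
  t-fst  : ∀ {Γ A B p} → Γ ⊢ p ∶ Sg A B → Γ ⊢ fst p ∶ A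
  t-snd  : ∀ {Γ A B p} → Γ ⊢ p ∶ Sg A B → Γ ⊢ snd p ∶ B [ fst p ]₀
  t-tt   : ∀ {Γ} → ⊢ Γ → Γ ⊢ tt ∶ Bool
  t-ff   : ∀ {Γ} → ⊢ Γ → Γ ⊢ ff ∶ Bool
  t-if   : ∀ {Γ C b t f} → Γ ▷ ty Bool ⊢ᵗ C → Γ ⊢ b ∶ Bool →
           Γ ⊢ t ∶ C [ tt ]₀ → Γ ⊢ f ∶ C [ ff ]₀ → Γ ⊢ if C b t f ∶ C [ b ]₀
  t-plam : ∀ {Γ A a} → Γ ▷ dim ⊢ a ∶ A →
           Γ ⊢ plam a ∶ Path A (a [ i0 ]₀) (a [ i1 ]₀)
  t-papp : ∀ {Γ A a0 a1 p r} → Γ ⊢ p ∶ Path A a0 a1 → Γ ⊢ᵈ r →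
           Γ ⊢ papp p r ∶ A [ r ]₀
  t-abort : ∀ {Γ A} → Γ ⊨ i0 ≐ i1 → Γ ⊢ᵗ A → Γ ⊢ abort ∶ A
  t-split : ∀ {Γ A φ ψ a b} → Γ ⊨ φ ∨ ψ →
            Γ ▷ cof φ ⊢ a ∶ wk A → Γ ▷ cof ψ ⊢ b ∶ wk A →
            Γ ▷ cof φ ▷ cof (wk ψ) ⊢ wk a ≡ ren (liftR suc) b ∶ wk (wk A) →
            Γ ⊢ split φ a ψ b ∶ A
  t-cPi  : ∀ {Γ a b} → Γ ⊢ a ∶ U → Γ ▷ ty (El a) ⊢ b ∶ U → Γ ⊢ cPi a b ∶ U
  t-cSg  : ∀ {Γ a b} → Γ ⊢ a ∶ U → Γ ▷ ty (El a) ⊢ b ∶ U → Γ ⊢ cSg a b ∶ U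
  t-cBool : ∀ {Γ} → ⊢ Γ → Γ ⊢ cBool ∶ U
  t-cPath : ∀ {Γ a x y} → Γ ▷ dim ⊢ a ∶ U →
            Γ ⊢ x ∶ El (a [ i0 ]₀) → Γ ⊢ y ∶ El (a [ i1 ]₀) → Γ ⊢ cPath a x y ∶ U
  t-coe  : ∀ {Γ A r r' a} → Γ ▷ dim ⊢ A ∶ U → Γ ⊢ᵈ r → Γ ⊢ᵈ r' →
           Γ ⊢ a ∶ El (A [ r ]₀) → Γ ⊢ coe r r' A a ∶ El (A [ r' ]₀)
  t-com  : ∀ {Γ A r r' s a} → Γ ▷ dim ⊢ A ∶ U → Γ ⊢ᵈ r → Γ ⊢ᵈ r' → Γ ⊢ᵈ s →
           Γ ▷ dim ▷ cof (partialCof r s) ⊢ a ∶ El (wk A) →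
           Γ ⊢ com r r' s A a ∶ El (A [ r' ]₀)
  t-tcase : ∀ {Γ C cpi csg cpath cbool x} → Γ ▷ ty U ⊢ᵗ C →
            ctxPi Γ ⊢ cpi ∶ sub σtcPi C → ctxPi Γ ⊢ csg ∶ sub σtcSg C →
            ctxPath Γ ⊢ cpath ∶ sub σtcPath C → Γ ⊢ cbool ∶ C [ cBool ]₀ →
            Γ ⊢ x ∶ U → Γ ⊢ tcase C cpi csg cpath cbool x ∶ C [ x ]₀

data _⊢_≡_∶_ where
  ≡-refl  : ∀ {Γ a A} → Γ ⊢ a ∶ A → Γ ⊢ a ≡ a ∶ A
  ≡-sym   : ∀ {Γ a b A} → Γ ⊢ a ≡ b ∶ A → Γ ⊢ b ≡ a ∶ A
  ≡-trans : ∀ {Γ a b c A} → Γ ⊢ a ≡ b ∶ A → Γ ⊢ b ≡ c ∶ A → Γ ⊢ a ≡ c ∶ A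
  ≡-conv  : ∀ {Γ a b A B} → Γ ⊢ a ≡ b ∶ A → Γ ⊢ᵗ A ≡ B → Γ ⊢ a ≡ b ∶ B
  lam-cong  : ∀ {Γ A B b b'} → Γ ⊢ᵗ A → Γ ▷ ty A ⊢ b ≡ b' ∶ B →
              Γ ⊢ lam b ≡ lam b' ∶ Pi A B
  app-cong  : ∀ {Γ A B f f' a a'} → Γ ⊢ f ≡ f' ∶ Pi A B → Γ ⊢ a ≡ a' ∶ A →
              Γ ⊢ app f a ≡ app f' a' ∶ B [ a ]₀
  pair-cong : ∀ {Γ A B a a' b b'} → Γ ▷ ty A ⊢ᵗ B → Γ ⊢ a ≡ a' ∶ A →
              Γ ⊢ b ≡ b' ∶ B [ a ]₀ → Γ ⊢ pair a b ≡ pair a' b' ∶ Sg A B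
  fst-cong  : ∀ {Γ A B p p'} → Γ ⊢ p ≡ p' ∶ Sg A B → Γ ⊢ fst p ≡ fst p' ∶ A
  snd-cong  : ∀ {Γ A B p p'} → Γ ⊢ p ≡ p' ∶ Sg A B →
              Γ ⊢ snd p ≡ snd p' ∶ B [ fst p ]₀
  if-cong   : ∀ {Γ C C' b b' t t' f f'} → Γ ▷ ty Bool ⊢ᵗ C ≡ C' →
              Γ ⊢ b ≡ b' ∶ Bool → Γ ⊢ t ≡ t' ∶ C [ tt ]₀ → Γ ⊢ f ≡ f' ∶ C [ ff ]₀ →
              Γ ⊢ if C b t f ≡ if C' b' t' f' ∶ C [ b ]₀
  plam-cong : ∀ {Γ A a a'} → Γ ▷ dim ⊢ a ≡ a' ∶ A →
              Γ ⊢ plam a ≡ plam a' ∶ Path A (a [ i0 ]₀) (a [ i1 ]₀)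
  papp-cong : ∀ {Γ A a0 a1 p p' r s} → Γ ⊢ p ≡ p' ∶ Path A a0 a1 →
              Γ ⊢ᵈ r → Γ ⊢ᵈ s → Γ ⊨ r ≐ s → Γ ⊢ papp p r ≡ papp p' s ∶ A [ r ]₀
  split-cong : ∀ {Γ A φ ψ a a' b b'} → Γ ⊨ φ ∨ ψ →
               Γ ▷ cof φ ⊢ a ≡ a' ∶ wk A → Γ ▷ cof ψ ⊢ b ≡ b' ∶ wk A →
               Γ ▷ cof φ ▷ cof (wk ψ) ⊢ wk a ≡ ren (liftR suc) b ∶ wk (wk A) →
               Γ ▷ cof φ ▷ cof (wk ψ) ⊢ wk a' ≡ ren (liftR suc) b' ∶ wk (wk A) →
               Γ ⊢ split φ a ψ b ≡ split φ a' ψ b' ∶ A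
  cPi-cong  : ∀ {Γ a a' b b'} → Γ ⊢ a ∶ U → Γ ⊢ a ≡ a' ∶ U →
              Γ ▷ ty (El a) ⊢ b ≡ b' ∶ U → Γ ⊢ cPi a b ≡ cPi a' b' ∶ U
  cSg-cong  : ∀ {Γ a a' b b'} → Γ ⊢ a ∶ U → Γ ⊢ a ≡ a' ∶ U →
              Γ ▷ ty (El a) ⊢ b ≡ b' ∶ U → Γ ⊢ cSg a b ≡ cSg a' b' ∶ U
  cPath-cong : ∀ {Γ a a' x x' y y'} → Γ ▷ dim ⊢ a ≡ a' ∶ U →
               Γ ⊢ x ≡ x' ∶ El (a [ i0 ]₀) → Γ ⊢ y ≡ y' ∶ El (a [ i1 ]₀) →
               Γ ⊢ cPath a x y ≡ cPath a' x' y' ∶ U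
  coe-cong  : ∀ {Γ A A' r r' s s' a a'} → Γ ▷ dim ⊢ A ≡ A' ∶ U →
              Γ ⊢ᵈ r → Γ ⊢ᵈ s → Γ ⊨ r ≐ s → Γ ⊢ᵈ r' → Γ ⊢ᵈ s' → Γ ⊨ r' ≐ s' →
              Γ ⊢ a ≡ a' ∶ El (A [ r ]₀) →
              Γ ⊢ coe r r' A a ≡ coe s s' A' a' ∶ El (A [ r' ]₀)
  com-cong  : ∀ {Γ A A' r r' q q' s t a a'} → Γ ▷ dim ⊢ A ≡ A' ∶ U →
              Γ ⊢ᵈ r → Γ ⊢ᵈ q → Γ ⊨ r ≐ q → Γ ⊢ᵈ r' → Γ ⊢ᵈ q' → Γ ⊨ r' ≐ q' →
              Γ ⊢ᵈ s → Γ ⊢ᵈ t → Γ ⊨ s ≐ t →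
              Γ ▷ dim ▷ cof (partialCof r s) ⊢ a ≡ a' ∶ El (wk A) →
              Γ ▷ dim ▷ cof (partialCof q t) ⊢ a' ∶ El (wk A') →
              Γ ⊢ com r r' s A a ≡ com q q' t A' a' ∶ El (A [ r' ]₀)
  tcase-cong : ∀ {Γ C C' p p' s s' q q' b b' x x'} → Γ ▷ ty U ⊢ᵗ C ≡ C' →
               ctxPi Γ ⊢ p ≡ p' ∶ sub σtcPi C → ctxPi Γ ⊢ s ≡ s' ∶ sub σtcSg C →
               ctxPath Γ ⊢ q ≡ q' ∶ sub σtcPath C → Γ ⊢ b ≡ b' ∶ C [ cBool ]₀ →
               Γ ⊢ x ≡ x' ∶ U →
               Γ ⊢ tcase C p s q b x ≡ tcase C' p' s' q' b' x' ∶ C [ x ]₀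
  Pi-β : ∀ {Γ A B b a} → Γ ▷ ty A ⊢ b ∶ B → Γ ⊢ a ∶ A →
         Γ ⊢ app (lam b) a ≡ b [ a ]₀ ∶ B [ a ]₀
  Pi-η : ∀ {Γ A B f} → Γ ⊢ f ∶ Pi A B →
         Γ ⊢ f ≡ lam (app (wk f) (var 0)) ∶ Pi A B
  Sg-β₁ : ∀ {Γ A B a b} → Γ ▷ ty A ⊢ᵗ B → Γ ⊢ a ∶ A → Γ ⊢ b ∶ B [ a ]₀ →
          Γ ⊢ fst (pair a b) ≡ a ∶ A
  Sg-β₂ : ∀ {Γ A B a b} → Γ ▷ ty A ⊢ᵗ B → Γ ⊢ a ∶ A → Γ ⊢ b ∶ B [ a ]₀ →
          Γ ⊢ snd (pair a b) ≡ b ∶ B [ a ]₀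
  Sg-η  : ∀ {Γ A B p} → Γ ⊢ p ∶ Sg A B → Γ ⊢ p ≡ pair (fst p) (snd p) ∶ Sg A B
  if-βtt : ∀ {Γ C t f} → Γ ▷ ty Bool ⊢ᵗ C → Γ ⊢ t ∶ C [ tt ]₀ →
           Γ ⊢ f ∶ C [ ff ]₀ → Γ ⊢ if C tt t f ≡ t ∶ C [ tt ]₀
  if-βff : ∀ {Γ C t f} → Γ ▷ ty Bool ⊢ᵗ C → Γ ⊢ t ∶ C [ tt ]₀ →
           Γ ⊢ f ∶ C [ ff ]₀ → Γ ⊢ if C ff t f ≡ f ∶ C [ ff ]₀
  Path-β  : ∀ {Γ A a r} → Γ ▷ dim ⊢ a ∶ A → Γ ⊢ᵈ r →
            Γ ⊢ papp (plam a) r ≡ a [ r ]₀ ∶ A [ r ]₀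
  Path-η  : ∀ {Γ A a0 a1 p} → Γ ⊢ p ∶ Path A a0 a1 →
            Γ ⊢ p ≡ plam (papp (wk p) (var 0)) ∶ Path A a0 a1
  Path-∂₀ : ∀ {Γ A a0 a1 p} → Γ ⊢ p ∶ Path A a0 a1 →
            Γ ⊢ papp p i0 ≡ a0 ∶ A [ i0 ]₀
  Path-∂₁ : ∀ {Γ A a0 a1 p} → Γ ⊢ p ∶ Path A a0 a1 →
            Γ ⊢ papp p i1 ≡ a1 ∶ A [ i1 ]₀
  abort-≡ : ∀ {Γ A a b} → Γ ⊨ i0 ≐ i1 → Γ ⊢ a ∶ A → Γ ⊢ b ∶ A → Γ ⊢ a ≡ b ∶ A
  split-β₁ : ∀ {Γ A φ ψ a b} → Γ ⊨ φ → Γ ⊢ split φ a ψ b ∶ A →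
             Γ ⊢ split φ a ψ b ≡ instF a ∶ A
  split-β₂ : ∀ {Γ A φ ψ a b} → Γ ⊨ ψ → Γ ⊢ split φ a ψ b ∶ A →
             Γ ⊢ split φ a ψ b ≡ instF b ∶ A
  split-η  : ∀ {Γ A φ ψ a} → Γ ⊨ φ ∨ ψ → Γ ⊢ a ∶ A →
             Γ ⊢ a ≡ split φ (wk a) ψ (wk a) ∶ A
  bsep : ∀ {Γ Â r a b} → Γ ⊢ Â ∶ U → Γ ⊢ᵈ r →
         Γ ⊢ a ∶ El Â → Γ ⊢ b ∶ El Â →
         Γ ▷ cof (∂ r) ⊢ wk a ≡ wk b ∶ El (wk Â) → Γ ⊢ a ≡ b ∶ El Â
  coe-refl : ∀ {Γ A r r' a} → Γ ▷ dim ⊢ A ∶ U → Γ ⊢ᵈ r → Γ ⊢ᵈ r' → Γ ⊨ r ≐ r' →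
             Γ ⊢ a ∶ El (A [ r ]₀) → Γ ⊢ coe r r' A a ≡ a ∶ El (A [ r' ]₀)
  coe-reg  : ∀ {Γ A r r' a} → Γ ⊢ A ∶ U → Γ ⊢ᵈ r → Γ ⊢ᵈ r' →
             Γ ⊢ a ∶ El A → Γ ⊢ coe r r' (wk A) a ≡ a ∶ El A
  coe-Pi   : ∀ {Γ A B r r' f} → Γ ▷ dim ⊢ cPi A B ∶ U → Γ ⊢ᵈ r → Γ ⊢ᵈ r' →
             Γ ⊢ f ∶ El (cPi A B [ r ]₀) →
             Γ ⊢ coe r r' (cPi A B) f ≡ coePiRHS r r' A B f ∶ El (cPi A B [ r' ]₀)
  coe-Sg   : ∀ {Γ A B r r' p} → Γ ▷ dim ⊢ cSg A B ∶ U → Γ ⊢ᵈ r → Γ ⊢ᵈ r' →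
             Γ ⊢ p ∶ El (cSg A B [ r ]₀) →
             Γ ⊢ coe r r' (cSg A B) p ≡ coeSgRHS r r' A B p ∶ El (cSg A B [ r' ]₀)
  coe-Path : ∀ {Γ A a0 a1 r r' p} → Γ ▷ dim ⊢ cPath A a0 a1 ∶ U →
             Γ ⊢ᵈ r → Γ ⊢ᵈ r' → Γ ⊢ p ∶ El (cPath A a0 a1 [ r ]₀) →
             Γ ⊢ coe r r' (cPath A a0 a1) p ≡ coePathRHS r r' A a0 a1 p
               ∶ El (cPath A a0 a1 [ r' ]₀)
  com-∂ : ∀ {Γ A r r' s a} → Γ ▷ dim ⊢ A ∶ U → Γ ⊢ᵈ r → Γ ⊢ᵈ r' → Γ ⊢ᵈ s →
          Γ ▷ dim ▷ cof (partialCof r s) ⊢ a ∶ El (wk A) →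
          Γ ⊨ (r' ≐ r) ∨ ∂ s →
          Γ ⊢ com r r' s A a ≡ sub (i0 ∷ₛ r' ∷ₛ var) a ∶ El (A [ r' ]₀)
  tc-Pi : ∀ {Γ C p s q b x y} → Γ ▷ ty U ⊢ᵗ C →
          ctxPi Γ ⊢ p ∶ sub σtcPi C → ctxPi Γ ⊢ s ∶ sub σtcSg C →
          ctxPath Γ ⊢ q ∶ sub σtcPath C → Γ ⊢ b ∶ C [ cBool ]₀ →
          Γ ⊢ x ∶ U → Γ ▷ ty (El x) ⊢ y ∶ U →
          Γ ⊢ tcase C p s q b (cPi x y) ≡ sub (lam y ∷ₛ x ∷ₛ var) p ∶ C [ cPi x y ]₀
  tc-Sg : ∀ {Γ C p s q b x y} → Γ ▷ ty U ⊢ᵗ C →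
          ctxPi Γ ⊢ p ∶ sub σtcPi C → ctxPi Γ ⊢ s ∶ sub σtcSg C →
          ctxPath Γ ⊢ q ∶ sub σtcPath C → Γ ⊢ b ∶ C [ cBool ]₀ →
          Γ ⊢ x ∶ U → Γ ▷ ty (El x) ⊢ y ∶ U →
          Γ ⊢ tcase C p s q b (cSg x y) ≡ sub (lam y ∷ₛ x ∷ₛ var) s ∶ C [ cSg x y ]₀
  tc-Path : ∀ {Γ C p s q b a x y} → Γ ▷ ty U ⊢ᵗ C →
            ctxPi Γ ⊢ p ∶ sub σtcPi C → ctxPi Γ ⊢ s ∶ sub σtcSg C →
            ctxPath Γ ⊢ q ∶ sub σtcPath C → Γ ⊢ b ∶ C [ cBool ]₀ →
            Γ ▷ dim ⊢ a ∶ U → Γ ⊢ x ∶ El (a [ i0 ]₀) → Γ ⊢ y ∶ El (a [ i1 ]₀) →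
            Γ ⊢ tcase C p s q b (cPath a x y)
              ≡ sub (y ∷ₛ x ∷ₛ plam a ∷ₛ a [ i1 ]₀ ∷ₛ a [ i0 ]₀ ∷ₛ var) q
              ∶ C [ cPath a x y ]₀
  tc-Bool : ∀ {Γ C p s q b} → Γ ▷ ty U ⊢ᵗ C →
            ctxPi Γ ⊢ p ∶ sub σtcPi C → ctxPi Γ ⊢ s ∶ sub σtcSg C →
            ctxPath Γ ⊢ q ∶ sub σtcPath C → Γ ⊢ b ∶ C [ cBool ]₀ →
            Γ ⊢ tcase C p s q b cBool ≡ b ∶ C [ cBool ]₀

{-# OPTIONS --safe #-}
module Submission where

-- Computability is a predicate on terms in contexts of dimension variables, up to judgmental
-- equality: a boolean is computable if it equals tt or ff, a code if it equals a code former
-- applied to computable components, and an element of a code if its eliminations are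
-- computable at every further dimension substitution. As the predicate is stable under
-- judgmental equality, equations between terms never have to be validated, only typing rules
-- and equations between types.
-- That the predicate does not depend on the head normal form chosen for a code follows inside
-- the theory: typecase makes the code formers injective, and two different heads would
-- identify tt with ff, in which case all booleans are equal and everything is computable.
-- Coercion and composition are computable by induction on the line of codes. The theory has
-- no computation rules for composition, but boundary separation identifies a composite at Π,
-- Σ or Path, after elimination, with a composite at a component. A composite of booleans is a
-- literal because its tube and cap, being computable, are constant lines.

-- Canonicity concerns the empty context, but coercion and composition bind a dimension, so
-- computability is defined over all contexts of dimension variables. Face assumptions are kept out
-- of them on purpose: a formula entailed there is literally true, so a split always selects a
-- branch and 0 = 1 never holds. Boundary separation still reaches such faces, because it is used
-- inside the theory and not in the model.
--
-- On the syntactic side the obstacle is that a derivable judgment need not have a well-formed type: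
-- `t-split` asks for its type only under each of the two faces. The interpretation of types is
-- therefore a recursion on raw terms, and presuppositions are recovered only as far as they are
-- used, namely that contexts are well-formed and that types look like types.
--
-- The universe has no code for itself. Codes and their elements are thus covered by one
-- inductive-recursive definition, and the types of the theory, among them `U` and products over it,
-- are interpreted afterwards on top of it.

open import Defs
open import Data.Nat using (ℕ; zero; suc; _+_)
open import Data.Product using (Σ; _×_; _,_; proj₁; proj₂)
open import Data.Sum using (_⊎_; inj₁; inj₂)
open import Data.Nat.Properties using (+-comm; _≟_)
open import Data.Bool using (true; false) renaming (Bool to 𝔹)
open import Data.Empty using (⊥; ⊥-elim)
open import Data.Unit using (⊤)
open import Relation.Nullary using (yes; no)
open import Function using (_∘_; case_of_)
open import Relation.Binary.PropositionalEquality
  using (refl; sym; trans; cong; cong₂; subst; subst₂)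
  renaming (_≡_ to _≃_)

-- The raw substitution calculus.

private
  variable
    m n k : ℕ
    ρ : Ren
    σ σ' τ υ : Sub
    Γ Δ : Ctx
    t A A' B B' a a' b b' c c' f p r r' s u x y M M' N N' φ ψ χ : Tm

cong₃ : (g : Tm → Tm → Tm → Tm) → ∀ {x x' y y' z z'} →
        x ≃ x' → y ≃ y' → z ≃ z' → g x y z ≃ g x' y' z'
cong₃ g refl refl refl = refl

cong₄ : (g : Tm → Tm → Tm → Tm → Tm) → ∀ {x x' y y' z z' w w'} →
        x ≃ x' → y ≃ y' → z ≃ z' → w ≃ w' → g x y z w ≃ g x' y' z' w'
cong₄ g refl refl refl refl = refl

cong₅ : (g : Tm → Tm → Tm → Tm → Tm → Tm) → ∀ {x x' y y' z z' w w' v v'} →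
        x ≃ x' → y ≃ y' → z ≃ z' → w ≃ w' → v ≃ v' → g x y z w v ≃ g x' y' z' w' v'
cong₅ g refl refl refl refl refl = refl

cong₆ : (g : Tm → Tm → Tm → Tm → Tm → Tm → Tm) →
        ∀ {x x' y y' z z' w w' v v' u u'} →
        x ≃ x' → y ≃ y' → z ≃ z' → w ≃ w' → v ≃ v' → u ≃ u' →
        g x y z w v u ≃ g x' y' z' w' v' u'
cong₆ g refl refl refl refl refl refl = refl

infix 4 _≗_
_≗_ : Sub → Sub → Set
σ ≗ τ = ∀ x → σ x ≃ τ x

liftS-ext : σ ≗ τ → liftS σ ≗ liftS τ
liftS-ext e zero = refl
liftS-ext e (suc x) = cong wk (e x)

liftSⁿ-ext : ∀ k → σ ≗ τ → liftSⁿ k σ ≗ liftSⁿ k τ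
liftSⁿ-ext zero e = e
liftSⁿ-ext (suc k) e = liftS-ext (liftSⁿ-ext k e)

sub-ext : σ ≗ τ → ∀ t → sub σ t ≃ sub τ t
sub-ext e (var x) = e x
sub-ext e i0 = refl
sub-ext e i1 = refl
sub-ext e (r ≐ s) = cong₂ _≐_ (sub-ext e r) (sub-ext e s)
sub-ext e (φ ∨ ψ) = cong₂ _∨_ (sub-ext e φ) (sub-ext e ψ)
sub-ext e (Pi A B) = cong₂ Pi (sub-ext e A) (sub-ext (liftS-ext e) B)
sub-ext e (Sg A B) = cong₂ Sg (sub-ext e A) (sub-ext (liftS-ext e) B)
sub-ext e Bool = refl
sub-ext e (Path A a b) = cong₃ Path (sub-ext (liftS-ext e) A) (sub-ext e a) (sub-ext e b)
sub-ext e U = refl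
sub-ext e (El a) = cong El (sub-ext e a)
sub-ext e (lam b) = cong lam (sub-ext (liftS-ext e) b)
sub-ext e (app f a) = cong₂ app (sub-ext e f) (sub-ext e a)
sub-ext e (pair a b) = cong₂ pair (sub-ext e a) (sub-ext e b)
sub-ext e (fst p) = cong fst (sub-ext e p)
sub-ext e (snd p) = cong snd (sub-ext e p)
sub-ext e tt = refl
sub-ext e ff = refl
sub-ext e (if C b t f) =
  cong₄ if (sub-ext (liftS-ext e) C) (sub-ext e b) (sub-ext e t) (sub-ext e f)
sub-ext e (plam a) = cong plam (sub-ext (liftS-ext e) a)
sub-ext e (papp p r) = cong₂ papp (sub-ext e p) (sub-ext e r)
sub-ext e abort = refl
sub-ext e (split φ a ψ b) =
  cong₄ split (sub-ext e φ) (sub-ext (liftS-ext e) a) (sub-ext e ψ) (sub-ext (liftS-ext e) b)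
sub-ext e (cPi a b) = cong₂ cPi (sub-ext e a) (sub-ext (liftS-ext e) b)
sub-ext e (cSg a b) = cong₂ cSg (sub-ext e a) (sub-ext (liftS-ext e) b)
sub-ext e cBool = refl
sub-ext e (cPath a x y) = cong₃ cPath (sub-ext (liftS-ext e) a) (sub-ext e x) (sub-ext e y)
sub-ext e (coe r r' A a) =
  cong₄ coe (sub-ext e r) (sub-ext e r') (sub-ext (liftS-ext e) A) (sub-ext e a)
sub-ext e (com r r' s A a) =
  cong₅ com (sub-ext e r) (sub-ext e r') (sub-ext e s)
    (sub-ext (liftS-ext e) A) (sub-ext (liftSⁿ-ext 2 e) a)
sub-ext e (tcase C p s q b x) =
  cong₆ tcase (sub-ext (liftS-ext e) C) (sub-ext (liftSⁿ-ext 2 e) p)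
    (sub-ext (liftSⁿ-ext 2 e) s) (sub-ext (liftSⁿ-ext 5 e) q) (sub-ext e b) (sub-ext e x)

Agree : Ren → Sub → Set
Agree ρ σ = ∀ x → var (ρ x) ≃ σ x

liftR-agree : Agree ρ σ → Agree (liftR ρ) (liftS σ)
liftR-agree e zero = refl
liftR-agree e (suc x) = cong wk (e x)

liftRⁿ-agree : ∀ k → Agree ρ σ → Agree (liftRⁿ k ρ) (liftSⁿ k σ)
liftRⁿ-agree zero e = e
liftRⁿ-agree (suc k) e = liftR-agree (liftRⁿ-agree k e)

ren-agree : Agree ρ σ → ∀ t → ren ρ t ≃ sub σ t
ren-agree e (var x) = e x
ren-agree e i0 = refl
ren-agree e i1 = refl
ren-agree e (r ≐ s) = cong₂ _≐_ (ren-agree e r) (ren-agree e s)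
ren-agree e (φ ∨ ψ) = cong₂ _∨_ (ren-agree e φ) (ren-agree e ψ)
ren-agree e (Pi A B) = cong₂ Pi (ren-agree e A) (ren-agree (liftR-agree e) B)
ren-agree e (Sg A B) = cong₂ Sg (ren-agree e A) (ren-agree (liftR-agree e) B)
ren-agree e Bool = refl
ren-agree e (Path A a b) =
  cong₃ Path (ren-agree (liftR-agree e) A) (ren-agree e a) (ren-agree e b)
ren-agree e U = refl
ren-agree e (El a) = cong El (ren-agree e a)
ren-agree e (lam b) = cong lam (ren-agree (liftR-agree e) b)
ren-agree e (app f a) = cong₂ app (ren-agree e f) (ren-agree e a)
ren-agree e (pair a b) = cong₂ pair (ren-agree e a) (ren-agree e b)
ren-agree e (fst p) = cong fst (ren-agree e p)
ren-agree e (snd p) = cong snd (ren-agree e p)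
ren-agree e tt = refl
ren-agree e ff = refl
ren-agree e (if C b t f) =
  cong₄ if (ren-agree (liftR-agree e) C) (ren-agree e b) (ren-agree e t) (ren-agree e f)
ren-agree e (plam a) = cong plam (ren-agree (liftR-agree e) a)
ren-agree e (papp p r) = cong₂ papp (ren-agree e p) (ren-agree e r)
ren-agree e abort = refl
ren-agree e (split φ a ψ b) =
  cong₄ split (ren-agree e φ) (ren-agree (liftR-agree e) a)
    (ren-agree e ψ) (ren-agree (liftR-agree e) b)
ren-agree e (cPi a b) = cong₂ cPi (ren-agree e a) (ren-agree (liftR-agree e) b)
ren-agree e (cSg a b) = cong₂ cSg (ren-agree e a) (ren-agree (liftR-agree e) b)
ren-agree e cBool = refl
ren-agree e (cPath a x y) =
  cong₃ cPath (ren-agree (liftR-agree e) a) (ren-agree e x) (ren-agree e y)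
ren-agree e (coe r r' A a) =
  cong₄ coe (ren-agree e r) (ren-agree e r') (ren-agree (liftR-agree e) A) (ren-agree e a)
ren-agree e (com r r' s A a) =
  cong₅ com (ren-agree e r) (ren-agree e r') (ren-agree e s)
    (ren-agree (liftR-agree e) A) (ren-agree (liftRⁿ-agree 2 e) a)
ren-agree e (tcase C p s q b x) =
  cong₆ tcase (ren-agree (liftR-agree e) C) (ren-agree (liftRⁿ-agree 2 e) p)
    (ren-agree (liftRⁿ-agree 2 e) s) (ren-agree (liftRⁿ-agree 5 e) q)
    (ren-agree e b) (ren-agree e x)

ren-sub : ∀ ρ t → ren ρ t ≃ sub (var ∘ ρ) t
ren-sub ρ = ren-agree (λ _ → refl)

-- Composites of substitutions, abstracted over the class of composites considered, so that
-- the same traversal serves for renamings before or after a substitution and then for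
-- substitutions in general.
module Fusion
  (R : Sub → Sub → Sub → Set)
  (R-comp : ∀ {τ σ υ} → R τ σ υ → ∀ x → sub τ (σ x) ≃ υ x)
  (R-lift : ∀ {τ σ υ} → R τ σ υ → R (liftS τ) (liftS σ) (liftS υ)) where

  R-liftⁿ : ∀ k → R τ σ υ → R (liftSⁿ k τ) (liftSⁿ k σ) (liftSⁿ k υ)
  R-liftⁿ zero e = e
  R-liftⁿ (suc k) e = R-lift (R-liftⁿ k e)

  fuse : R τ σ υ → ∀ t → sub τ (sub σ t) ≃ sub υ t
  fuse e (var x) = R-comp e x
  fuse e i0 = refl
  fuse e i1 = refl
  fuse e (r ≐ s) = cong₂ _≐_ (fuse e r) (fuse e s)
  fuse e (φ ∨ ψ) = cong₂ _∨_ (fuse e φ) (fuse e ψ)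
  fuse e (Pi A B) = cong₂ Pi (fuse e A) (fuse (R-lift e) B)
  fuse e (Sg A B) = cong₂ Sg (fuse e A) (fuse (R-lift e) B)
  fuse e Bool = refl
  fuse e (Path A a b) = cong₃ Path (fuse (R-lift e) A) (fuse e a) (fuse e b)
  fuse e U = refl
  fuse e (El a) = cong El (fuse e a)
  fuse e (lam b) = cong lam (fuse (R-lift e) b)
  fuse e (app f a) = cong₂ app (fuse e f) (fuse e a)
  fuse e (pair a b) = cong₂ pair (fuse e a) (fuse e b)
  fuse e (fst p) = cong fst (fuse e p)
  fuse e (snd p) = cong snd (fuse e p)
  fuse e tt = refl
  fuse e ff = refl
  fuse e (if C b t f) = cong₄ if (fuse (R-lift e) C) (fuse e b) (fuse e t) (fuse e f)
  fuse e (plam a) = cong plam (fuse (R-lift e) a)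
  fuse e (papp p r) = cong₂ papp (fuse e p) (fuse e r)
  fuse e abort = refl
  fuse e (split φ a ψ b) =
    cong₄ split (fuse e φ) (fuse (R-lift e) a) (fuse e ψ) (fuse (R-lift e) b)
  fuse e (cPi a b) = cong₂ cPi (fuse e a) (fuse (R-lift e) b)
  fuse e (cSg a b) = cong₂ cSg (fuse e a) (fuse (R-lift e) b)
  fuse e cBool = refl
  fuse e (cPath a x y) = cong₃ cPath (fuse (R-lift e) a) (fuse e x) (fuse e y)
  fuse e (coe r r' A a) =
    cong₄ coe (fuse e r) (fuse e r') (fuse (R-lift e) A) (fuse e a)
  fuse e (com r r' s A a) =
    cong₅ com (fuse e r) (fuse e r') (fuse e s) (fuse (R-lift e) A) (fuse (R-liftⁿ 2 e) a)
  fuse e (tcase C p s q b x) =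
    cong₆ tcase (fuse (R-lift e) C) (fuse (R-liftⁿ 2 e) p) (fuse (R-liftⁿ 2 e) s)
      (fuse (R-liftⁿ 5 e) q) (fuse e b) (fuse e x)

record ThenRen (τ σ υ : Sub) : Set where
  constructor then-ren
  field
    of   : Ren
    is   : σ ≗ var ∘ of
    comp : τ ∘ of ≗ υ

then-ren-comp : ThenRen τ σ υ → ∀ x → sub τ (σ x) ≃ υ x
then-ren-comp {τ} (then-ren ρ e h) x = trans (cong (sub τ) (e x)) (h x)

then-ren-lift : ThenRen τ σ υ → ThenRen (liftS τ) (liftS σ) (liftS υ)
then-ren-lift (then-ren ρ e h) = then-ren (liftR ρ)
  (λ { zero → refl ; (suc x) → cong wk (e x) })
  (λ { zero → refl ; (suc x) → cong wk (h x) })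

module FusionRen = Fusion ThenRen then-ren-comp then-ren-lift

sub-ren : ∀ τ ρ t → sub τ (ren ρ t) ≃ sub (τ ∘ ρ) t
sub-ren τ ρ t = trans (cong (sub τ) (ren-sub ρ t))
  (FusionRen.fuse (then-ren ρ (λ _ → refl) (λ _ → refl)) t)

ren-ren : ∀ (ρ ρ' : Ren) t → ren ρ (ren ρ' t) ≃ ren (ρ ∘ ρ') t
ren-ren ρ ρ' t = trans (ren-sub ρ (ren ρ' t))
  (trans (sub-ren (var ∘ ρ) ρ' t) (sym (ren-sub (ρ ∘ ρ') t)))

record RenThen (τ σ υ : Sub) : Set where
  constructor ren-then
  field
    of   : Ren
    is   : τ ≗ var ∘ of
    comp : ren of ∘ σ ≗ υ

ren-then-comp : RenThen τ σ υ → ∀ x → sub τ (σ x) ≃ υ x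
ren-then-comp {σ = σ} (ren-then ρ e h) x =
  trans (sub-ext e (σ x)) (trans (sym (ren-sub ρ (σ x))) (h x))

ren-then-lift : RenThen τ σ υ → RenThen (liftS τ) (liftS σ) (liftS υ)
ren-then-lift {σ = σ} (ren-then ρ e h) = ren-then (liftR ρ)
  (λ { zero → refl ; (suc x) → cong wk (e x) })
  (λ { zero → refl
     ; (suc x) → trans (trans (ren-ren (liftR ρ) suc (σ x)) (sym (ren-ren suc ρ (σ x))))
                         (cong wk (h x)) })

module FusionSubRen = Fusion RenThen ren-then-comp ren-then-lift

ren-∘-sub : ∀ ρ σ t → ren ρ (sub σ t) ≃ sub (ren ρ ∘ σ) t
ren-∘-sub ρ σ t = trans (ren-sub ρ (sub σ t))
  (FusionSubRen.fuse (ren-then ρ (λ _ → refl) (λ _ → refl)) t)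

liftS-wk : ∀ σ t → sub (liftS σ) (wk t) ≃ wk (sub σ t)
liftS-wk σ t = trans (sub-ren (liftS σ) suc t) (sym (ren-∘-sub suc σ t))

infixr 9 _⨟_
_⨟_ : Sub → Sub → Sub
(σ ⨟ τ) x = sub τ (σ x)

-- General composites come last because lifting one moves `liftS τ` past a weakening. That is
-- `liftS-wk`, which combines the two earlier instances, renaming first and renaming last.
record Composite (τ σ υ : Sub) : Set where
  constructor composite
  field comp : σ ⨟ τ ≗ υ

composite-lift : Composite τ σ υ → Composite (liftS τ) (liftS σ) (liftS υ)
composite-lift {τ} {σ} (composite h) = composite
  (λ { zero → refl ; (suc x) → trans (liftS-wk τ (σ x)) (cong wk (h x)) })

module FusionSub = Fusion Composite Composite.comp composite-lift

sub-sub : ∀ τ σ t → sub τ (sub σ t) ≃ sub (σ ⨟ τ) t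
sub-sub τ σ t = FusionSub.fuse (composite λ _ → refl) t

liftS-id : σ ≗ var → liftS σ ≗ var
liftS-id e zero = refl
liftS-id e (suc x) = cong wk (e x)

liftSⁿ-id : ∀ k → σ ≗ var → liftSⁿ k σ ≗ var
liftSⁿ-id zero e = e
liftSⁿ-id (suc k) e = liftS-id (liftSⁿ-id k e)

sub-id′ : σ ≗ var → ∀ t → sub σ t ≃ t
sub-id′ e (var x) = e x
sub-id′ e i0 = refl
sub-id′ e i1 = refl
sub-id′ e (r ≐ s) = cong₂ _≐_ (sub-id′ e r) (sub-id′ e s)
sub-id′ e (φ ∨ ψ) = cong₂ _∨_ (sub-id′ e φ) (sub-id′ e ψ)
sub-id′ e (Pi A B) = cong₂ Pi (sub-id′ e A) (sub-id′ (liftS-id e) B)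
sub-id′ e (Sg A B) = cong₂ Sg (sub-id′ e A) (sub-id′ (liftS-id e) B)
sub-id′ e Bool = refl
sub-id′ e (Path A a b) = cong₃ Path (sub-id′ (liftS-id e) A) (sub-id′ e a) (sub-id′ e b)
sub-id′ e U = refl
sub-id′ e (El a) = cong El (sub-id′ e a)
sub-id′ e (lam b) = cong lam (sub-id′ (liftS-id e) b)
sub-id′ e (app f a) = cong₂ app (sub-id′ e f) (sub-id′ e a)
sub-id′ e (pair a b) = cong₂ pair (sub-id′ e a) (sub-id′ e b)
sub-id′ e (fst p) = cong fst (sub-id′ e p)
sub-id′ e (snd p) = cong snd (sub-id′ e p)
sub-id′ e tt = refl
sub-id′ e ff = refl
sub-id′ e (if C b t f) =
  cong₄ if (sub-id′ (liftS-id e) C) (sub-id′ e b) (sub-id′ e t) (sub-id′ e f)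
sub-id′ e (plam a) = cong plam (sub-id′ (liftS-id e) a)
sub-id′ e (papp p r) = cong₂ papp (sub-id′ e p) (sub-id′ e r)
sub-id′ e abort = refl
sub-id′ e (split φ a ψ b) =
  cong₄ split (sub-id′ e φ) (sub-id′ (liftS-id e) a) (sub-id′ e ψ) (sub-id′ (liftS-id e) b)
sub-id′ e (cPi a b) = cong₂ cPi (sub-id′ e a) (sub-id′ (liftS-id e) b)
sub-id′ e (cSg a b) = cong₂ cSg (sub-id′ e a) (sub-id′ (liftS-id e) b)
sub-id′ e cBool = refl
sub-id′ e (cPath a x y) = cong₃ cPath (sub-id′ (liftS-id e) a) (sub-id′ e x) (sub-id′ e y)
sub-id′ e (coe r r' A a) =
  cong₄ coe (sub-id′ e r) (sub-id′ e r') (sub-id′ (liftS-id e) A) (sub-id′ e a)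
sub-id′ e (com r r' s A a) =
  cong₅ com (sub-id′ e r) (sub-id′ e r') (sub-id′ e s)
    (sub-id′ (liftS-id e) A) (sub-id′ (liftSⁿ-id 2 e) a)
sub-id′ e (tcase C p s q b x) =
  cong₆ tcase (sub-id′ (liftS-id e) C) (sub-id′ (liftSⁿ-id 2 e) p)
    (sub-id′ (liftSⁿ-id 2 e) s) (sub-id′ (liftSⁿ-id 5 e) q) (sub-id′ e b) (sub-id′ e x)

sub-id : ∀ t → sub var t ≃ t
sub-id = sub-id′ (λ _ → refl)

-- Interchange laws for instantiation and weakening.

sub-swap : ∀ τ σ τ' σ' → σ ⨟ τ ≗ σ' ⨟ τ' → ∀ t → sub τ (sub σ t) ≃ sub τ' (sub σ' t)
sub-swap τ σ τ' σ' e t =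
  trans (sub-sub τ σ t) (trans (sub-ext e t) (sym (sub-sub τ' σ' t)))

ren-swap : ∀ τ ρ ρ' σ → τ ∘ ρ ≗ ren ρ' ∘ σ → ∀ t → sub τ (ren ρ t) ≃ ren ρ' (sub σ t)
ren-swap τ ρ ρ' σ e t =
  trans (sub-ren τ ρ t) (trans (sub-ext e t) (sym (ren-∘-sub ρ' σ t)))

sub-∷-wk : ∀ N σ t → sub (N ∷ₛ σ) (wk t) ≃ sub σ t
sub-∷-wk N σ t = sub-ren (N ∷ₛ σ) suc t

wk-inst : ∀ N t → wk t [ N ]₀ ≃ t
wk-inst N t = trans (sub-∷-wk N var t) (sub-id t)

lift-∷ : ∀ N σ τ → liftS σ ⨟ (N ∷ₛ τ) ≗ N ∷ₛ (σ ⨟ τ)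
lift-∷ N σ τ zero = refl
lift-∷ N σ τ (suc x) = sub-∷-wk N τ (σ x)

∷-ext : ∀ {N} → σ ≗ τ → (N ∷ₛ σ) ≗ (N ∷ₛ τ)
∷-ext e zero = refl
∷-ext e (suc x) = e x

⨟-var : ∀ σ → σ ⨟ var ≗ σ
⨟-var σ x = sub-id (σ x)

lift-inst : ∀ N σ t → sub (liftS σ) t [ N ]₀ ≃ sub (N ∷ₛ σ) t
lift-inst N σ t = trans (sub-sub (N ∷ₛ var) (liftS σ) t)
  (sub-ext (λ x → trans (lift-∷ N σ var x) (∷-ext (⨟-var σ) x)) t)

∷-⨟ : ∀ N σ τ → (N ∷ₛ σ) ⨟ τ ≗ sub τ N ∷ₛ (σ ⨟ τ)
∷-⨟ N σ τ zero = refl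
∷-⨟ N σ τ (suc x) = refl

sub-inst : ∀ σ t N → sub σ (t [ N ]₀) ≃ sub (sub σ N ∷ₛ σ) t
sub-inst σ t N = trans (sub-sub σ (N ∷ₛ var) t) (sub-ext (∷-⨟ N var σ) t)

inst : ∀ {σ t N} → sub σ (t [ N ]₀) ≃ sub (liftS σ) t [ sub σ N ]₀
inst {σ} {t} {N} = trans (sub-inst σ t N) (sym (lift-inst (sub σ N) σ t))

inst₂ : ∀ {σ t M N} →
        sub σ (sub (M ∷ₛ N ∷ₛ var) t) ≃ sub (sub σ M ∷ₛ sub σ N ∷ₛ var) (sub (liftSⁿ 2 σ) t)
inst₂ {σ} {t} {M} {N} = sub-swap σ (M ∷ₛ N ∷ₛ var) _ (liftSⁿ 2 σ)
  (λ { zero → refl ; (suc zero) → refl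
     ; (suc (suc x)) → sym (trans (sub-∷-wk _ _ (wk (σ x)))
                                      (trans (sub-∷-wk _ _ (σ x)) (sub-id (σ x)))) }) t

inst₅ : ∀ {σ t M₁ M₂ M₃ M₄ M₅} →
        sub σ (sub (M₁ ∷ₛ M₂ ∷ₛ M₃ ∷ₛ M₄ ∷ₛ M₅ ∷ₛ var) t) ≃
        sub (sub σ M₁ ∷ₛ sub σ M₂ ∷ₛ sub σ M₃ ∷ₛ sub σ M₄ ∷ₛ sub σ M₅ ∷ₛ var)
            (sub (liftSⁿ 5 σ) t)
inst₅ {σ} {t} {M₁} {M₂} {M₃} {M₄} {M₅} =
  sub-swap σ (M₁ ∷ₛ M₂ ∷ₛ M₃ ∷ₛ M₄ ∷ₛ M₅ ∷ₛ var) _ (liftSⁿ 5 σ)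
  (λ { zero → refl ; (suc zero) → refl ; (suc (suc zero)) → refl
     ; (suc (suc (suc zero))) → refl ; (suc (suc (suc (suc zero)))) → refl
     ; (suc (suc (suc (suc (suc x))))) → sym
         (trans (sub-∷-wk _ _ (wk (wk (wk (wk (σ x))))))
         (trans (sub-∷-wk _ _ (wk (wk (wk (σ x)))))
         (trans (sub-∷-wk _ _ (wk (wk (σ x))))
         (trans (sub-∷-wk _ _ (wk (σ x)))
         (trans (sub-∷-wk _ _ (σ x)) (sub-id (σ x))))))) }) t

lift-lift-wk : ∀ σ t → sub (liftSⁿ 2 σ) (ren (liftR suc) t) ≃ ren (liftR suc) (sub (liftS σ) t)
lift-lift-wk σ = ren-swap (liftSⁿ 2 σ) (liftR suc) (liftR suc) (liftS σ)
  (λ { zero → refl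
     ; (suc x) → trans (ren-ren suc suc (σ x)) (sym (ren-ren (liftR suc) suc (σ x))) })

wkn-suc : ∀ n t → wk (wkn n t) ≃ wkn (suc n) t
wkn-suc n t = ren-ren suc (λ k → n + k) t

wkn-0 : ∀ t → wkn 0 t ≃ t
wkn-0 t = trans (ren-sub _ t) (sub-id t)

lift-wkn : ∀ n σ t → sub (liftSⁿ n σ) (wkn n t) ≃ wkn n (sub σ t)
lift-wkn zero σ t = trans (cong (sub σ) (wkn-0 t)) (sym (wkn-0 (sub σ t)))
lift-wkn (suc n) σ t =
  trans (cong (sub (liftSⁿ (suc n) σ)) (sym (wkn-suc n t)))
    (trans (liftS-wk (liftSⁿ n σ) (wkn n t))
      (trans (cong wk (lift-wkn n σ t)) (wkn-suc n (sub σ t))))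

partialCof-sub : ∀ σ r s → sub (liftS σ) (partialCof r s) ≃ partialCof (sub σ r) (sub σ s)
partialCof-sub σ r s = cong₂ (λ r s → (var 0 ≐ r) ∨ ∂ s) (liftS-wk σ r) (liftS-wk σ s)

tcPi-sub : ∀ {σ t} → sub (liftSⁿ 2 σ) (sub σtcPi t) ≃ sub σtcPi (sub (liftS σ) t)
tcPi-sub {σ} {t} = sub-swap _ σtcPi σtcPi (liftS σ)
  (λ { zero → refl
     ; (suc x) → sym (trans (sub-ren σtcPi suc (σ x))
                       (trans (sym (ren-sub (λ k → 2 + k) (σ x)))
                                (sym (ren-ren suc suc (σ x))))) }) t

tcSg-sub : ∀ {σ t} → sub (liftSⁿ 2 σ) (sub σtcSg t) ≃ sub σtcSg (sub (liftS σ) t)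
tcSg-sub {σ} {t} = sub-swap _ σtcSg σtcSg (liftS σ)
  (λ { zero → refl
     ; (suc x) → sym (trans (sub-ren σtcSg suc (σ x))
                       (trans (sym (ren-sub (λ k → 2 + k) (σ x)))
                                (sym (ren-ren suc suc (σ x))))) }) t

liftSⁿ-∘+ : ∀ n σ x → liftSⁿ n σ (n + x) ≃ wkn n (σ x)
liftSⁿ-∘+ zero σ x = sym (wkn-0 (σ x))
liftSⁿ-∘+ (suc n) σ x = trans (cong wk (liftSⁿ-∘+ n σ x)) (wkn-suc n (σ x))

-- `σtcPath` carries its offset on the right, as `suc k + 4`, which is stuck on a variable `k`; the
-- shifts by `liftSⁿ 5` and `wkn 5` carry it on the left.
σtcPath-suc : ∀ x → σtcPath (suc x) ≃ var (5 + x)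
σtcPath-suc x = cong (var ∘ suc) (+-comm x 4)

tcPath-sub : ∀ {σ t} → sub (liftSⁿ 5 σ) (sub σtcPath t) ≃ sub σtcPath (sub (liftS σ) t)
tcPath-sub {σ} {t} = sub-swap _ σtcPath σtcPath (liftS σ)
  (λ { zero → refl
     ; (suc x) → trans (cong (sub (liftSⁿ 5 σ)) (σtcPath-suc x))
         (trans (liftSⁿ-∘+ 5 σ x)
           (sym (trans (sub-ren σtcPath suc (σ x))
             (trans (sub-ext σtcPath-suc (σ x)) (sym (ren-sub (λ k → 5 + k) (σ x))))))) }) t

-- Stability of the right-hand sides of the coercion rules.

coePi-sub : ∀ {σ r r' A B f} → sub σ (coePiRHS r r' A B f) ≃
  coePiRHS (sub σ r) (sub σ r') (sub (liftS σ) A) (sub (liftSⁿ 2 σ) B) (sub σ f)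
coePi-sub {σ} {r} {r'} {A} {B} {f} = cong lam (cong₄ coe (liftS-wk σ r) (liftS-wk σ r')
  (sub-swap _ _ _ _
    -- The substitution local to `coePiRHS` is compared with the lifted `σ` variable by variable;
    -- only variable 0, replaced by the coerced argument, carries content.
    (λ { zero → cong₄ coe (lift-wkn 2 σ r') refl
                  (ren-swap _ _ _ _
                    (λ { zero → refl
                       ; (suc x) → trans (cong wk (liftSⁿ-∘+ 2 σ x))
                                     (trans (wkn-suc 2 (σ x)) (sym (ren-ren _ suc (σ x)))) })
                    A) refl
       ; (suc zero) → refl
       ; (suc (suc x)) → trans (trans (ren-ren suc suc (σ x)) (ren-sub _ (σ x)))
           (sym (trans (sub-ren _ suc (wk (σ x))) (sub-ren _ suc (σ x)))) }) B)
  (cong₂ app (liftS-wk σ f)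
    (cong₄ coe (liftS-wk σ r') (liftS-wk σ r) (lift-lift-wk σ A) refl)))

coeSg-sub : ∀ {σ r r' A B p} → sub σ (coeSgRHS r r' A B p) ≃
  coeSgRHS (sub σ r) (sub σ r') (sub (liftS σ) A) (sub (liftSⁿ 2 σ) B) (sub σ p)
coeSg-sub {σ} {r} {r'} {A} {B} {p} = cong₂ pair refl (cong₄ coe refl refl
  (sub-swap _ _ _ _
    (λ { zero → cong₄ coe (liftS-wk σ r) refl (lift-lift-wk σ A) (cong fst (liftS-wk σ p))
       ; (suc zero) → refl
       ; (suc (suc x)) → trans (ren-sub suc (σ x))
           (sym (trans (sub-ren _ suc (wk (σ x))) (sub-ren _ suc (σ x)))) }) B)
  refl)

coePath-sub : ∀ {σ r r' A x y p} → sub σ (coePathRHS r r' A x y p) ≃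
  coePathRHS (sub σ r) (sub σ r') (sub (liftSⁿ 2 σ) A) (sub (liftS σ) x) (sub (liftS σ) y)
    (sub σ p)
coePath-sub {σ} {r} {r'} {A} {x} {y} {p} = cong plam (cong₅ com (liftS-wk σ r) (liftS-wk σ r') refl
  (ren-swap _ _ _ _
    (λ { zero → refl ; (suc zero) → refl
       ; (suc (suc x)) → trans (ren-ren suc suc (σ x))
           (sym (trans (ren-ren _ suc (wk (σ x))) (ren-ren _ suc (σ x)))) }) A)
  (cong₄ split (cong (var 1 ≐_) r-eq) (cong₂ papp (lift-wkn 4 σ p) refl) refl
    (cong₄ split refl (end x) refl (end y))))
  where
  r-eq : sub (liftSⁿ 3 σ) (wk (wk (wk r))) ≃ wk (wk (wk (sub σ r)))
  r-eq = trans (liftS-wk (liftSⁿ 2 σ) (wk (wk r)))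
    (cong wk (trans (liftS-wk (liftS σ) (wk r)) (cong wk (liftS-wk σ r))))
  end : ∀ t → _
  end = ren-swap _ _ _ _
    (λ { zero → refl
       ; (suc x) → trans (cong (liftSⁿ 5 σ) (cong suc (+-comm x 4)))
           (trans (liftSⁿ-∘+ 5 σ x)
             (sym (trans (ren-ren _ suc (σ x))
               (trans (ren-sub _ (σ x))
                 (trans (sub-ext σtcPath-suc (σ x)) (sym (ren-sub _ (σ x)))))))) })

-- Typed substitution.

subE : Sub → Entry → Entry
subE σ dim = dim
subE σ (cof φ) = cof (sub σ φ)
subE σ (ty A) = ty (sub σ A)

data WfE (Γ : Ctx) : Entry → Set where
  wf-dim : WfE Γ dim
  wf-cof : Γ ⊢ᶠ φ → WfE Γ (cof φ)
  wf-ty  : Γ ⊢ᵗ A → WfE Γ (ty A)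

▷-ok : ∀ {e} → ⊢ Γ → WfE Γ e → ⊢ Γ ▷ e
▷-ok ok wf-dim = dim-ok ok
▷-ok ok (wf-cof F) = cof-ok F
▷-ok ok (wf-ty T) = ty-ok T

-- A face slot is inhabited by the truth of its formula. The term put into the slot is
-- unconstrained, since no well-typed term refers to it.
Inhabits : Ctx → Tm → Entry → Set
Inhabits Γ t dim = Γ ⊢ᵈ t
Inhabits Γ t (cof φ) = Γ ⊨ φ
Inhabits Γ t (ty A) = Γ ⊢ t ∶ A

ty≃ : A ≃ A' → Γ ⊢ a ∶ A → Γ ⊢ a ∶ A'
ty≃ refl d = d

tm≃ : a ≃ a' → A ≃ A' → Γ ⊢ a ∶ A → Γ ⊢ a' ∶ A'
tm≃ refl refl d = d

eq≃ : a ≃ a' → b ≃ b' → A ≃ A' → Γ ⊢ a ≡ b ∶ A → Γ ⊢ a' ≡ b' ∶ A'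
eq≃ refl refl refl d = d

eqt≃ : A ≃ A' → Γ ⊢ a ≡ b ∶ A → Γ ⊢ a ≡ b ∶ A'
eqt≃ refl d = d

tyeq≃ : A ≃ A' → B ≃ B' → Γ ⊢ᵗ A ≡ B → Γ ⊢ᵗ A' ≡ B'
tyeq≃ refl refl d = d

cof≃ : φ ≃ ψ → Γ ⊨ φ → Γ ⊨ ψ
cof≃ refl d = d

ctxPi-ok : ⊢ Γ → ⊢ ctxPi Γ
ctxPi-ok ok = ty-ok (T-Pi (T-El (t-var ok₁ here)) (T-U (ty-ok (T-El (t-var ok₁ here)))))
  where ok₁ = ty-ok (T-U ok)

ctxPath-ok : ⊢ Γ → ⊢ ctxPath Γ
ctxPath-ok ok = ty-ok (T-El (t-var ok₄ (there (there here))))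
  where
  ok₁ = ty-ok (T-U ok)
  ok₂ = ty-ok (T-U ok₁)
  ok₃ = ty-ok (T-Path (T-U (dim-ok ok₂)) (t-var ok₂ (there here)) (t-var ok₂ here))
  ok₄ = ty-ok (T-El (t-var ok₃ (there (there here))))

wkD-dim : Γ ⊢ᵈ r → Γ ▷ dim ⊢ᵈ wk r
wkD-dim (d-0 ok) = d-0 (dim-ok ok)
wkD-dim (d-1 ok) = d-1 (dim-ok ok)
wkD-dim (d-var ok v) = d-var (dim-ok ok) (there v)

-- The theorem is proved for an arbitrary class W of substitutions closed under lifting, and
-- then used for renamings first and for well-typed substitutions after that. Since some
-- rules extend the context by a type without having its formation as a premise, each
-- derivation also yields that the types and formulas in its context can be substituted into.
module Substitution
  (W : Ctx → Sub → Ctx → Set)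
  (W-ok : ∀ {Δ σ Γ} → W Δ σ Γ → ⊢ Δ)
  (W-var : ∀ {Δ σ Γ x e} → W Δ σ Γ → Γ ∋ x ⦂ e → Inhabits Δ (σ x) (subE σ e))
  (W-lift : ∀ {Δ σ Γ} e → W Δ σ Γ → WfE Δ (subE σ e) → W (Δ ▷ subE σ e) (liftS σ) (Γ ▷ e))
  where

  SubE : Ctx → Entry → Set
  SubE Γ e = ∀ {Δ σ} → W Δ σ Γ → WfE Δ (subE σ e)

  SubC : Ctx → Set
  SubC ε = ⊤
  SubC (Γ ▷ e) = SubC Γ × SubE Γ e

  Stable : Ctx → (Ctx → Sub → Set) → Set
  Stable Γ J = SubC Γ × (∀ {Δ σ} → W Δ σ Γ → J Δ σ)

  liftD : W Δ σ Γ → W (Δ ▷ dim) (liftS σ) (Γ ▷ dim)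
  liftD w = W-lift dim w wf-dim

  liftF : sub σ φ ≃ ψ → W Δ σ Γ → Δ ⊢ᶠ ψ → W (Δ ▷ cof ψ) (liftS σ) (Γ ▷ cof φ)
  liftF refl w F = W-lift (cof _) w (wf-cof F)

  liftF′ : sub σ φ ≃ ψ → W Δ σ Γ → WfE Δ (subE σ (cof φ)) → W (Δ ▷ cof ψ) (liftS σ) (Γ ▷ cof φ)
  liftF′ refl w F = W-lift (cof _) w F

  liftT : W Δ σ Γ → Δ ⊢ᵗ sub σ A → W (Δ ▷ ty (sub σ A)) (liftS σ) (Γ ▷ ty A)
  liftT w T = W-lift (ty _) w (wf-ty T)

  liftPi : W Δ σ Γ → W (ctxPi Δ) (liftSⁿ 2 σ) (ctxPi Γ)
  liftPi w with ctxPi-ok (W-ok w)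
  ... | ty-ok T = liftT (liftT w (T-U (W-ok w))) T

  liftPath : W Δ σ Γ → W (ctxPath Δ) (liftSⁿ 5 σ) (ctxPath Γ)
  liftPath {Δ = Δ} w = liftT (liftT (liftT (liftT (liftT w (T-U ok)) (T-U ok₁)) P₂) P₃) P₄
    where
    ok = W-ok w
    ok₁ = ty-ok (T-U ok)
    ok₂ = ty-ok (T-U ok₁)
    P₂ = T-Path (T-U (dim-ok ok₂)) (t-var ok₂ (there here)) (t-var ok₂ here)
    ok₃ = ty-ok P₂
    P₃ = T-El (t-var ok₃ (there (there here)))
    P₄ = T-El (t-var (ty-ok P₃) (there (there here)))

  -- The substituted premises shared by the typing rule and the four computation rules of typecase,
  -- retyped so that each branch again lives over an instance of the substituted motive.
  record Cases (C p s q b : Tm) (Δ : Ctx) (σ : Sub) : Set where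
    constructor cases
    field
      motive : Δ ▷ ty U ⊢ᵗ sub (liftS σ) C
      pi-t   : ctxPi Δ ⊢ sub (liftSⁿ 2 σ) p ∶ sub σtcPi (sub (liftS σ) C)
      sg-t   : ctxPi Δ ⊢ sub (liftSⁿ 2 σ) s ∶ sub σtcSg (sub (liftS σ) C)
      path-t : ctxPath Δ ⊢ sub (liftSⁿ 5 σ) q ∶ sub σtcPath (sub (liftS σ) C)
      bool-t : Δ ⊢ sub σ b ∶ sub (liftS σ) C [ cBool ]₀

  liftCof : W Δ σ Γ → Δ ⊢ᵈ sub σ r → Δ ⊢ᵈ sub σ s →
            W (Δ ▷ dim ▷ cof (partialCof (sub σ r) (sub σ s))) (liftSⁿ 2 σ)
              (Γ ▷ dim ▷ cof (partialCof r s))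

  sub-C : ⊢ Γ → SubC Γ
  sub-D : Γ ⊢ᵈ r → Stable Γ (λ Δ σ → Δ ⊢ᵈ sub σ r)
  sub-F : Γ ⊢ᶠ φ → Stable Γ (λ Δ σ → Δ ⊢ᶠ sub σ φ)
  sub-H : Γ ⊨ φ → Stable Γ (λ Δ σ → Δ ⊨ sub σ φ)
  sub-T : Γ ⊢ᵗ A → Stable Γ (λ Δ σ → Δ ⊢ᵗ sub σ A)
  sub-TE : Γ ⊢ᵗ A ≡ B → Stable Γ (λ Δ σ → Δ ⊢ᵗ sub σ A ≡ sub σ B)
  sub-t : Γ ⊢ a ∶ A → Stable Γ (λ Δ σ → Δ ⊢ sub σ a ∶ sub σ A)
  sub-e : Γ ⊢ a ≡ b ∶ A → Stable Γ (λ Δ σ → Δ ⊢ sub σ a ≡ sub σ b ∶ sub σ A)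

  sub-C ε-ok = _
  sub-C (dim-ok ok) = sub-C ok , λ _ → wf-dim
  sub-C (cof-ok F) = let c , F = sub-F F in c , λ w → wf-cof (F w)
  sub-C (ty-ok T) = let c , T = sub-T T in c , λ w → wf-ty (T w)

  sub-D (d-0 ok) = sub-C ok , λ w → d-0 (W-ok w)
  sub-D (d-1 ok) = sub-C ok , λ w → d-1 (W-ok w)
  sub-D (d-var ok v) = sub-C ok , λ w → W-var w v

  sub-F (f-eq r s) = let c , r = sub-D r; _ , s = sub-D s in c , λ w → f-eq (r w) (s w)
  sub-F (f-or F G) = let c , F = sub-F F; _ , G = sub-F G in c , λ w → f-or (F w) (G w)

  sub-H (⊨-hyp ok v) = sub-C ok , λ w → W-var w v
  sub-H (⊨-refl r) = let c , r = sub-D r in c , λ w → ⊨-refl (r w)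
  sub-H (⊨-sym h) = let c , h = sub-H h in c , λ w → ⊨-sym (h w)
  sub-H (⊨-trans h g) = let c , h = sub-H h; _ , g = sub-H g in c , λ w → ⊨-trans (h w) (g w)
  sub-H (⊨-inl h F) = let c , h = sub-H h; _ , F = sub-F F in c , λ w → ⊨-inl (h w) (F w)
  sub-H (⊨-inr F h) = let c , h = sub-H h; _ , F = sub-F F in c , λ w → ⊨-inr (F w) (h w)
  sub-H (⊨-elim {χ = χ} h F g₁ g₂) =
    let c , h = sub-H h; _ , F = sub-F F
        (_ , F₁) , g₁ = sub-H g₁; (_ , F₂) , g₂ = sub-H g₂
    in c , λ w → ⊨-elim (h w) (F w)
         (cof≃ (liftS-wk _ χ) (g₁ (W-lift _ w (F₁ w))))
         (cof≃ (liftS-wk _ χ) (g₂ (W-lift _ w (F₂ w))))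
  sub-H (⊨-abort h F) = let c , h = sub-H h; _ , F = sub-F F in c , λ w → ⊨-abort (h w) (F w)

  liftCof {σ = σ} {r = r} {s = s} w R S =
    liftF (partialCof-sub σ r s) (liftD w)
      (f-or (f-eq (d-var ok here) (wkD-dim R))
            (f-or (f-eq (wkD-dim S) (d-0 ok)) (f-eq (wkD-dim S) (d-1 ok))))
    where
    ok = dim-ok (W-ok w)

  sub-T (T-Pi T S) =
    let c , T = sub-T T; _ , S = sub-T S in c , λ w → T-Pi (T w) (S (liftT w (T w)))
  sub-T (T-Sg T S) =
    let c , T = sub-T T; _ , S = sub-T S in c , λ w → T-Sg (T w) (S (liftT w (T w)))
  sub-T (T-Bool ok) = sub-C ok , λ w → T-Bool (W-ok w)
  sub-T (T-Path {A = A} T a b) =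
    let (c , _) , T = sub-T T; _ , a = sub-t a; _ , b = sub-t b
    in c , λ w → T-Path (T (liftD w)) (ty≃ (inst {t = A}) (a w)) (ty≃ (inst {t = A}) (b w))
  sub-T (T-U ok) = sub-C ok , λ w → T-U (W-ok w)
  sub-T (T-El a) = let c , a = sub-t a in c , λ w → T-El (a w)

  sub-TE (Ty-refl T) = let c , T = sub-T T in c , λ w → Ty-refl (T w)
  sub-TE (Ty-sym e) = let c , e = sub-TE e in c , λ w → Ty-sym (e w)
  sub-TE (Ty-trans e e') = let c , e = sub-TE e; _ , e' = sub-TE e' in c , λ w → Ty-trans (e w) (e' w)
  sub-TE (Pi-cong T e e') =
    let c , T = sub-T T; _ , e = sub-TE e; _ , e' = sub-TE e'
    in c , λ w → Pi-cong (T w) (e w) (e' (liftT w (T w)))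
  sub-TE (Sg-cong T e e') =
    let c , T = sub-T T; _ , e = sub-TE e; _ , e' = sub-TE e'
    in c , λ w → Sg-cong (T w) (e w) (e' (liftT w (T w)))
  sub-TE (Path-cong {A = A} e a b) =
    let (c , _) , e = sub-TE e; _ , a = sub-e a; _ , b = sub-e b
    in c , λ w → Path-cong (e (liftD w)) (eqt≃ (inst {t = A}) (a w)) (eqt≃ (inst {t = A}) (b w))
  sub-TE (El-cong e) = let c , e = sub-e e in c , λ w → El-cong (e w)
  sub-TE (El-cPi a b) =
    let c , a = sub-t a; _ , b = sub-t b in c , λ w → El-cPi (a w) (b (liftT w (T-El (a w))))
  sub-TE (El-cSg a b) =
    let c , a = sub-t a; _ , b = sub-t b in c , λ w → El-cSg (a w) (b (liftT w (T-El (a w))))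
  sub-TE (El-cPath {a = a} A x y) =
    let (c , _) , A = sub-t A; _ , x = sub-t x; _ , y = sub-t y
    in c , λ w → El-cPath (A (liftD w)) (ty≃ (cong El (inst {t = a})) (x w))
                          (ty≃ (cong El (inst {t = a})) (y w))
  sub-TE (El-cBool ok) = sub-C ok , λ w → El-cBool (W-ok w)

  sub-cases : ∀ {C p s q b} → Γ ▷ ty U ⊢ᵗ C → ctxPi Γ ⊢ p ∶ sub σtcPi C → ctxPi Γ ⊢ s ∶ sub σtcSg C →
              ctxPath Γ ⊢ q ∶ sub σtcPath C → Γ ⊢ b ∶ C [ cBool ]₀ → Stable Γ (Cases C p s q b)
  sub-cases {C = C} T p s q b =
    let (c , F) , T = sub-T T; _ , p = sub-t p; _ , s = sub-t s; _ , q = sub-t q; _ , b = sub-t b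
    in c , λ w → cases (T (W-lift _ w (F w)))
      (ty≃ (tcPi-sub {t = C}) (p (liftPi w))) (ty≃ (tcSg-sub {t = C}) (s (liftPi w)))
      (ty≃ (tcPath-sub {t = C}) (q (liftPath w))) (ty≃ (inst {t = C}) (b w))

  sub-split : ∀ {Γ A φ ψ a b} →
    Stable (Γ ▷ cof φ ▷ cof (wk ψ))
      (λ Δ σ → Δ ⊢ sub σ (wk a) ≡ sub σ (ren (liftR suc) b) ∶ sub σ (wk (wk A))) →
    W Δ σ Γ →
    Δ ▷ cof (sub σ φ) ▷ cof (wk (sub σ ψ)) ⊢
      wk (sub (liftS σ) a) ≡ ren (liftR suc) (sub (liftS σ) b) ∶ wk (wk (sub σ A))
  sub-split {σ = σ} {A = A} {φ} {ψ} {a} {b} (((_ , F) , G) , e) w =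
    eq≃ (liftS-wk (liftS σ) a) (lift-lift-wk σ b)
        (trans (liftS-wk (liftS σ) (wk A)) (cong wk (liftS-wk σ A)))
        (e (liftF′ (liftS-wk σ ψ) w₁ (G w₁)))
    where w₁ = W-lift (cof φ) w (F w)

  sub-t (t-var ok v) = sub-C ok , λ w → W-var w v
  sub-t (t-conv a e) = let c , a = sub-t a; _ , e = sub-TE e in c , λ w → t-conv (a w) (e w)
  sub-t (t-lam T b) =
    let c , T = sub-T T; _ , b = sub-t b in c , λ w → t-lam (T w) (b (liftT w (T w)))
  sub-t (t-app {B = B} f a) =
    let c , f = sub-t f; _ , a = sub-t a
    in c , λ w → ty≃ (sym (inst {t = B})) (t-app (f w) (a w))
  sub-t (t-pair {B = B} T a b) =
    let (c , F) , T = sub-T T; _ , a = sub-t a; _ , b = sub-t b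
    in c , λ w → t-pair (T (W-lift _ w (F w))) (a w) (ty≃ (inst {t = B}) (b w))
  sub-t (t-fst p) = let c , p = sub-t p in c , λ w → t-fst (p w)
  sub-t (t-snd {B = B} p) =
    let c , p = sub-t p in c , λ w → ty≃ (sym (inst {t = B})) (t-snd (p w))
  sub-t (t-tt ok) = sub-C ok , λ w → t-tt (W-ok w)
  sub-t (t-ff ok) = sub-C ok , λ w → t-ff (W-ok w)
  sub-t (t-if {C = C} T b x y) =
    let (c , F) , T = sub-T T; _ , b = sub-t b; _ , x = sub-t x; _ , y = sub-t y
    in c , λ w → ty≃ (sym (inst {t = C}))
      (t-if (T (W-lift _ w (F w))) (b w) (ty≃ (inst {t = C}) (x w)) (ty≃ (inst {t = C}) (y w)))
  sub-t (t-plam {A = A} {a = a} d) =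
    let (c , _) , d = sub-t d
    in c , λ w → ty≃ (cong₂ (Path _) (sym (inst {t = a})) (sym (inst {t = a})))
                     (t-plam (d (liftD w)))
  sub-t (t-papp {A = A} p r) =
    let c , p = sub-t p; _ , r = sub-D r
    in c , λ w → ty≃ (sym (inst {t = A})) (t-papp (p w) (r w))
  sub-t (t-abort h T) = let c , h = sub-H h; _ , T = sub-T T in c , λ w → t-abort (h w) (T w)
  sub-t (t-split {A = A} {a = a} {b = b} h d d' e) =
    let c , h = sub-H h; (_ , F) , d = sub-t d; (_ , G) , d' = sub-t d'; e = sub-e e
    in c , λ w → t-split (h w)
      (ty≃ (liftS-wk _ A) (d (W-lift _ w (F w)))) (ty≃ (liftS-wk _ A) (d' (W-lift _ w (G w))))
      (sub-split {A = A} {a = a} {b} e w)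
  sub-t (t-cPi a b) =
    let c , a = sub-t a; _ , b = sub-t b in c , λ w → t-cPi (a w) (b (liftT w (T-El (a w))))
  sub-t (t-cSg a b) =
    let c , a = sub-t a; _ , b = sub-t b in c , λ w → t-cSg (a w) (b (liftT w (T-El (a w))))
  sub-t (t-cBool ok) = sub-C ok , λ w → t-cBool (W-ok w)
  sub-t (t-cPath {a = a} d x y) =
    let (c , _) , d = sub-t d; _ , x = sub-t x; _ , y = sub-t y
    in c , λ w → t-cPath (d (liftD w)) (ty≃ (cong El (inst {t = a})) (x w))
                         (ty≃ (cong El (inst {t = a})) (y w))
  sub-t (t-coe {A = A} T r r' a) =
    let (c , _) , T = sub-t T; _ , r = sub-D r; _ , r' = sub-D r'; _ , a = sub-t a
    in c , λ w → ty≃ (cong El (sym (inst {t = A})))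
      (t-coe (T (liftD w)) (r w) (r' w) (ty≃ (cong El (inst {t = A})) (a w)))
  sub-t (t-com {A = A} T r r' s a) =
    let (c , _) , T = sub-t T; _ , r = sub-D r; _ , r' = sub-D r'; _ , s = sub-D s; _ , a = sub-t a
    in c , λ w → ty≃ (cong El (sym (inst {t = A})))
      (t-com (T (liftD w)) (r w) (r' w) (s w)
        (ty≃ (cong El (liftS-wk _ A)) (a (liftCof w (r w) (s w)))))
  sub-t (t-tcase {C = C} T p s q b x) =
    let c , K = sub-cases T p s q b; _ , x = sub-t x
    in c , λ w → let cases T p s q b = K w in ty≃ (sym (inst {t = C})) (t-tcase T p s q b (x w))

  sub-e (≡-refl a) = let c , a = sub-t a in c , λ w → ≡-refl (a w)
  sub-e (≡-sym e) = let c , e = sub-e e in c , λ w → ≡-sym (e w)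
  sub-e (≡-trans e e') = let c , e = sub-e e; _ , e' = sub-e e' in c , λ w → ≡-trans (e w) (e' w)
  sub-e (≡-conv e T) = let c , e = sub-e e; _ , T = sub-TE T in c , λ w → ≡-conv (e w) (T w)
  sub-e (lam-cong T e) =
    let c , T = sub-T T; _ , e = sub-e e in c , λ w → lam-cong (T w) (e (liftT w (T w)))
  sub-e (app-cong {B = B} e e') =
    let c , e = sub-e e; _ , e' = sub-e e'
    in c , λ w → eqt≃ (sym (inst {t = B})) (app-cong (e w) (e' w))
  sub-e (pair-cong {B = B} T a b) =
    let (c , F) , T = sub-T T; _ , a = sub-e a; _ , b = sub-e b
    in c , λ w → pair-cong (T (W-lift _ w (F w))) (a w) (eqt≃ (inst {t = B}) (b w))
  sub-e (fst-cong e) = let c , e = sub-e e in c , λ w → fst-cong (e w)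
  sub-e (snd-cong {B = B} e) =
    let c , e = sub-e e in c , λ w → eqt≃ (sym (inst {t = B})) (snd-cong (e w))
  sub-e (if-cong {C = C} T b x y) =
    let (c , F) , T = sub-TE T; _ , b = sub-e b; _ , x = sub-e x; _ , y = sub-e y
    in c , λ w → eqt≃ (sym (inst {t = C}))
      (if-cong (T (W-lift _ w (F w))) (b w)
        (eqt≃ (inst {t = C}) (x w)) (eqt≃ (inst {t = C}) (y w)))
  sub-e (plam-cong {a = a} d) =
    let (c , _) , d = sub-e d
    in c , λ w → eqt≃ (cong₂ (Path _) (sym (inst {t = a})) (sym (inst {t = a})))
                      (plam-cong (d (liftD w)))
  sub-e (papp-cong {A = A} p r s h) =
    let c , p = sub-e p; _ , r = sub-D r; _ , s = sub-D s; _ , h = sub-H h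
    in c , λ w → eqt≃ (sym (inst {t = A})) (papp-cong (p w) (r w) (s w) (h w))
  sub-e (split-cong {A = A} {a = a} {a'} {b} {b'} h d d' e e') =
    let c , h = sub-H h; (_ , F) , d = sub-e d; (_ , G) , d' = sub-e d'
        e = sub-e e; e' = sub-e e'
    in c , λ w → split-cong (h w)
      (eqt≃ (liftS-wk _ A) (d (W-lift _ w (F w)))) (eqt≃ (liftS-wk _ A) (d' (W-lift _ w (G w))))
      (sub-split {A = A} {a = a} {b} e w) (sub-split {A = A} {a = a'} {b'} e' w)
  sub-e (cPi-cong A a b) =
    let c , A = sub-t A; _ , a = sub-e a; _ , b = sub-e b
    in c , λ w → cPi-cong (A w) (a w) (b (liftT w (T-El (A w))))
  sub-e (cSg-cong A a b) =
    let c , A = sub-t A; _ , a = sub-e a; _ , b = sub-e b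
    in c , λ w → cSg-cong (A w) (a w) (b (liftT w (T-El (A w))))
  sub-e (cPath-cong {a = a} d x y) =
    let (c , _) , d = sub-e d; _ , x = sub-e x; _ , y = sub-e y
    in c , λ w → cPath-cong (d (liftD w)) (eqt≃ (cong El (inst {t = a})) (x w))
                            (eqt≃ (cong El (inst {t = a})) (y w))
  sub-e (coe-cong {A = A} T r s h r' s' h' a) =
    let (c , _) , T = sub-e T; _ , r = sub-D r; _ , s = sub-D s; _ , h = sub-H h
        _ , r' = sub-D r'; _ , s' = sub-D s'; _ , h' = sub-H h'; _ , a = sub-e a
    in c , λ w → eqt≃ (cong El (sym (inst {t = A})))
      (coe-cong (T (liftD w)) (r w) (s w) (h w) (r' w) (s' w) (h' w)
        (eqt≃ (cong El (inst {t = A})) (a w)))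
  sub-e (com-cong {A = A} {A'} T r q h r' q' h' s t h'' a a') =
    let (c , _) , T = sub-e T; _ , r = sub-D r; _ , q = sub-D q; _ , h = sub-H h
        _ , r' = sub-D r'; _ , q' = sub-D q'; _ , h' = sub-H h'
        _ , s = sub-D s; _ , t = sub-D t; _ , h'' = sub-H h''; _ , a = sub-e a; _ , a' = sub-t a'
    in c , λ w → eqt≃ (cong El (sym (inst {t = A})))
      (com-cong (T (liftD w)) (r w) (q w) (h w) (r' w) (q' w) (h' w) (s w) (t w) (h'' w)
        (eqt≃ (cong El (liftS-wk _ A)) (a (liftCof w (r w) (s w))))
        (ty≃ (cong El (liftS-wk _ A')) (a' (liftCof w (q w) (t w)))))
  sub-e (tcase-cong {C = C} T p s q b x) =
    let (c , F) , T = sub-TE T; _ , p = sub-e p; _ , s = sub-e s; _ , q = sub-e q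
        _ , b = sub-e b; _ , x = sub-e x
    in c , λ w → eqt≃ (sym (inst {t = C}))
      (tcase-cong (T (W-lift _ w (F w))) (eqt≃ (tcPi-sub {t = C}) (p (liftPi w)))
        (eqt≃ (tcSg-sub {t = C}) (s (liftPi w))) (eqt≃ (tcPath-sub {t = C}) (q (liftPath w)))
        (eqt≃ (inst {t = C}) (b w)) (x w))
  sub-e (Pi-β {B = B} {b} b' a) =
    let (c , F) , b' = sub-t b'; _ , a = sub-t a
    in c , λ w → eq≃ refl (sym (inst {t = b})) (sym (inst {t = B}))
      (Pi-β (b' (W-lift _ w (F w))) (a w))
  sub-e (Pi-η {f = f} d) =
    let c , d = sub-t d
    in c , λ w → eq≃ refl (cong lam (cong₂ app (sym (liftS-wk _ f)) refl)) refl (Pi-η (d w))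
  sub-e (Sg-β₁ {B = B} T a b) =
    let (c , F) , T = sub-T T; _ , a = sub-t a; _ , b = sub-t b
    in c , λ w → Sg-β₁ (T (W-lift _ w (F w))) (a w) (ty≃ (inst {t = B}) (b w))
  sub-e (Sg-β₂ {B = B} T a b) =
    let (c , F) , T = sub-T T; _ , a = sub-t a; _ , b = sub-t b
    in c , λ w → eqt≃ (sym (inst {t = B}))
      (Sg-β₂ (T (W-lift _ w (F w))) (a w) (ty≃ (inst {t = B}) (b w)))
  sub-e (Sg-η p) = let c , p = sub-t p in c , λ w → Sg-η (p w)
  sub-e (if-βtt {C = C} T x y) =
    let (c , F) , T = sub-T T; _ , x = sub-t x; _ , y = sub-t y
    in c , λ w → eqt≃ (sym (inst {t = C}))
      (if-βtt (T (W-lift _ w (F w))) (ty≃ (inst {t = C}) (x w)) (ty≃ (inst {t = C}) (y w)))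
  sub-e (if-βff {C = C} T x y) =
    let (c , F) , T = sub-T T; _ , x = sub-t x; _ , y = sub-t y
    in c , λ w → eqt≃ (sym (inst {t = C}))
      (if-βff (T (W-lift _ w (F w))) (ty≃ (inst {t = C}) (x w)) (ty≃ (inst {t = C}) (y w)))
  sub-e (Path-β {A = A} {a} d r) =
    let (c , _) , d = sub-t d; _ , r = sub-D r
    in c , λ w → eq≃ refl (sym (inst {t = a})) (sym (inst {t = A})) (Path-β (d (liftD w)) (r w))
  sub-e (Path-η {p = p} d) =
    let c , d = sub-t d
    in c , λ w → eq≃ refl (cong plam (cong₂ papp (sym (liftS-wk _ p)) refl)) refl (Path-η (d w))
  sub-e (Path-∂₀ {A = A} d) =
    let c , d = sub-t d in c , λ w → eqt≃ (sym (inst {t = A})) (Path-∂₀ (d w))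
  sub-e (Path-∂₁ {A = A} d) =
    let c , d = sub-t d in c , λ w → eqt≃ (sym (inst {t = A})) (Path-∂₁ (d w))
  sub-e (abort-≡ h a b) =
    let c , h = sub-H h; _ , a = sub-t a; _ , b = sub-t b in c , λ w → abort-≡ (h w) (a w) (b w)
  sub-e (split-β₁ {a = a} h d) =
    let c , h = sub-H h; _ , d = sub-t d
    in c , λ w → eq≃ refl (sym (inst {t = a})) refl (split-β₁ (h w) (d w))
  sub-e (split-β₂ {b = b} h d) =
    let c , h = sub-H h; _ , d = sub-t d
    in c , λ w → eq≃ refl (sym (inst {t = b})) refl (split-β₂ (h w) (d w))
  sub-e (split-η {a = a} h d) =
    let c , h = sub-H h; _ , d = sub-t d
    in c , λ w → eq≃ refl
      (cong₂ (λ x y → split _ x _ y) (sym (liftS-wk _ a)) (sym (liftS-wk _ a))) refl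
      (split-η (h w) (d w))
  sub-e (bsep {Â = A} {a = a} {b} T r a' b' e) =
    let c , T = sub-t T; _ , r = sub-D r; _ , a' = sub-t a'; _ , b' = sub-t b'
        (_ , F) , e = sub-e e
    in c , λ w → bsep (T w) (r w) (a' w) (b' w)
      (eq≃ (liftS-wk _ a) (liftS-wk _ b) (cong El (liftS-wk _ A)) (e (W-lift _ w (F w))))
  sub-e (coe-refl {A = A} T r r' h a) =
    let (c , _) , T = sub-t T; _ , r = sub-D r; _ , r' = sub-D r'; _ , h = sub-H h; _ , a = sub-t a
    in c , λ w → eqt≃ (cong El (sym (inst {t = A})))
      (coe-refl (T (liftD w)) (r w) (r' w) (h w) (ty≃ (cong El (inst {t = A})) (a w)))
  sub-e (coe-reg {A = A} T r r' a) =
    let c , T = sub-t T; _ , r = sub-D r; _ , r' = sub-D r'; _ , a = sub-t a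
    in c , λ w → eq≃ (cong₄ coe refl refl (sym (liftS-wk _ A)) refl) refl refl
      (coe-reg (T w) (r w) (r' w) (a w))
  sub-e (coe-Pi {A = A} {B} {r} {r'} {f} T d d' a) =
    let (c , _) , T = sub-t T; _ , d = sub-D d; _ , d' = sub-D d'; _ , a = sub-t a
    in c , λ w → eq≃ refl (sym (coePi-sub {r = r} {r'} {A} {B} {f}))
      (cong El (sym (inst {t = cPi A B})))
      (coe-Pi (T (liftD w)) (d w) (d' w) (ty≃ (cong El (inst {t = cPi A B})) (a w)))
  sub-e (coe-Sg {A = A} {B} {r} {r'} {f} T d d' a) =
    let (c , _) , T = sub-t T; _ , d = sub-D d; _ , d' = sub-D d'; _ , a = sub-t a
    in c , λ w → eq≃ refl (sym (coeSg-sub {r = r} {r'} {A} {B} {f}))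
      (cong El (sym (inst {t = cSg A B})))
      (coe-Sg (T (liftD w)) (d w) (d' w) (ty≃ (cong El (inst {t = cSg A B})) (a w)))
  sub-e (coe-Path {A = A} {x} {y} {r} {r'} {f} T d d' a) =
    let (c , _) , T = sub-t T; _ , d = sub-D d; _ , d' = sub-D d'; _ , a = sub-t a
    in c , λ w → eq≃ refl (sym (coePath-sub {r = r} {r'} {A} {x} {y} {f}))
      (cong El (sym (inst {t = cPath A x y})))
      (coe-Path (T (liftD w)) (d w) (d' w) (ty≃ (cong El (inst {t = cPath A x y})) (a w)))
  sub-e (com-∂ {A = A} {s = s} {a} T r r' S d h) =
    let (c , _) , T = sub-t T; _ , r = sub-D r; _ , r' = sub-D r'; _ , S = sub-D S; _ , d = sub-t d
        _ , h = sub-H h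
    in c , λ w → eq≃ refl (sym (inst₂ {t = a})) (cong El (sym (inst {t = A})))
      (com-∂ (T (liftD w)) (r w) (r' w) (S w)
        (ty≃ (cong El (liftS-wk _ A)) (d (liftCof w (r w) (S w)))) (h w))
  sub-e (tc-Pi {C = C} {p} T P s q b x y) =
    let c , K = sub-cases T P s q b; _ , x = sub-t x; _ , y = sub-t y
    in c , λ w → let cases T P s q b = K w in
      eq≃ refl (sym (inst₂ {t = p})) (sym (inst {t = C}))
        (tc-Pi T P s q b (x w) (y (liftT w (T-El (x w)))))
  sub-e (tc-Sg {C = C} {p} {S} T P s q b x y) =
    let c , K = sub-cases T P s q b; _ , x = sub-t x; _ , y = sub-t y
    in c , λ w → let cases T P s q b = K w in
      eq≃ refl (sym (inst₂ {t = S})) (sym (inst {t = C}))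
        (tc-Sg T P s q b (x w) (y (liftT w (T-El (x w)))))
  sub-e (tc-Path {C = C} {q = Q} {a = A} T P s q b a x y) =
    let c , K = sub-cases T P s q b; _ , a = sub-t a; _ , x = sub-t x; _ , y = sub-t y
    in c , λ {_} {σ} w → let cases T P s q b = K w in eq≃ refl
      (trans (sub-ext (λ { zero → refl ; (suc zero) → refl ; (suc (suc zero)) → refl
                         ; (suc (suc (suc zero))) → sym (inst {t = A})
                         ; (suc (suc (suc (suc zero)))) → sym (inst {t = A})
                         ; (suc (suc (suc (suc (suc _))))) → refl })
                      (sub (liftSⁿ 5 σ) Q))
             (sym (inst₅ {t = Q})))
      (sym (inst {t = C}))
      (tc-Path T P s q b (a (liftD w))
        (ty≃ (cong El (inst {t = A})) (x w)) (ty≃ (cong El (inst {t = A})) (y w)))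
  sub-e (tc-Bool {C = C} T P s q b) =
    let c , K = sub-cases T P s q b
    in c , λ w → let cases T P s q b = K w in eqt≃ (sym (inst {t = C})) (tc-Bool T P s q b)

-- The substitution theorem for renamings and for typed substitutions.

subE-ext : σ ≗ τ → ∀ e → subE σ e ≃ subE τ e
subE-ext h dim = refl
subE-ext h (cof φ) = cong cof (sub-ext h φ)
subE-ext h (ty A) = cong ty (sub-ext h A)

subE-id : ∀ e → subE var e ≃ e
subE-id dim = refl
subE-id (cof φ) = cong cof (sub-id φ)
subE-id (ty A) = cong ty (sub-id A)

subE-suc : ∀ e → wkE e ≃ subE (var ∘ suc) e
subE-suc dim = refl
subE-suc (cof φ) = cong cof (ren-sub suc φ)
subE-suc (ty A) = cong ty (ren-sub suc A)

subE-lift : ∀ σ e → wkE (subE σ e) ≃ subE (liftS σ) (wkE e)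
subE-lift σ dim = refl
subE-lift σ (cof φ) = cong cof (sym (liftS-wk σ φ))
subE-lift σ (ty A) = cong ty (sym (liftS-wk σ A))

subE-wkE : ∀ σ e → subE (σ ∘ suc) e ≃ subE σ (wkE e)
subE-wkE σ dim = refl
subE-wkE σ (cof φ) = cong cof (sym (sub-ren σ suc φ))
subE-wkE σ (ty A) = cong ty (sym (sub-ren σ suc A))

subE-sub : ∀ τ σ e → subE τ (subE σ e) ≃ subE (σ ⨟ τ) e
subE-sub τ σ dim = refl
subE-sub τ σ (cof φ) = cong cof (sub-sub τ σ φ)
subE-sub τ σ (ty A) = cong ty (sub-sub τ σ A)

var-inhabits : ∀ {x} e → ⊢ Γ → Γ ∋ x ⦂ e → Inhabits Γ (var x) e
var-inhabits dim ok v = d-var ok v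
var-inhabits (cof φ) ok v = ⊨-hyp ok v
var-inhabits (ty A) ok v = t-var ok v

∋≃ : ∀ {x e e'} → e ≃ e' → Γ ∋ x ⦂ e → Γ ∋ x ⦂ e'
∋≃ refl v = v

Inhabits≃ : ∀ {t t' e e'} → t ≃ t' → e ≃ e' → Inhabits Γ t e → Inhabits Γ t' e'
Inhabits≃ refl refl d = d

record Renames (Δ : Ctx) (σ : Sub) (Γ : Ctx) : Set where
  field
    ok    : ⊢ Δ
    index : Ren
    agree : Agree index σ
    var∋  : ∀ {x e} → Γ ∋ x ⦂ e → Δ ∋ index x ⦂ subE σ e

inhR : ∀ {x e} → Renames Δ σ Γ → Γ ∋ x ⦂ e → Inhabits Δ (σ x) (subE σ e)
inhR {x = x} {e} w v = Inhabits≃ (Renames.agree w x) refl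
  (var-inhabits (subE _ e) (Renames.ok w) (Renames.var∋ w v))

liftR-renames : ∀ e → Renames Δ σ Γ → WfE Δ (subE σ e) →
                Renames (Δ ▷ subE σ e) (liftS σ) (Γ ▷ e)
liftR-renames {σ = σ} e w wf = record
  { ok = ▷-ok (Renames.ok w) wf
  ; index = liftR (Renames.index w)
  ; agree = liftR-agree (Renames.agree w)
  ; var∋ = λ { here → ∋≃ (subE-lift σ e) here
             ; (there {e = e'} v) → ∋≃ (subE-lift σ e') (there (Renames.var∋ w v)) } }

module Weakening = Substitution Renames Renames.ok inhR liftR-renames

wk-renames : ∀ {e} → ⊢ Γ ▷ e → Renames (Γ ▷ e) (var ∘ suc) Γ
wk-renames ok = record
  { ok = ok ; index = suc ; agree = λ _ → refl
  ; var∋ = λ {_} {e} v → ∋≃ (subE-suc e) (there v) }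

wk-inhabits : ∀ {e} e' → ⊢ Γ ▷ e → Inhabits Γ t e' → Inhabits (Γ ▷ e) (wk t) (wkE e')
wk-inhabits {t = t} e' ok d = Inhabits≃ (sym (ren-sub suc t)) (sym (subE-suc e')) (go e' d)
  where
  w = wk-renames ok
  go : ∀ e' → Inhabits _ t e' → Inhabits _ (sub (var ∘ suc) t) (subE (var ∘ suc) e')
  go dim d = proj₂ (Weakening.sub-D d) w
  go (cof φ) d = proj₂ (Weakening.sub-H d) w
  go (ty A) d = proj₂ (Weakening.sub-t d) w

record TSub (Δ : Ctx) (σ : Sub) (Γ : Ctx) : Set where
  field
    ok    : ⊢ Δ
    inh   : ∀ {x e} → Γ ∋ x ⦂ e → Inhabits Δ (σ x) (subE σ e)

liftTS : ∀ e → TSub Δ σ Γ → WfE Δ (subE σ e) → TSub (Δ ▷ subE σ e) (liftS σ) (Γ ▷ e)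
liftTS {Δ} {σ} e w wf = record
  { ok = ok
  ; inh = λ { here → Inhabits≃ refl (subE-lift σ e) (var-inhabits _ ok here)
            ; (there {e = e'} v) → Inhabits≃ refl (subE-lift σ e')
                                     (wk-inhabits (subE σ e') ok (TSub.inh w v)) } }
  where ok = ▷-ok (TSub.ok w) wf

inhTS : ∀ {x e} → TSub Δ σ Γ → Γ ∋ x ⦂ e → Inhabits Δ (σ x) (subE σ e)
inhTS w v = TSub.inh w v

open Substitution TSub TSub.ok inhTS liftTS

dimS : Γ ⊢ᵈ r → TSub Δ σ Γ → Δ ⊢ᵈ sub σ r
dimS d = proj₂ (sub-D d)

formS : Γ ⊢ᶠ φ → TSub Δ σ Γ → Δ ⊢ᶠ sub σ φ
formS d = proj₂ (sub-F d)

holdsS : Γ ⊨ φ → TSub Δ σ Γ → Δ ⊨ sub σ φ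
holdsS d = proj₂ (sub-H d)

tyS : Γ ⊢ᵗ A → TSub Δ σ Γ → Δ ⊢ᵗ sub σ A
tyS d = proj₂ (sub-T d)

tyeqS : Γ ⊢ᵗ A ≡ B → TSub Δ σ Γ → Δ ⊢ᵗ sub σ A ≡ sub σ B
tyeqS d = proj₂ (sub-TE d)

tmS : Γ ⊢ a ∶ A → TSub Δ σ Γ → Δ ⊢ sub σ a ∶ sub σ A
tmS d = proj₂ (sub-t d)

eqS : Γ ⊢ a ≡ b ∶ A → TSub Δ σ Γ → Δ ⊢ sub σ a ≡ sub σ b ∶ sub σ A
eqS d = proj₂ (sub-e d)

idTS : ⊢ Γ → TSub Γ var Γ
idTS ok = record { ok = ok ; inh = λ {_} {e} v → Inhabits≃ refl (sym (subE-id e)) (var-inhabits e ok v) }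

extTS : TSub Δ σ Γ → σ ≗ τ → TSub Δ τ Γ
extTS w h = record
  { ok = TSub.ok w ; inh = λ {x} {e} v → Inhabits≃ (h x) (subE-ext h e) (TSub.inh w v) }

wkTS : ∀ {e} → ⊢ Γ ▷ e → TSub (Γ ▷ e) (var ∘ suc) Γ
wkTS ok = record
  { ok = ok ; inh = λ {_} {e} v → Inhabits≃ refl (subE-suc e) (var-inhabits _ ok (there v)) }

infixr 5 _∷TS_
_∷TS_ : ∀ {e} → Inhabits Δ t (subE σ e) → TSub Δ σ Γ → TSub Δ (t ∷ₛ σ) (Γ ▷ e)
_∷TS_ {e = e} d w = record
  { ok = TSub.ok w
  ; inh = λ { here → Inhabits≃ refl (subE-wkE _ e) d
            ; (there {e = e'} v) → Inhabits≃ refl (subE-wkE _ e') (TSub.inh w v) } }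

tailTS : ∀ {e} → TSub Δ σ (Γ ▷ e) → TSub Δ (σ ∘ suc) Γ
tailTS {σ = σ} w = record
  { ok = TSub.ok w ; inh = λ {_} {e} v → Inhabits≃ refl (sym (subE-wkE σ e)) (TSub.inh w (there v)) }

headTS : ∀ {e} → TSub Δ σ (Γ ▷ e) → Inhabits Δ (σ 0) (subE (σ ∘ suc) e)
headTS {σ = σ} {e = e} w = Inhabits≃ refl (sym (subE-wkE σ e)) (TSub.inh w here)

_⨟TS_ : ∀ {Θ} → TSub Δ σ Γ → TSub Θ τ Δ → TSub Θ (σ ⨟ τ) Γ
_⨟TS_ {Δ} {σ} {τ = τ} {Θ} w v = record
  { ok = TSub.ok v
  ; inh = λ {_} {e} x → Inhabits≃ refl (subE-sub τ σ e) (go (subE σ e) (TSub.inh w x)) }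
  where
  go : ∀ {t} e → Inhabits Δ t e → Inhabits Θ (sub τ t) (subE τ e)
  go dim d = dimS d v
  go (cof φ) d = holdsS d v
  go (ty A) d = tmS d v

instTS : ∀ {e} → ⊢ Γ → Inhabits Γ t e → TSub Γ (t ∷ₛ var) (Γ ▷ e)
instTS {e = e} ok d = Inhabits≃ refl (sym (subE-id e)) d ∷TS idTS ok

-- Substitutability of a context entry, specialised to the identity, is its well-formedness. This
-- gives the well-formed context of any derivation without another induction.
SubC-ok : SubC Γ → ⊢ Γ
SubC-ok {ε} _ = ε-ok
SubC-ok {Γ ▷ e} (c , F) = ▷-ok ok (subst (WfE _) (subE-id e) (F (idTS ok)))
  where ok = SubC-ok c

ok-D : Γ ⊢ᵈ r → ⊢ Γ
ok-D d = SubC-ok (proj₁ (sub-D d))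

ok-T : Γ ⊢ᵗ A → ⊢ Γ
ok-T d = SubC-ok (proj₁ (sub-T d))

ok-t : Γ ⊢ a ∶ A → ⊢ Γ
ok-t d = SubC-ok (proj₁ (sub-t d))

ok-e : Γ ⊢ a ≡ b ∶ A → ⊢ Γ
ok-e d = SubC-ok (proj₁ (sub-e d))

ok-tail : ∀ {e} → ⊢ Γ ▷ e → ⊢ Γ
ok-tail ok = SubC-ok (proj₁ (sub-C ok))

ty-of : ⊢ Γ ▷ ty A → Γ ⊢ᵗ A
ty-of (ty-ok T) = T

form-of : ⊢ Γ ▷ cof φ → Γ ⊢ᶠ φ
form-of (cof-ok F) = F

wkD : ∀ {e} → ⊢ Γ ▷ e → Γ ⊢ᵈ r → Γ ▷ e ⊢ᵈ wk r
wkD ok d = wk-inhabits dim ok d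

wkt : ∀ {e} → ⊢ Γ ▷ e → Γ ⊢ a ∶ A → Γ ▷ e ⊢ wk a ∶ wk A
wkt {A = A} ok d = wk-inhabits (ty A) ok d

wkT : ∀ {e} → ⊢ Γ ▷ e → Γ ⊢ᵗ A → Γ ▷ e ⊢ᵗ wk A
wkT {A = A} ok d = subst (_ ⊢ᵗ_) (sym (ren-sub suc A)) (tyS d (wkTS ok))

wkF : ∀ {e} → ⊢ Γ ▷ e → Γ ⊢ᶠ φ → Γ ▷ e ⊢ᶠ wk φ
wkF {φ = φ} ok d = subst (_ ⊢ᶠ_) (sym (ren-sub suc φ)) (formS d (wkTS ok))

wke : ∀ {e} → ⊢ Γ ▷ e → Γ ⊢ a ≡ b ∶ A → Γ ▷ e ⊢ wk a ≡ wk b ∶ wk A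
wke {a = a} {b} {A} ok d =
  eq≃ (sym (ren-sub suc a)) (sym (ren-sub suc b)) (sym (ren-sub suc A)) (eqS d (wkTS ok))

wk₁TS : ∀ {e e'} → ⊢ Γ ▷ e' ▷ wkE e → TSub (Γ ▷ e' ▷ wkE e) (var ∘ liftR suc) (Γ ▷ e)
wk₁TS {e = e} ok = extTS
  (Inhabits≃ refl (trans (cong wkE (subE-suc e)) (wk-wk e)) (var-inhabits (wkE (wkE e)) ok here)
    ∷TS (wkTS (ok-tail ok) ⨟TS wkTS ok))
  (λ { zero → refl ; (suc x) → refl })
  where
  wk-wk : ∀ e → wkE (subE (var ∘ suc) e) ≃ subE ((var ∘ suc) ⨟ (var ∘ suc)) e
  wk-wk e = trans (subE-suc (subE (var ∘ suc) e)) (subE-sub _ _ e)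

wk₁t : ∀ {e e'} → ⊢ Γ ▷ e' ▷ wkE e → Γ ▷ e ⊢ a ∶ A →
       Γ ▷ e' ▷ wkE e ⊢ ren (liftR suc) a ∶ ren (liftR suc) A
wk₁t ok d = tm≃ (sym (ren-sub _ _)) (sym (ren-sub _ _)) (tmS d (wk₁TS ok))

wk₁e : ∀ {e e'} → ⊢ Γ ▷ e' ▷ wkE e → Γ ▷ e ⊢ a ≡ b ∶ A →
       Γ ▷ e' ▷ wkE e ⊢ ren (liftR suc) a ≡ ren (liftR suc) b ∶ ren (liftR suc) A
wk₁e ok d = eq≃ (sym (ren-sub _ _)) (sym (ren-sub _ _)) (sym (ren-sub _ _)) (eqS d (wk₁TS ok))

lift-wk-wk : ∀ t → ren (liftR suc) (wk t) ≃ wk (wk t)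
lift-wk-wk t = trans (ren-ren (liftR suc) suc t) (sym (ren-ren suc suc t))

-- Functionality is only available for substitutions that agree literally on dimensions: the
-- type of a split need not be well-formed, so that a split over one formula cannot be retyped
-- as a split over an equivalent one.

Related : Ctx → Tm → Tm → Entry → Set
Related Γ t u dim = t ≃ u
Related Γ t u (cof φ) = ⊤
Related Γ t u (ty A) = Γ ⊢ t ≡ u ∶ A

record ESub (Δ : Ctx) (σ σ' : Sub) (Γ : Ctx) : Set where
  field
    left  : TSub Δ σ Γ
    right : TSub Δ σ' Γ
    rel   : ∀ {x e} → Γ ∋ x ⦂ e → Related Δ (σ x) (σ' x) (subE σ e)
open ESub

data EqE (Γ : Ctx) : Entry → Entry → Set where
  eq-dim : EqE Γ dim dim
  eq-cof : EqE Γ (cof φ) (cof φ)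
  eq-ty  : Γ ⊢ᵗ A ≡ B → EqE Γ (ty A) (ty B)

Related≃ : ∀ {t t' u u' e e'} → t ≃ t' → u ≃ u' → e ≃ e' → Related Γ t u e → Related Γ t' u' e'
Related≃ refl refl refl d = d

wk-related : ∀ {e} e' → ⊢ Γ ▷ e → Related Γ t u e' → Related (Γ ▷ e) (wk t) (wk u) (wkE e')
wk-related dim ok d = cong wk d
wk-related (cof φ) ok d = _
wk-related (ty A) ok d = wke ok d

wk-tyeq : ∀ {e} → ⊢ Γ ▷ e → Γ ⊢ᵗ A ≡ B → Γ ▷ e ⊢ᵗ wk A ≡ wk B
wk-tyeq {A = A} {B} ok d =
  subst₂ (_ ⊢ᵗ_≡_) (sym (ren-sub suc A)) (sym (ren-sub suc B)) (tyeqS d (wkTS ok))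

-- Both lifted substitutions must land in the same context, which is extended by the left instance
-- of `e`; the right one converts the new variable along the equation of the two instances.
liftES : ∀ e → ESub Δ σ σ' Γ → WfE Δ (subE σ e) → EqE Δ (subE σ e) (subE σ' e) →
         ESub (Δ ▷ subE σ e) (liftS σ) (liftS σ') (Γ ▷ e)
liftES {Δ} {σ} {σ'} e w wf eq = record
  { left = liftTS e (left w) wf
  ; right = record
      { ok = ok
      ; inh = λ { here → Inhabits≃ refl (subE-lift σ' e) (var₀ eq ok)
                ; (there {e = e'} v) → Inhabits≃ refl (subE-lift σ' e')
                    (wk-inhabits (subE σ' e') ok (TSub.inh (right w) v)) } }
  ; rel = λ { here → Related≃ refl refl (subE-lift σ e) (rel₀ (subE σ e) ok)
            ; (there {e = e'} v) → Related≃ refl refl (subE-lift σ e')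
                (wk-related (subE σ e') ok (rel w v)) } }
  where
  ok = ▷-ok (TSub.ok (left w)) wf
  var₀ : ∀ {e e'} → EqE Δ e e' → ⊢ Δ ▷ e → Inhabits (Δ ▷ e) (var 0) (wkE e')
  var₀ eq-dim ok = d-var ok here
  var₀ eq-cof ok = ⊨-hyp ok here
  var₀ (eq-ty e) ok = t-conv (t-var ok here) (wk-tyeq ok e)
  rel₀ : ∀ e → ⊢ Δ ▷ e → Related (Δ ▷ e) (var 0) (var 0) (wkE e)
  rel₀ dim ok = refl
  rel₀ (cof φ) ok = _
  rel₀ (ty A) ok = ≡-refl (t-var ok here)

FunE : Ctx → Entry → Set
FunE Γ e = ∀ {Δ σ σ'} → ESub Δ σ σ' Γ → WfE Δ (subE σ e) × EqE Δ (subE σ e) (subE σ' e)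

FunC : Ctx → Set
FunC ε = ⊤
FunC (Γ ▷ e) = FunC Γ × FunE Γ e

Functional : Ctx → (Ctx → Sub → Sub → Set) → Set
Functional Γ J = FunC Γ × (∀ {Δ σ σ'} → ESub Δ σ σ' Γ → J Δ σ σ')

liftES-dim : ESub Δ σ σ' Γ → ESub (Δ ▷ dim) (liftS σ) (liftS σ') (Γ ▷ dim)
liftES-dim w = liftES dim w wf-dim eq-dim

liftES-ty : ESub Δ σ σ' Γ → Δ ⊢ᵗ sub σ A → Δ ⊢ᵗ sub σ A ≡ sub σ' A →
            ESub (Δ ▷ ty (sub σ A)) (liftS σ) (liftS σ') (Γ ▷ ty A)
liftES-ty w T e = liftES (ty _) w (wf-ty T) (eq-ty e)

liftES-E : ∀ {e} → FunE Γ e → ESub Δ σ σ' Γ → ESub (Δ ▷ subE σ e) (liftS σ) (liftS σ') (Γ ▷ e)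
liftES-E F w = liftES _ w (proj₁ (F w)) (proj₂ (F w))

liftES-Pi : ESub Δ σ σ' Γ → ESub (ctxPi Δ) (liftSⁿ 2 σ) (liftSⁿ 2 σ') (ctxPi Γ)
liftES-Pi w with ctxPi-ok (TSub.ok (left w))
... | ty-ok T = liftES-ty (liftES-ty w (T-U ok) (Ty-refl (T-U ok))) T (Ty-refl T)
  where ok = TSub.ok (left w)

liftES-Path : ESub Δ σ σ' Γ → ESub (ctxPath Δ) (liftSⁿ 5 σ) (liftSⁿ 5 σ') (ctxPath Γ)
liftES-Path {Δ = Δ} w =
  liftES-ty (liftES-ty (liftES-ty (liftES-ty (liftES-ty w
    P₀ (Ty-refl P₀)) P₁ (Ty-refl P₁)) P₂ (Ty-refl P₂)) P₃ (Ty-refl P₃)) P₄ (Ty-refl P₄)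
  where
  P₀ = T-U (TSub.ok (left w))
  P₁ = T-U (ty-ok P₀)
  ok₂ = ty-ok P₁
  P₂ = T-Path (T-U (dim-ok ok₂)) (t-var ok₂ (there here)) (t-var ok₂ here)
  ok₃ = ty-ok P₂
  P₃ = T-El (t-var ok₃ (there (there here)))
  P₄ = T-El (t-var (ty-ok P₃) (there (there here)))

fun-D : Γ ⊢ᵈ r → ESub Δ σ σ' Γ → sub σ r ≃ sub σ' r
fun-D (d-0 _) w = refl
fun-D (d-1 _) w = refl
fun-D (d-var _ v) w = rel w v

fun-F : Γ ⊢ᶠ φ → ESub Δ σ σ' Γ → sub σ φ ≃ sub σ' φ
fun-F (f-eq r s) w = cong₂ _≐_ (fun-D r w) (fun-D s w)
fun-F (f-or F G) w = cong₂ _∨_ (fun-F F w) (fun-F G w)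

fun-C : ⊢ Γ → FunC Γ
fun-T : Γ ⊢ᵗ A → Functional Γ (λ Δ σ σ' → Δ ⊢ᵗ sub σ A ≡ sub σ' A)
fun-t : Γ ⊢ a ∶ A → Functional Γ (λ Δ σ σ' → Δ ⊢ sub σ a ≡ sub σ' a ∶ sub σ A)

fun-C ε-ok = _
fun-C (dim-ok ok) = fun-C ok , λ w → wf-dim , eq-dim
fun-C (cof-ok {φ = φ} F) = fun-FC F , λ {_} {σ} w →
  wf-cof (formS F (left w)) , subst (λ ψ → EqE _ (cof (sub σ φ)) (cof ψ)) (fun-F F w) eq-cof
  where
  fun-DC : ∀ {Γ r} → Γ ⊢ᵈ r → FunC Γ
  fun-DC (d-0 ok) = fun-C ok
  fun-DC (d-1 ok) = fun-C ok
  fun-DC (d-var ok _) = fun-C ok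
  fun-FC : ∀ {Γ φ} → Γ ⊢ᶠ φ → FunC Γ
  fun-FC (f-eq r _) = fun-DC r
  fun-FC (f-or F _) = fun-FC F
fun-C (ty-ok T) =
  let c , e = fun-T T in c , λ w → wf-ty (tyS T (left w)) , eq-ty (e w)

fun-T (T-Pi T S) =
  let c , e = fun-T T; _ , e' = fun-T S
  in c , λ w → let T' = tyS T (left w) in Pi-cong T' (e w) (e' (liftES-ty w T' (e w)))
fun-T (T-Sg T S) =
  let c , e = fun-T T; _ , e' = fun-T S
  in c , λ w → let T' = tyS T (left w) in Sg-cong T' (e w) (e' (liftES-ty w T' (e w)))
fun-T (T-Bool ok) = fun-C ok , λ w → Ty-refl (T-Bool (TSub.ok (left w)))
fun-T (T-Path {A = A} T a b) =
  let (c , _) , T = fun-T T; _ , a = fun-t a; _ , b = fun-t b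
  in c , λ w → Path-cong (T (liftES-dim w)) (eqt≃ (inst {t = A}) (a w)) (eqt≃ (inst {t = A}) (b w))
fun-T (T-U ok) = fun-C ok , λ w → Ty-refl (T-U (TSub.ok (left w)))
fun-T (T-El a) = let c , a = fun-t a in c , λ w → El-cong (a w)

fun-t (t-var ok v) = fun-C ok , λ w → rel w v
fun-t (t-conv a e) = let c , a = fun-t a in c , λ w → ≡-conv (a w) (tyeqS e (left w))
fun-t (t-lam T b) =
  let c , e = fun-T T; _ , b = fun-t b
  in c , λ w → let T' = tyS T (left w) in lam-cong T' (b (liftES-ty w T' (e w)))
fun-t (t-app {B = B} f a) =
  let c , f = fun-t f; _ , a = fun-t a
  in c , λ w → eqt≃ (sym (inst {t = B})) (app-cong (f w) (a w))
fun-t (t-pair {B = B} T a b) =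
  let (c , F) , _ = fun-T T; _ , a = fun-t a; _ , b = fun-t b
  in c , λ w → pair-cong (tyS T (left (liftES-E F w))) (a w) (eqt≃ (inst {t = B}) (b w))
fun-t (t-fst p) = let c , p = fun-t p in c , λ w → fst-cong (p w)
fun-t (t-snd {B = B} p) =
  let c , p = fun-t p in c , λ w → eqt≃ (sym (inst {t = B})) (snd-cong (p w))
fun-t (t-tt ok) = fun-C ok , λ w → ≡-refl (t-tt (TSub.ok (left w)))
fun-t (t-ff ok) = fun-C ok , λ w → ≡-refl (t-ff (TSub.ok (left w)))
fun-t (t-if {C = C} T b x y) =
  let (c , F) , T = fun-T T; _ , b = fun-t b; _ , x = fun-t x; _ , y = fun-t y
  in c , λ w → eqt≃ (sym (inst {t = C}))
    (if-cong (T (liftES-E F w)) (b w) (eqt≃ (inst {t = C}) (x w)) (eqt≃ (inst {t = C}) (y w)))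
fun-t (t-plam {a = a} d) =
  let (c , _) , d = fun-t d
  in c , λ w → eqt≃ (cong₂ (Path _) (sym (inst {t = a})) (sym (inst {t = a})))
                    (plam-cong (d (liftES-dim w)))
fun-t (t-papp {A = A} {r = r} p d) =
  let c , p = fun-t p
  in c , λ w → eq≃ refl (cong (papp _) (fun-D d w)) (sym (inst {t = A}))
    (papp-cong (p w) (dimS d (left w)) (dimS d (left w)) (⊨-refl (dimS d (left w))))
fun-t (t-abort h T) =
  let c , _ = fun-T T in c , λ w → ≡-refl (t-abort (holdsS h (left w)) (tyS T (left w)))
fun-t (t-split {Γ} {A = A} {φ} {ψ} {a} {b} h d d' e) =
  let (c , F) , x = fun-t d; (_ , G) , y = fun-t d' in c , λ {Δ} {σ} {σ'} w →
    let wa = liftES-E F w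
        wb = liftES-E G w
        X = eqt≃ (liftS-wk σ A) (x wa)
        Y = eqt≃ (liftS-wk σ A) (y wb)
        compat = sub-split {A = A} {a = a} {b} (sub-e e) (left w)
        Fψ = formS (form-of (ok-t d')) (left w)
        okφ = TSub.ok (left wa)
        okφψ = cof-ok (wkF okφ Fψ)
        Y' = eqt≃ (lift-wk-wk _) (wk₁e okφψ Y)
    in eq≃ refl (cong₂ (λ φ ψ → split φ _ ψ _) (fun-F (form-of (ok-t d)) w)
                                               (fun-F (form-of (ok-t d')) w)) refl
      (split-cong (holdsS h (left w)) X Y compat
        -- The right-hand branches have to agree at the left instance of `A`. Substituting `σ'` into
        -- the premise would give their agreement at the right instance, and without a derivation of
        -- `A` the two instances cannot be converted; hence the detour through the left-hand
        -- branches.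
        (≡-trans (≡-sym (wke okφψ X)) (≡-trans compat Y')))
fun-t (t-cPi a b) =
  let c , e = fun-t a; _ , e' = fun-t b
  in c , λ w → let a' = tmS a (left w)
               in cPi-cong a' (e w) (e' (liftES-ty w (T-El a') (El-cong (e w))))
fun-t (t-cSg a b) =
  let c , e = fun-t a; _ , e' = fun-t b
  in c , λ w → let a' = tmS a (left w)
               in cSg-cong a' (e w) (e' (liftES-ty w (T-El a') (El-cong (e w))))
fun-t (t-cBool ok) = fun-C ok , λ w → ≡-refl (t-cBool (TSub.ok (left w)))
fun-t (t-cPath {a = a} d x y) =
  let (c , _) , d = fun-t d; _ , x = fun-t x; _ , y = fun-t y
  in c , λ w → cPath-cong (d (liftES-dim w)) (eqt≃ (cong El (inst {t = a})) (x w))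
                          (eqt≃ (cong El (inst {t = a})) (y w))
fun-t (t-coe {A = A} T r r' a) =
  let (c , _) , T = fun-t T; _ , a = fun-t a
  in c , λ w → let r₁ = dimS r (left w); r₂ = dimS r' (left w)
    in eq≃ refl (cong₂ (λ r r' → coe r r' _ _) (fun-D r w) (fun-D r' w)) (cong El (sym (inst {t = A})))
      (coe-cong (T (liftES-dim w)) r₁ r₁ (⊨-refl r₁) r₂ r₂ (⊨-refl r₂)
        (eqt≃ (cong El (inst {t = A})) (a w)))
fun-t (t-com {A = A} {r} {r'} {s} {a} T d d' e x) =
  let (c , _) , T' = fun-t T; (_ , F) , x' = fun-t x
  in c , λ {Δ} {σ} {σ'} w →
    let r₁ = dimS d (left w); r₂ = dimS d' (left w); s₁ = dimS e (left w)
    in eq≃ refl (cong₃ (λ r r' s → com r r' s _ _) (fun-D d w) (fun-D d' w) (fun-D e w))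
            (cong El (sym (inst {t = A})))
      (com-cong (T' (liftES-dim w)) r₁ r₁ (⊨-refl r₁) r₂ r₂ (⊨-refl r₂) s₁ s₁ (⊨-refl s₁)
        (subst (λ φ → Δ ▷ dim ▷ cof φ ⊢ sub (liftSⁿ 2 σ) a ≡ sub (liftSⁿ 2 σ') a ∶ El (wk (sub (liftS σ) A)))
           (partialCof-sub σ r s)
           (eqt≃ (cong El (liftS-wk _ A)) (x' (liftES-E F (liftES-dim w)))))
        (subst₂ (λ r s → Δ ▷ dim ▷ cof (partialCof r s) ⊢ sub (liftSⁿ 2 σ') a ∶ El (wk (sub (liftS σ') A)))
           (sym (fun-D d w)) (sym (fun-D e w))
           (ty≃ (cong El (liftS-wk _ A))
             (tmS x (liftCof (right w) (dimS d (right w)) (dimS e (right w)))))))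
fun-t (t-tcase {C = C} T p s q b x) =
  let (c , F) , T = fun-T T; _ , p = fun-t p; _ , s = fun-t s; _ , q = fun-t q
      _ , b = fun-t b; _ , x = fun-t x
  in c , λ w → eqt≃ (sym (inst {t = C}))
    (tcase-cong (T (liftES-E F w)) (eqt≃ (tcPi-sub {t = C}) (p (liftES-Pi w)))
      (eqt≃ (tcSg-sub {t = C}) (s (liftES-Pi w))) (eqt≃ (tcPath-sub {t = C}) (q (liftES-Path w)))
      (eqt≃ (inst {t = C}) (b w)) (x w))

-- Instantiation, and equality by cases on a formula.

tmI : ∀ {e} → Γ ▷ e ⊢ b ∶ B → Inhabits Γ t e → Γ ⊢ b [ t ]₀ ∶ B [ t ]₀
tmI d i = tmS d (instTS (ok-tail (ok-t d)) i)

reflES : TSub Δ σ Γ → ESub Δ σ σ Γ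
reflES {σ = σ} w = record { left = w ; right = w ; rel = λ {_} {e} v → go (subE σ e) (TSub.inh w v) }
  where
  go : ∀ {t} e → Inhabits Δ t e → Related Δ t t e
  go dim d = refl
  go (cof φ) d = _
  go (ty A) d = ≡-refl d

infixr 5 _∷ES_
_∷ES_ : Δ ⊢ a ≡ a' ∶ sub σ A × (Δ ⊢ a ∶ sub σ A) × (Δ ⊢ a' ∶ sub σ' A) →
        ESub Δ σ σ' Γ → ESub Δ (a ∷ₛ σ) (a' ∷ₛ σ') (Γ ▷ ty A)
_∷ES_ {A = A} (e , d , d') w = record
  { left = d ∷TS left w
  ; right = d' ∷TS right w
  ; rel = λ { here → Related≃ refl refl (subE-wkE _ (ty A)) e
            ; (there {e = e'} v) → Related≃ refl refl (subE-wkE _ e') (rel w v) } }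

tyES : Γ ⊢ᵗ A → ESub Δ σ σ' Γ → Δ ⊢ᵗ sub σ A ≡ sub σ' A
tyES d w = proj₂ (fun-T d) w

tmES : Γ ⊢ a ∶ A → ESub Δ σ σ' Γ → Δ ⊢ sub σ a ≡ sub σ' a ∶ sub σ A
tmES d w = proj₂ (fun-t d) w

instES : Γ ⊢ a ≡ a' ∶ A → Γ ⊢ a ∶ A → Γ ⊢ a' ∶ A → ESub Γ (a ∷ₛ var) (a' ∷ₛ var) (Γ ▷ ty A)
instES e d d' = (eqt≃ (sym (sub-id _)) e , ty≃ (sym (sub-id _)) d , ty≃ (sym (sub-id _)) d')
  ∷ES reflES (idTS (ok-e e))

-- Case analysis for equations is not primitive. By `split-η` each side is the split of its own
-- weakenings, and `split-cong` compares the branches.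
or-eq : Γ ⊨ φ ∨ ψ → Γ ⊢ a ∶ A → Γ ⊢ b ∶ A →
        Γ ▷ cof φ ⊢ wk a ≡ wk b ∶ wk A → Γ ▷ cof ψ ⊢ wk a ≡ wk b ∶ wk A → Γ ⊢ a ≡ b ∶ A
or-eq h a b e e' =
  ≡-trans (split-η h a) (≡-trans (split-cong h e e' (same a) (same b)) (≡-sym (split-η h b)))
  where
  okφ = ok-e e
  okφψ = cof-ok (wkF okφ (form-of (ok-e e')))
  same : ∀ {a} → _ ⊢ a ∶ _ → _
  same {a} d = eq≃ refl (sym (lift-wk-wk a)) refl (≡-refl (wkt okφψ (wkt okφ d)))

bsep∂ : Γ ⊢ A ∶ U → Γ ⊢ᵈ r → Γ ⊢ a ∶ El A → Γ ⊢ b ∶ El A →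
        Γ ▷ cof (r ≐ i0) ⊢ wk a ≡ wk b ∶ El (wk A) →
        Γ ▷ cof (r ≐ i1) ⊢ wk a ≡ wk b ∶ El (wk A) → Γ ⊢ a ≡ b ∶ El A
bsep∂ {A = A} {a = a} {b} T r d d' e₀ e₁ =
  bsep T r d d' (or-eq (⊨-hyp ok∂ here) (wkt ok∂ d) (wkt ok∂ d') (under e₀) (under e₁))
  where
  ok∂ = cof-ok (f-or (form-of (ok-e e₀)) (form-of (ok-e e₁)))
  under : ∀ {φ} → _ ▷ cof φ ⊢ wk a ≡ wk b ∶ El (wk A) →
          _ ▷ cof (wk φ) ⊢ wk (wk a) ≡ wk (wk b) ∶ El (wk (wk A))
  under e = eq≃ (lift-wk-wk a) (lift-wk-wk b) (cong El (lift-wk-wk A))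
    (wk₁e (cof-ok (wkF ok∂ (form-of (ok-e e)))) e)

-- In a context where tt and ff are identified, Bool is identified with a path type whose
-- elements are all equal by boundary separation.

Clash : Ctx → Set
Clash Γ = Γ ⊢ tt ≡ ff ∶ Bool

-- `if` with motive `U` sends `tt` to `a` and `ff` to `b`.
clash-U : Clash Γ → Γ ⊢ a ∶ U → Γ ⊢ b ∶ U → Γ ⊢ a ≡ b ∶ U
clash-U e a b = ≡-trans (≡-sym (if-βtt T a b))
  (≡-trans (if-cong (Ty-refl T) e (≡-refl a) (≡-refl b)) (if-βff T a b))
  where T = T-U (ty-ok (T-Bool (ok-e e)))

-- After η a loop is a line that is `tt` at both ends, and boundary separation in the bound
-- dimension leaves only the constant one. The type is `El cBool` and not `Bool` because boundary
-- separation applies to elements of codes.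
loop-unique : Γ ⊢ p ∶ Path (El cBool) tt tt → Γ ⊢ p ≡ plam tt ∶ Path (El cBool) tt tt
loop-unique {Γ} {p} d =
  ≡-trans (Path-η d)
    (≡-conv (plam-cong {A = El cBool} line)
      (Path-cong (Ty-refl (T-El (t-cBool okd))) (end i0 Path-∂₀) (end i1 Path-∂₁)))
  where
  okd = dim-ok (ok-t d)
  wkd = wkt okd d
  v₀ = d-var okd here
  ttE : ∀ {Γ} → ⊢ Γ → Γ ⊢ tt ∶ El cBool
  ttE ok = t-conv (t-tt ok) (Ty-sym (El-cBool ok))
  end : ∀ δ → (∀ {Γ p} → Γ ⊢ p ∶ Path (El cBool) tt tt → Γ ⊢ papp p δ ≡ tt ∶ El cBool) →
        Γ ⊢ papp (wk p [ δ ]₀) δ ≡ tt ∶ El cBool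
  end δ ∂δ = eq≃ (cong (λ p → papp p δ) (sym (wk-inst δ p))) refl refl (∂δ d)
  side : ∀ {δ} → wk δ ≃ δ → (∀ {Γ} → ⊢ Γ → Γ ⊢ᵈ δ) →
         (∀ {Γ p} → Γ ⊢ p ∶ Path (El cBool) tt tt → Γ ⊢ papp p δ ≡ tt ∶ El cBool) →
         Γ ▷ dim ▷ cof (var 0 ≐ δ) ⊢ papp (wk (wk p)) (var 1) ≡ tt ∶ El cBool
  side {δ} wkδ dδ ∂δ = ≡-trans
    (papp-cong (≡-refl (wkt okφ wkd)) (wkD okφ v₀) (dδ okφ)
      (subst (λ r → Γ ▷ dim ▷ cof (var 0 ≐ δ) ⊨ var 1 ≐ r) wkδ (⊨-hyp okφ here)))
    (∂δ (wkt okφ wkd))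
    where okφ = cof-ok (f-eq v₀ (dδ okd))
  line : Γ ▷ dim ⊢ papp (wk p) (var 0) ≡ tt ∶ El cBool
  line = bsep∂ (t-cBool okd) v₀ (t-papp wkd v₀) (ttE okd) 
    (side refl d-0 Path-∂₀) (side refl d-1 Path-∂₁)

clash-Bool : Clash Γ → Γ ⊢ M ∶ Bool → Γ ⊢ M ≡ tt ∶ Bool
clash-Bool {Γ} e d = ≡-trans (≡-conv (loop-unique (t-conv d Bool≡loop)) (Ty-sym Bool≡loop))
  (≡-sym (≡-conv (loop-unique (t-conv (t-tt ok) Bool≡loop)) (Ty-sym Bool≡loop)))
  where
  ok = ok-e e
  ttE = t-conv (t-tt ok) (Ty-sym (El-cBool ok))
  Bool≡loop : Γ ⊢ᵗ Bool ≡ Path (El cBool) tt tt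
  Bool≡loop = Ty-trans (Ty-sym (El-cBool ok))
    (Ty-trans (El-cong (clash-U e (t-cBool ok) (t-cPath (t-cBool (dim-ok ok)) ttE ttE)))
              (El-cPath (t-cBool (dim-ok ok)) ttE ttE))

-- Codes with different heads are separated by typecase into Bool.

data Head : Set where
  hPi hSg hPath hBool : Head

_==_ : Head → Head → 𝔹
hPi == hPi = true
hSg == hSg = true
hPath == hPath = true
hBool == hBool = true
_ == _ = false

lit : 𝔹 → Tm
lit true = tt
lit false = ff

data Coded (Γ : Ctx) : Head → Tm → Set where
  pi   : Γ ⊢ a ∶ U → Γ ▷ ty (El a) ⊢ b ∶ U → Coded Γ hPi (cPi a b)
  sg   : Γ ⊢ a ∶ U → Γ ▷ ty (El a) ⊢ b ∶ U → Coded Γ hSg (cSg a b)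
  path : Γ ▷ dim ⊢ a ∶ U → Γ ⊢ x ∶ El (a [ i0 ]₀) → Γ ⊢ y ∶ El (a [ i1 ]₀) →
         Coded Γ hPath (cPath a x y)
  bool : ⊢ Γ → Coded Γ hBool cBool

is : Head → Tm → Tm
is h a = tcase Bool (lit (h == hPi)) (lit (h == hSg)) (lit (h == hPath)) (lit (h == hBool)) a

is-β : ∀ {h h'} → ⊢ Γ → Coded Γ h' a → Γ ⊢ is h a ≡ lit (h == h') ∶ Bool
is-β {Γ} {h = h} ok H = go H
  where
  lit-t : ∀ {Γ} b → ⊢ Γ → Γ ⊢ lit b ∶ Bool
  lit-t true = t-tt
  lit-t false = t-ff
  lit-sub : ∀ b → sub σ (lit b) ≃ lit b
  lit-sub true = refl
  lit-sub false = refl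
  T = T-Bool (ty-ok (T-U ok))
  bp = lit-t (h == hPi) (ctxPi-ok ok)
  bs = lit-t (h == hSg) (ctxPi-ok ok)
  bq = lit-t (h == hPath) (ctxPath-ok ok)
  bb = lit-t (h == hBool) ok
  go : ∀ {h' a} → Coded Γ h' a → Γ ⊢ is h a ≡ lit (h == h') ∶ Bool
  go (pi x y) = eq≃ refl (lit-sub (h == hPi)) refl (tc-Pi T bp bs bq bb x y)
  go (sg x y) = eq≃ refl (lit-sub (h == hSg)) refl (tc-Sg T bp bs bq bb x y)
  go (path a x y) = eq≃ refl (lit-sub (h == hPath)) refl (tc-Path T bp bs bq bb a x y)
  go (bool _) = tc-Bool T bp bs bq bb

is-cong : ∀ {h} → Γ ⊢ a ≡ a' ∶ U → Γ ⊢ is h a ≡ is h a' ∶ Bool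
is-cong {Γ} {h = h} e = tcase-cong (Ty-refl (T-Bool (ty-ok (T-U ok))))
  (rfl (h == hPi) (ctxPi-ok ok)) (rfl (h == hSg) (ctxPi-ok ok)) (rfl (h == hPath) (ctxPath-ok ok))
  (rfl (h == hBool) ok) e
  where
  ok = ok-e e
  rfl : ∀ {Γ} b → ⊢ Γ → Γ ⊢ lit b ≡ lit b ∶ Bool
  rfl true ok = ≡-refl (t-tt ok)
  rfl false ok = ≡-refl (t-ff ok)

heads-clash : ∀ {h h'} → Γ ⊢ a ≡ a' ∶ U → Coded Γ h a → Coded Γ h' a' →
              (h == h') ≃ false → Clash Γ
heads-clash {h = h} {h'} e H H' h≠h' =
  eq≃ (cong lit (==-refl h)) (cong lit h≠h') refl
    (≡-trans (≡-sym (is-β (ok-e e) H)) (≡-trans (is-cong {h = h} e) (is-β (ok-e e) H')))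
  where
  ==-refl : ∀ h → (h == h) ≃ true
  ==-refl hPi = refl
  ==-refl hSg = refl
  ==-refl hPath = refl
  ==-refl hBool = refl

-- Typecase also makes the code formers injective: Π and Σ by sending a code to the pair of
-- its components, Path by applying the stored line of codes to a dimension.

cPath-inj : Γ ⊢ cPath a x y ≡ cPath a' M N ∶ U →
            Coded Γ hPath (cPath a x y) → Coded Γ hPath (cPath a' M N) →
            TSub Δ σ Γ → Δ ⊢ᵈ r → Δ ⊢ sub (r ∷ₛ σ) a ≡ sub (r ∷ₛ σ) a' ∶ U
cPath-inj {Γ} {a} {x} {y} {a'} {M} {N} {Δ} {σ} {r} e (path d u v) (path d' u' v') w dr =
  eq≃ (lift-inst r σ a) (lift-inst r σ a') refl
    (≡-trans (≡-sym (at-r d u v)) (≡-trans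
      (tcase-cong (Ty-refl T) (≡-refl P) (≡-refl P) (≡-refl Q) (≡-refl (t-cBool ok)) (eqS e w))
      (at-r d' u' v')))
  where
  ok = TSub.ok w
  T = T-U (ty-ok (T-U ok))
  P = t-cBool (ctxPi-ok ok)
  ok₅ = ctxPath-ok ok
  wk₅ : ∀ {r} → Δ ⊢ᵈ r → ctxPath Δ ⊢ᵈ wkn 5 r
  wk₅ (d-0 _) = d-0 ok₅
  wk₅ (d-1 _) = d-1 ok₅
  wk₅ (d-var _ v) = d-var ok₅ (there (there (there (there (there v)))))
  -- Counting from 0, the branch variables are the right endpoint, the left endpoint, the line and
  -- its two end codes, so index 2 is the line. Evaluating it at `r` keeps the motive constantly
  -- `U`; the line itself has a type that depends on the end codes.
  Q : ctxPath Δ ⊢ papp (var 2) (wkn 5 r) ∶ U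
  Q = t-papp (t-var ok₅ (there (there here))) (wk₅ dr)
  unwk₅ : ∀ {r M₁ M₂ M₃ M₄ M₅} → Δ ⊢ᵈ r →
          sub (M₁ ∷ₛ M₂ ∷ₛ M₃ ∷ₛ M₄ ∷ₛ M₅ ∷ₛ var) (wkn 5 r) ≃ r
  unwk₅ (d-0 _) = refl
  unwk₅ (d-1 _) = refl
  unwk₅ (d-var _ _) = refl
  at-r : ∀ {a x y} → Γ ▷ dim ⊢ a ∶ U → Γ ⊢ x ∶ El (a [ i0 ]₀) → Γ ⊢ y ∶ El (a [ i1 ]₀) →
         Δ ⊢ tcase U cBool cBool (papp (var 2) (wkn 5 r)) cBool (sub σ (cPath a x y))
           ≡ sub (liftS σ) a [ r ]₀ ∶ U
  at-r {a} d u v = ≡-trans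
    (eq≃ refl (cong (papp _) (unwk₅ dr)) refl
      (tc-Path T P P Q (t-cBool ok) dσ (ty≃ (cong El (inst {t = a})) (tmS u w))
                                       (ty≃ (cong El (inst {t = a})) (tmS v w))))
    (Path-β dσ dr)
    where dσ = tmS d (liftTS dim w wf-dim)

-- Codes for Π and Σ consist of the same data, a code and a family over it. Indexing by the head
-- lets one injectivity proof and one constructor of computable codes serve both.
data Arrow : Head → Tm → Tm → Tm → Set where
  arrPi : Arrow hPi (cPi a b) a b
  arrSg : Arrow hSg (cSg a b) a b

arrow-inj : ∀ {h} → Γ ⊢ c ≡ c' ∶ U → Coded Γ h c → Coded Γ h c' → Arrow h c a b → Arrow h c' a' b' →
            (Γ ⊢ a ≡ a' ∶ U) ×
            (∀ {Δ σ N} → TSub Δ σ Γ → Δ ⊢ N ∶ El (sub σ a) →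
             Δ ⊢ sub (N ∷ₛ σ) b ≡ sub (N ∷ₛ σ) b' ∶ U)
arrow-inj {Γ} {a = a} {b} {a'} {b'} {h = h} e H H' X X' = dom , fibre
  where
  ok = ok-e e
  ok₂ = ctxPi-ok ok
  Fam : ∀ {Γ} → ⊢ Γ → Γ ▷ ty U ⊢ᵗ Pi (El (var 0)) U
  Fam ok = T-Pi (T-El v₀) (T-U (ty-ok (T-El v₀)))
    where v₀ = t-var (ty-ok (T-U ok)) here
  F : Tm
  F = Sg U (Pi (El (var 0)) U)
  -- An arbitrary inhabitant of `F` for the Path and bool branches, which codes with an arrow head
  -- never select.
  default : ∀ {Γ} → ⊢ Γ → Γ ⊢ pair cBool (lam cBool) ∶ F
  default ok = t-pair (Fam ok) (t-cBool ok)
    (t-lam (T-El (t-cBool ok)) (t-cBool (ty-ok (T-El (t-cBool ok)))))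
  okF = ty-ok (T-U ok)
  T = T-Sg (T-U okF) (Fam okF)
  P = t-pair (Fam ok₂) (t-var ok₂ (there here)) (t-var ok₂ here)
  Q = default (ctxPath-ok ok)
  parts : Tm → Tm
  parts = tcase F (pair (var 1) (var 0)) (pair (var 1) (var 0))
            (pair cBool (lam cBool)) (pair cBool (lam cBool))
  parts-β : ∀ {c a b} → Coded Γ h c → Arrow h c a b → Γ ⊢ parts c ≡ pair a (lam b) ∶ F
  parts-β (pi x y) arrPi = tc-Pi T P P Q (default ok) x y
  parts-β (sg x y) arrSg = tc-Sg T P P Q (default ok) x y
  a-t : ∀ {c a b} → Coded Γ h c → Arrow h c a b → Γ ⊢ a ∶ U
  a-t (pi x y) arrPi = x
  a-t (sg x y) arrSg = x
  b-t : ∀ {c a b} → Coded Γ h c → Arrow h c a b → Γ ▷ ty (El a) ⊢ b ∶ U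
  b-t (pi x y) arrPi = y
  b-t (sg x y) arrSg = y
  lam-t : ∀ {a b} → Γ ⊢ a ∶ U → Γ ▷ ty (El a) ⊢ b ∶ U → Γ ⊢ lam b ∶ Pi (El a) U
  lam-t a b = t-lam (T-El a) b
  at = a-t H X
  bt = b-t H X
  at' = a-t H' X'
  bt' = b-t H' X'
  pairs : Γ ⊢ pair a (lam b) ≡ pair a' (lam b') ∶ F
  pairs = ≡-trans (≡-sym (parts-β H X))
    (≡-trans (tcase-cong (Ty-refl T) (≡-refl P) (≡-refl P) (≡-refl Q) (≡-refl (default ok)) e)
             (parts-β H' X'))
  first : ∀ {a b} → Γ ⊢ a ∶ U → Γ ▷ ty (El a) ⊢ b ∶ U → Γ ⊢ fst (pair a (lam b)) ≡ a ∶ U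
  first a b = Sg-β₁ (Fam ok) a (lam-t a b)
  dom = ≡-trans (≡-sym (first at bt)) (≡-trans (fst-cong pairs) (first at' bt'))
  fam-cong : ∀ {a a'} → Γ ⊢ a ∶ U → Γ ⊢ a ≡ a' ∶ U → Γ ⊢ᵗ Pi (El a) U ≡ Pi (El a') U
  fam-cong d e = Pi-cong (T-El d) (El-cong e) (Ty-refl (T-U (ty-ok (T-El d))))
  -- The two families are functions on different domains, so their equation is stated over the first
  -- domain by converting along the equation of domains.
  lams = ≡-trans (≡-sym (Sg-β₂ (Fam ok) at (lam-t at bt)))
    (≡-trans (≡-conv (snd-cong pairs) (fam-cong (t-fst (t-pair (Fam ok) at (lam-t at bt))) (first at bt)))
             (≡-conv (Sg-β₂ (Fam ok) at' (lam-t at' bt')) (fam-cong at' (≡-sym dom))))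
  fibre : ∀ {Δ σ N} → TSub Δ σ Γ → Δ ⊢ N ∶ El (sub σ a) →
          Δ ⊢ sub (N ∷ₛ σ) b ≡ sub (N ∷ₛ σ) b' ∶ U
  fibre {σ = σ} {N} w n = eq≃ (lift-inst N σ b) (lift-inst N σ b') refl
    (≡-trans (≡-sym (Pi-β (tmS bt (liftTS (ty _) w (wf-ty (T-El (tmS at w))))) n))
      (≡-trans (app-cong (eqS lams w) (≡-refl n))
        (Pi-β (tmS bt' (liftTS (ty _) w (wf-ty (T-El (tmS at' w)))))
              (t-conv n (El-cong (eqS dom w))))))

-- Coercion and composition with the target dimension in an extended context.

coeS : Sub → Tm → Tm → Tm → Tm → Tm
coeS σ r t A N = coe (sub σ r) t (sub (liftS σ) A) (sub σ N)

comS : Sub → Tm → Tm → Tm → Tm → Tm → Tm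
comS σ r t s A a = com (sub σ r) t (sub σ s) (sub (liftS σ) A) (sub (liftSⁿ 2 σ) a)

lift-⨟ : ∀ σ τ → liftS σ ⨟ liftS τ ≗ liftS (σ ⨟ τ)
lift-⨟ σ τ zero = refl
lift-⨟ σ τ (suc x) = liftS-wk τ (σ x)

lift-sub : ∀ τ σ t → sub (liftS τ) (sub (liftS σ) t) ≃ sub (liftS (σ ⨟ τ)) t
lift-sub τ σ t = trans (sub-sub (liftS τ) (liftS σ) t) (sub-ext (lift-⨟ σ τ) t)

lift₂-sub : ∀ τ σ t → sub (liftSⁿ 2 τ) (sub (liftSⁿ 2 σ) t) ≃ sub (liftSⁿ 2 (σ ⨟ τ)) t
lift₂-sub τ σ t = trans (lift-sub (liftS τ) (liftS σ) t) (sub-ext (liftS-ext (lift-⨟ σ τ)) t)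

coeS-sub : ∀ τ σ r t A N → sub τ (coeS σ r t A N) ≃ coeS (σ ⨟ τ) r (sub τ t) A N
coeS-sub τ σ r t A N = cong₄ coe (sub-sub τ σ r) refl (lift-sub τ σ A) (sub-sub τ σ N)

comS-sub : ∀ τ σ r t s A a → sub τ (comS σ r t s A a) ≃ comS (σ ⨟ τ) r (sub τ t) s A a
comS-sub τ σ r t s A a =
  cong₅ com (sub-sub τ σ r) refl (sub-sub τ σ s) (lift-sub τ σ A) (lift₂-sub τ σ a)

coeS-id : ∀ r t A N → coeS var r t A N ≃ coe r t A N
coeS-id r t A N = cong₄ coe (sub-id r) refl (sub-id′ (liftS-id λ _ → refl) A) (sub-id N)

comS-id : ∀ r t s A a → comS var r t s A a ≃ com r t s A a
comS-id r t s A a = cong₅ com (sub-id r) refl (sub-id s)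
  (sub-id′ (liftS-id λ _ → refl) A) (sub-id′ (liftSⁿ-id 2 λ _ → refl) a)

wk-com : ∀ r t s A a → wk (com r t s A a) ≃ comS (var ∘ suc) r (wk t) s A a
wk-com r t s A a = cong₅ com (ren-sub suc r) refl (ren-sub suc s)
  (ren-agree (liftR-agree λ _ → refl) A) (ren-agree (liftRⁿ-agree 2 λ _ → refl) a)

wk-sub : ∀ σ t → wk (sub σ t) ≃ sub (wk ∘ σ) t
wk-sub = ren-∘-sub suc

wk-[] : ∀ t N → wk (t [ N ]₀) ≃ ren (liftR suc) t [ wk N ]₀
wk-[] t N = trans (wk-sub (N ∷ₛ var) t)
  (trans (sub-ext (λ { zero → refl ; (suc x) → refl }) t) (sym (sub-ren _ (liftR suc) t)))

id-cons : var 0 ∷ₛ (var ∘ suc) ≗ var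
id-cons zero = refl
id-cons (suc x) = refl

sub-id-cons : ∀ t → sub (var 0 ∷ₛ (var ∘ suc)) t ≃ t
sub-id-cons = sub-id′ id-cons

coeS-t : Γ ▷ dim ⊢ A ∶ U → Γ ⊢ᵈ r → Γ ⊢ N ∶ El (A [ r ]₀) → TSub Δ σ Γ → Δ ⊢ᵈ t →
         Δ ⊢ coeS σ r t A N ∶ El (sub (t ∷ₛ σ) A)
coeS-t {A = A} {σ = σ} {t} T r n w d = ty≃ (cong El (lift-inst t σ A))
  (t-coe (tmS T (liftTS dim w wf-dim)) (dimS r w) d (ty≃ (cong El (inst {t = A})) (tmS n w)))

coeS-refl : Γ ▷ dim ⊢ A ∶ U → Γ ⊢ᵈ r → Γ ⊢ N ∶ El (A [ r ]₀) → TSub Δ σ Γ → Δ ⊢ᵈ t →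
            Δ ⊨ sub σ r ≐ t → Δ ⊢ coeS σ r t A N ≡ sub σ N ∶ El (sub (t ∷ₛ σ) A)
coeS-refl {A = A} {σ = σ} {t} T r n w d h = eqt≃ (cong El (lift-inst t σ A))
  (coe-refl (tmS T (liftTS dim w wf-dim)) (dimS r w) d h (ty≃ (cong El (inst {t = A})) (tmS n w)))

comS-t : Γ ▷ dim ⊢ A ∶ U → Γ ⊢ᵈ r → Γ ⊢ᵈ s →
         Γ ▷ dim ▷ cof (partialCof r s) ⊢ a ∶ El (wk A) → TSub Δ σ Γ → Δ ⊢ᵈ t →
         Δ ⊢ comS σ r t s A a ∶ El (sub (t ∷ₛ σ) A)
comS-t {A = A} {σ = σ} {t} T r s a w d = ty≃ (cong El (lift-inst t σ A))
  (t-com (tmS T (liftTS dim w wf-dim)) (dimS r w) d (dimS s w)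
    (ty≃ (cong El (liftS-wk (liftS σ) A)) (tmS a (liftCof w (dimS r w) (dimS s w)))))

∷-lift₂ : ∀ M N σ t → sub (M ∷ₛ N ∷ₛ var) (sub (liftSⁿ 2 σ) t) ≃ sub (M ∷ₛ N ∷ₛ σ) t
∷-lift₂ M N σ t = trans (sub-sub _ (liftSⁿ 2 σ) t)
  (sub-ext (λ { zero → refl ; (suc zero) → refl
              ; (suc (suc x)) → trans (sub-∷-wk M (N ∷ₛ var) (wk (σ x)))
                                        (wk-inst N (σ x)) }) t)

comS-∂ : Γ ▷ dim ⊢ A ∶ U → Γ ⊢ᵈ r → Γ ⊢ᵈ s →
         Γ ▷ dim ▷ cof (partialCof r s) ⊢ a ∶ El (wk A) → TSub Δ σ Γ → Δ ⊢ᵈ t →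
         Δ ⊨ (t ≐ sub σ r) ∨ ∂ (sub σ s) →
         Δ ⊢ comS σ r t s A a ≡ sub (i0 ∷ₛ t ∷ₛ σ) a ∶ El (sub (t ∷ₛ σ) A)
comS-∂ {A = A} {a = a} {σ = σ} {t} T r s d w e h =
  eq≃ refl (∷-lift₂ i0 t σ a) (cong El (lift-inst t σ A))
    (com-∂ (tmS T (liftTS dim w wf-dim)) (dimS r w) e (dimS s w)
      (ty≃ (cong El (liftS-wk (liftS σ) A)) (tmS d (liftCof w (dimS r w) (dimS s w)))) h)

∂-form : Γ ⊢ᵈ s → Γ ⊢ᶠ ∂ s
∂-form s = f-or (f-eq s (d-0 (ok-D s))) (f-eq s (d-1 (ok-D s)))

-- On `∂ s` a composite is its tube at `r'`. The equations for composites at Π, Σ and Path are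
-- boundary separation along `s` applied to this.
com-face : Γ ▷ dim ⊢ A ∶ U → Γ ⊢ᵈ r → Γ ⊢ᵈ r' → Γ ⊢ᵈ s →
           Γ ▷ dim ▷ cof (partialCof r s) ⊢ a ∶ El (wk A) →
           Γ ▷ cof (∂ s) ⊢ wk (com r r' s A a) ≡ sub (i0 ∷ₛ wk r' ∷ₛ (var ∘ suc)) a
             ∶ El (wk (A [ r' ]₀))
com-face {A = A} {r} {r'} {s} {a} T d d' e x =
  eq≃ (sym (wk-com r r' s A a)) refl
      (cong El (sym (trans (wk-sub (r' ∷ₛ var) A) (sub-ext (λ { zero → refl ; (suc x) → refl }) A))))
    (comS-∂ T d e x w (wkD ok d')
      (⊨-inr (f-eq (wkD ok d') (dimS d w)) (cof≃ (cong ∂ (ren-sub suc s)) (⊨-hyp ok here))))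
  where
  ok = cof-ok (∂-form e)
  w = wkTS ok

partialCof-form : Γ ⊢ᵈ r → Γ ⊢ᵈ s → Γ ▷ dim ⊢ᶠ partialCof r s
partialCof-form r s = f-or (f-eq (d-var okd here) (wkD okd r)) (∂-form (wkD okd s))
  where okd = dim-ok (ok-D r)

-- Functionality for two substitutions that differ only in the face slot, where relatedness demands
-- nothing. It reconciles `com-∂`, which puts `i0` into the slot, with a tube whose slot is a
-- variable.
face-irrelevant : ⊢ Γ ▷ dim ▷ cof φ → Γ ▷ dim ▷ cof φ ⊢ a ∶ A →
  Γ ▷ dim ▷ cof φ ⊢ sub (i0 ∷ₛ var 1 ∷ₛ (var ∘ suc ∘ suc)) a ≡ a ∶ A
face-irrelevant {φ = φ} {a} {A} ok d = ≡-sym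
  (eq≃ (sub-id a) refl (sub-id A) (tmES d record
    { left = idTS ok
    ; right = extTS (⊨-id ∷TS wkTS ok) (λ { zero → refl ; (suc zero) → refl ; (suc (suc x)) → refl })
    ; rel = λ { here → _
              ; (there {e = e} v) → Related≃ refl (same v) (refl {x = subE var (wkE e)})
                         (ESub.rel (reflES (idTS ok)) (there v)) } }))
  where
  ⊨-id : Inhabits _ i0 (subE (var ∘ suc) (cof φ))
  ⊨-id = cof≃ (ren-sub suc φ) (⊨-hyp ok here)
  same : ∀ {x e} → _ ∋ x ⦂ e → var (suc x) ≃ (i0 ∷ₛ var 1 ∷ₛ (var ∘ suc ∘ suc)) (suc x)
  same here = refl
  same (there _) = refl

-- `coeS (var ∘ suc) r (var 0) b N` is the filler of a coercion: the line in a fresh dimension whose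
-- value at `r` is `N`. Restricting the family `c` to it turns a dependent coercion into one along a
-- line of codes.
fill-inst : ∀ t σ r b N c →
            sub (t ∷ₛ σ) (c [ coeS (var ∘ suc) r (var 0) b N ]₀) ≃ sub (coeS σ r t b N ∷ₛ t ∷ₛ σ) c
fill-inst t σ r b N c = trans (sub-inst (t ∷ₛ σ) c _)
  (sub-ext (λ { zero → coeS-sub (t ∷ₛ σ) (var ∘ suc) r (var 0) b N
              ; (suc x) → refl }) c)

fill-inst′ : ∀ t r b N c → (c [ coeS (var ∘ suc) r (var 0) b N ]₀) [ t ]₀ ≃
                           sub (coe r t b N ∷ₛ t ∷ₛ var) c
fill-inst′ t r b N c = trans (fill-inst t var r b N c)
  (sub-ext (∷-ext₀ (coeS-id r t b N)) c)
  where
  ∷-ext₀ : ∀ {M M' σ} → M ≃ M' → (M ∷ₛ σ) ≗ (M' ∷ₛ σ)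
  ∷-ext₀ e zero = e
  ∷-ext₀ e (suc x) = refl

fill-t : Γ ▷ dim ⊢ A ∶ U → Γ ⊢ᵈ r → Γ ⊢ N ∶ El (A [ r ]₀) →
         Γ ▷ dim ⊢ coeS (var ∘ suc) r (var 0) A N ∶ El A
fill-t {A = A} T r n = ty≃ (cong El (sub-id-cons A)) (coeS-t T r n (wkTS okd) (d-var okd here))
  where okd = ok-t T

-- Coercions at Π and Σ under elimination.

module Family {Γ : Ctx} {b c : Tm}
  (tb : Γ ▷ dim ⊢ b ∶ U) (tc : Γ ▷ dim ▷ ty (El b) ⊢ c ∶ U) where

  okΓ : ⊢ Γ
  okΓ = ok-tail (ok-t tb)

  dom-at : Γ ⊢ᵈ r → Γ ⊢ b [ r ]₀ ∶ U
  dom-at r = tmI tb r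

  fam-at : Γ ⊢ᵈ r → Γ ▷ ty (El (b [ r ]₀)) ⊢ sub (liftS (r ∷ₛ var)) c ∶ U
  fam-at r = tmS tc (liftTS (ty (El b)) (instTS okΓ r) (wf-ty (T-El (dom-at r))))

  fam-cong : Γ ⊢ᵈ r → Γ ⊢ M ≡ N ∶ El (b [ r ]₀) → Γ ⊢ M ∶ El (b [ r ]₀) → Γ ⊢ N ∶ El (b [ r ]₀) →
             Γ ⊢ᵗ El (sub (M ∷ₛ r ∷ₛ var) c) ≡ El (sub (N ∷ₛ r ∷ₛ var) c)
  fam-cong r e m n = tyES (T-El tc) ((e , m , n) ∷ES reflES (instTS okΓ r))

  El-Pi : Γ ⊢ᵈ r → Γ ⊢ᵗ El (cPi b c [ r ]₀) ≡ Pi (El (b [ r ]₀)) (El (sub (liftS (r ∷ₛ var)) c))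
  El-Pi r = El-cPi (dom-at r) (fam-at r)

  El-Sg : Γ ⊢ᵈ r → Γ ⊢ᵗ El (cSg b c [ r ]₀) ≡ Sg (El (b [ r ]₀)) (El (sub (liftS (r ∷ₛ var)) c))
  El-Sg r = El-cSg (dom-at r) (fam-at r)

  app-t : Γ ⊢ᵈ r → Γ ⊢ f ∶ El (cPi b c [ r ]₀) → Γ ⊢ N ∶ El (b [ r ]₀) →
          Γ ⊢ app f N ∶ El (sub (N ∷ₛ r ∷ₛ var) c)
  app-t {N = N} r f n = ty≃ (cong El (lift-inst N _ c)) (t-app (t-conv f (El-Pi r)) n)

  fst-t : Γ ⊢ᵈ r → Γ ⊢ p ∶ El (cSg b c [ r ]₀) → Γ ⊢ fst p ∶ El (b [ r ]₀)
  fst-t r p = t-fst (t-conv p (El-Sg r))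

  snd-t : Γ ⊢ᵈ r → Γ ⊢ p ∶ El (cSg b c [ r ]₀) → Γ ⊢ snd p ∶ El (sub (fst p ∷ₛ r ∷ₛ var) c)
  snd-t r p = ty≃ (cong El (lift-inst _ _ c)) (t-snd (t-conv p (El-Sg r)))

  fill-family : Γ ⊢ᵈ r → Γ ⊢ N ∶ El (b [ r ]₀) →
                Γ ▷ dim ⊢ c [ coeS (var ∘ suc) r (var 0) b N ]₀ ∶ U
  fill-family r n = tmI tc (fill-t tb r n)

  -- The coercion naturally ends in the fibre over the value of the filler at `r'`, which is `N`
  -- only judgmentally; the conversion is left to the uses.
  coePi-t : Γ ⊢ᵈ r → Γ ⊢ᵈ r' → Γ ⊢ f ∶ El (cPi b c [ r ]₀) → Γ ⊢ N ∶ El (b [ r' ]₀) →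
            Γ ⊢ coe r r' (c [ coeS (var ∘ suc) r' (var 0) b N ]₀) (app f (coe r' r b N))
              ∶ El (sub (coe r' r' b N ∷ₛ r' ∷ₛ var) c)
  coePi-t {r} {r'} {f} {N} d d' x n = ty≃ (cong El (fill-inst′ r' r' b N c))
    (t-coe (fill-family d' n) d d'
      (ty≃ (cong El (sym (fill-inst′ r r' b N c))) (app-t d x (t-coe tb d' d n))))

  coeSg-snd-t : Γ ⊢ᵈ r → Γ ⊢ᵈ r' → Γ ⊢ p ∶ El (cSg b c [ r ]₀) →
                Γ ⊢ coe r r' (c [ coeS (var ∘ suc) r (var 0) b (fst p) ]₀) (snd p)
                  ∶ El (sub (coe r r' b (fst p) ∷ₛ r' ∷ₛ var) c)
  coeSg-snd-t {r} {r'} {p} d d' x = ty≃ (cong El (fill-inst′ r' r b (fst p) c))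
    (t-coe (fill-family d (fst-t d x)) d d'
      (ty≃ (cong El (sym (fill-inst′ r r b (fst p) c)))
        (t-conv (snd-t d x) (fam-cong d (≡-sym fill) (fst-t d x) (t-coe tb d d (fst-t d x))))))
    where fill = coe-refl tb d d (⊨-refl d) (fst-t d x)

wk-[]′ : ∀ t N → wk (t [ N ]₀) ≃ sub (liftS (var ∘ suc)) t [ wk N ]₀
wk-[]′ t N = trans (wk-[] t N) (cong (_[ wk N ]₀) (ren-agree (liftR-agree λ _ → refl) t))

module CoercionEqs {Γ : Ctx} {b c : Tm}
  (tb : Γ ▷ dim ⊢ b ∶ U) (tc : Γ ▷ dim ▷ ty (El b) ⊢ c ∶ U) where

  open Family tb tc

  coePi-app : Γ ⊢ᵈ r → Γ ⊢ᵈ r' → Γ ⊢ f ∶ El (cPi b c [ r ]₀) → Γ ⊢ N ∶ El (b [ r' ]₀) →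
    Γ ⊢ app (coe r r' (cPi b c) f) N ≡
        coe r r' (c [ coeS (var ∘ suc) r' (var 0) b N ]₀) (app f (coe r' r b N))
      ∶ El (sub (N ∷ₛ r' ∷ₛ var) c)
  coePi-app {r} {r'} {f} {N} d d' x n = ≡-trans
    (eqt≃ (cong El (lift-inst N _ c))
      (app-cong (≡-conv (coe-Pi (t-cPi tb tc) d d' x) (El-Pi d')) (≡-refl n)))
    (eq≃ refl body-inst (cong El target-inst) (Pi-β body-t n))
    where
    ok' = ty-ok (T-El (dom-at d'))
    Γ' = Γ ▷ ty (El (b [ r' ]₀))
    w = liftTS dim (wkTS ok') wf-dim
    tb' = tmS tb w
    b₁ = sub (liftS (var ∘ suc)) b
    c₁ = sub (liftSⁿ 2 (var ∘ suc)) c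
    -- `Pi-β` asks for a typing of the body of the λ, which `coe-Pi` does not provide. It is
    -- `coePi-t` for the weakened family at the new variable.
    module F' = Family tb' (tmS tc (liftTS (ty (El b)) w (wf-ty (T-El tb'))))
    body : Tm
    -- The body contains a substitution local to `coePiRHS` and is therefore read off by matching
    -- instead of being written again.
    body = case coePiRHS r r' b c f of λ { (lam t) → t ; t → t }
    n' : Γ' ⊢ var 0 ∶ El (b₁ [ wk r' ]₀)
    n' = ty≃ (cong El (wk-[]′ b r')) (t-var ok' here)
    body≃ : coe (wk r) (wk r') (c₁ [ coeS (var ∘ suc) (wk r') (var 0) b₁ (var 0) ]₀)
              (app (wk f) (coe (wk r') (wk r) b₁ (var 0))) ≃ body
    body≃ = cong₄ coe refl refl
      (trans (sub-sub _ (liftSⁿ 2 (var ∘ suc)) c)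
        (sub-ext (λ { zero → cong₄ coe (trans (sub-ren _ suc r') (sym (ren-sub _ r'))) refl
                        (trans (lift-sub _ _ b) (sym (ren-agree (liftR-agree λ _ → refl) b))) refl
                    ; (suc zero) → refl ; (suc (suc x)) → refl }) c))
      (cong₂ app refl (cong₄ coe refl refl (sym (ren-agree (liftR-agree λ _ → refl) b)) refl))
    body-t : Γ' ⊢ body ∶ El (sub (var 0 ∷ₛ wk r' ∷ₛ (var ∘ suc)) c)
    body-t = tm≃ body≃ (cong El (∷-lift₂ (var 0) (wk r') (var ∘ suc) c))
      (t-conv (F'.coePi-t (wkD ok' d) (wkD ok' d') (ty≃ (cong El (wk-[]′ (cPi b c) r)) (wkt ok' x)) n')
              (F'.fam-cong (wkD ok' d') (coe-refl tb' (wkD ok' d') (wkD ok' d') (⊨-refl (wkD ok' d')) n')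
                (t-coe tb' (wkD ok' d') (wkD ok' d') n') n'))
    body-inst : body [ N ]₀ ≃
      coe r r' (c [ coeS (var ∘ suc) r' (var 0) b N ]₀) (app f (coe r' r b N))
    body-inst = cong₄ coe (wk-inst N r) (wk-inst N r')
      (trans (sub-sub _ _ c)
        (sub-ext (λ { zero → cong₄ coe (sub-ren _ _ r') refl
                        (trans (sub-ren _ _ b) (sub-ext (λ { zero → refl ; (suc x) → refl }) b))
                        (ren-sub suc N)
                    ; (suc zero) → refl ; (suc (suc x)) → refl }) c))
      (cong₂ app (wk-inst N f) (cong₄ coe (wk-inst N r') (wk-inst N r)
        (trans (sub-ren _ _ b) (sub-id′ (λ { zero → refl ; (suc x) → refl }) b)) refl))
    target-inst : sub (var 0 ∷ₛ wk r' ∷ₛ (var ∘ suc)) c [ N ]₀ ≃ sub (N ∷ₛ r' ∷ₛ var) c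
    target-inst = trans (sub-sub _ _ c)
      (sub-ext (λ { zero → refl ; (suc zero) → wk-inst N r' ; (suc (suc x)) → refl }) c)

  private
    coeSg-pair : Γ ⊢ᵈ r → Γ ⊢ᵈ r' → Γ ⊢ p ∶ El (cSg b c [ r ]₀) →
      Γ ⊢ coe r r' (cSg b c) p ≡
          pair (coe r r' b (fst p)) (coe r r' (c [ coeS (var ∘ suc) r (var 0) b (fst p) ]₀) (snd p))
        ∶ Sg (El (b [ r' ]₀)) (El (sub (liftS (r' ∷ₛ var)) c))
    coeSg-pair {r} {r'} {p} d d' x = eq≃ refl
      (cong₂ pair refl (cong₄ coe refl refl
        (sub-ext (λ { zero → cong₄ coe (ren-sub suc r) refl (ren-agree (liftR-agree λ _ → refl) b)
                               (ren-sub suc (fst p))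
                    ; (suc zero) → refl ; (suc (suc x)) → refl }) c) refl)) refl
      (≡-conv (coe-Sg (t-cSg tb tc) d d' x) (El-Sg d'))

  coeSg-fst : Γ ⊢ᵈ r → Γ ⊢ᵈ r' → Γ ⊢ p ∶ El (cSg b c [ r ]₀) →
    Γ ⊢ fst (coe r r' (cSg b c) p) ≡ coe r r' b (fst p) ∶ El (b [ r' ]₀)
  coeSg-fst d d' x = ≡-trans (fst-cong (coeSg-pair d d' x))
    (Sg-β₁ (T-El (fam-at d')) (t-coe tb d d' (fst-t d x))
           (ty≃ (cong El (sym (lift-inst _ _ c))) (coeSg-snd-t d d' x)))

  coeSg-snd : Γ ⊢ᵈ r → Γ ⊢ᵈ r' → Γ ⊢ p ∶ El (cSg b c [ r ]₀) →
    Γ ⊢ snd (coe r r' (cSg b c) p) ≡ coe r r' (c [ coeS (var ∘ suc) r (var 0) b (fst p) ]₀) (snd p)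
      ∶ El (sub (coe r r' b (fst p) ∷ₛ r' ∷ₛ var) c)
  coeSg-snd d d' x = eqt≃ (cong El (lift-inst _ _ c)) (≡-trans
    (≡-sym (≡-conv (snd-cong (≡-sym (coeSg-pair d d' x)))
      (tyES (T-El F) (instES (Sg-β₁ (T-El F) X Y) (t-fst (t-pair (T-El F) X Y)) X))))
    (Sg-β₂ (T-El F) X Y))
    where
    F = fam-at d'
    X = t-coe tb d d' (fst-t d x)
    Y = ty≃ (cong El (sym (lift-inst _ _ c))) (coeSg-snd-t d d' x)

-- Composites at Π and Σ under elimination.

module CompositionEqs {Γ : Ctx} {b c r r' s a : Tm}
  (tb : Γ ▷ dim ⊢ b ∶ U) (tc : Γ ▷ dim ▷ ty (El b) ⊢ c ∶ U)
  (d : Γ ⊢ᵈ r) (d' : Γ ⊢ᵈ r') (e : Γ ⊢ᵈ s) where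

  open Family tb tc

  Ξ : Ctx
  Ξ = Γ ▷ dim ▷ cof (partialCof r s)

  okΞ : ⊢ Ξ
  okΞ = cof-ok (partialCof-form d e)

  ok∂ : ⊢ Γ ▷ cof (∂ s)
  ok∂ = cof-ok (∂-form e)

  at-face : Sub
  at-face = i0 ∷ₛ wk r' ∷ₛ (var ∘ suc)

  face-wk : ∀ t → sub at-face (wk t) ≃ sub (wk r' ∷ₛ (var ∘ suc)) t
  face-wk t = sub-∷-wk i0 _ t

  module _ (x : Ξ ⊢ a ∶ El (wk (cPi b c))) where

    comPi-arg-t : ∀ {g} → Γ ▷ dim ⊢ g ∶ El b → Ξ ⊢ app a (wk g) ∶ El (wk (c [ g ]₀))
    comPi-arg-t {g} tg = ty≃ (cong El (sym (wk-[] c g)))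
      (t-app (t-conv x (wk-tyeq okΞ (El-cPi tb tc))) (wkt okΞ tg))

    -- On `∂ s` the left side is the tube at `r'` applied to `N`, and the right side is the same
    -- tube applied to the filler of `N` at `r'`, which is `N`. The filler starts at `r'` because
    -- that is where the argument is given.
    comPi-app : Γ ⊢ N ∶ El (b [ r' ]₀) →
      Γ ⊢ app (com r r' s (cPi b c) a) N ≡
          com r r' s (c [ coeS (var ∘ suc) r' (var 0) b N ]₀)
            (app a (wk (coeS (var ∘ suc) r' (var 0) b N)))
        ∶ El (sub (N ∷ₛ r' ∷ₛ var) c)
    comPi-app {N} n = bsep (tmS tc (n ∷TS instTS okΓ d')) e M-t
      (t-conv K-t (fam-cong d' (coe-refl tb d' d' (⊨-refl d') n) (t-coe tb d' d' n) n))
      (≡-trans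
        (eqt≃ (cong El (trans (sym (wk-[] (sub (liftS (r' ∷ₛ var)) c) N)) (cong wk (lift-inst N _ c))))
          (app-cong (≡-conv (com-face (t-cPi tb tc) d d' e x) (wk-tyeq ok∂ (El-Pi d'))) (≡-sym fill)))
        (≡-sym (eq≃ refl (cong (app _) (trans (face-wk (coeS (var ∘ suc) r' (var 0) b N)) (coeS-sub (wk r' ∷ₛ (var ∘ suc)) (var ∘ suc) r' (var 0) b N)))
          refl
          (≡-conv (com-face (fill-family d' n) d d' e (comPi-arg-t (fill-t tb d' n)))
            (wk-tyeq ok∂ K-type)))))
      where
      K-t = ty≃ (cong El (fill-inst′ r' r' b N c))
        (t-com (fill-family d' n) d d' e (comPi-arg-t (fill-t tb d' n)))
      M-t = app-t d' (t-com (t-cPi tb tc) d d' e x) n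
      K-type : Γ ⊢ᵗ El ((c [ coeS (var ∘ suc) r' (var 0) b N ]₀) [ r' ]₀) ≡ El (sub (N ∷ₛ r' ∷ₛ var) c)
      K-type = tyeq≃ (cong El (sym (fill-inst′ r' r' b N c))) refl
        (fam-cong d' (coe-refl tb d' d' (⊨-refl d') n) (t-coe tb d' d' n) n)
      fill : Γ ▷ cof (∂ s) ⊢ coeS (var ∘ suc) r' (wk r') b N ≡ wk N ∶ El (wk (b [ r' ]₀))
      fill = eq≃ refl (sym (ren-sub suc N))
        (cong El (sym (trans (wk-sub _ b) (sub-ext (λ { zero → refl ; (suc x) → refl }) b))))
        (coeS-refl tb d' n (wkTS ok∂) (wkD ok∂ d')
          (subst (λ t → _ ⊨ t ≐ wk r') (ren-sub suc r') (⊨-refl (wkD ok∂ d'))))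

  module _ (x : Ξ ⊢ a ∶ El (wk (cSg b c))) where

    private
      x′ : Ξ ⊢ a ∶ Sg (El (wk b)) (El (ren (liftR suc) c))
      x′ = t-conv x (wk-tyeq okΞ (El-cSg tb tc))

    comSg-fst-t : Ξ ⊢ fst a ∶ El (wk b)
    comSg-fst-t = t-fst x′

    comSg-fst : Γ ⊢ fst (com r r' s (cSg b c) a) ≡ com r r' s b (fst a) ∶ El (b [ r' ]₀)
    comSg-fst = bsep (dom-at d') e (fst-t d' (t-com (t-cSg tb tc) d d' e x))
      (t-com tb d d' e comSg-fst-t)
      (≡-trans (fst-cong (≡-conv (com-face (t-cSg tb tc) d d' e x) (wk-tyeq ok∂ (El-Sg d'))))
               (≡-sym (com-face tb d d' e comSg-fst-t)))

    -- The filler of the composite of first components. The second components lie over it, so they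
    -- are composed along `c` restricted to this line, which at `r'` is the first component of the
    -- result.
    comSg-fill : Tm
    comSg-fill = comS (var ∘ suc) r (var 0) s b (fst a)

    comSg-fill-t : Γ ▷ dim ⊢ comSg-fill ∶ El b
    comSg-fill-t = ty≃ (cong El (sub-id-cons b))
      (comS-t tb d e comSg-fst-t (wkTS (dim-ok okΓ)) (d-var (dim-ok okΓ) here))

    comSg-family : Γ ▷ dim ⊢ c [ comSg-fill ]₀ ∶ U
    comSg-family = tmI tc comSg-fill-t

    -- The assumption in `Ξ` is exactly the condition under which `com-∂` computes the filler at the
    -- current dimension; what remains is the content of the face slot.
    comSg-fill-∂ : Ξ ⊢ wk comSg-fill ≡ fst a ∶ El (wk b)
    comSg-fill-∂ = ≡-trans
      (eq≃ (sym (trans (ren-sub suc comSg-fill) (comS-sub _ _ r (var 0) s b (fst a)))) refl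
        (cong El (sym (trans (ren-sub suc b) (sub-ext (λ { zero → refl ; (suc x) → refl }) b))))
        (comS-∂ tb d e comSg-fst-t (wkTS (dim-ok okΓ) ⨟TS wkTS okΞ) (d-var okΞ (there here))
          (cof≃ (cong₂ (λ r s → (var 1 ≐ r) ∨ ∂ s) (wk² r) (wk² s)) (⊨-hyp okΞ here))))
      (face-irrelevant okΞ comSg-fst-t)
      where
      wk² : ∀ t → wk (wk t) ≃ sub ((var ∘ suc) ⨟ (var ∘ suc)) t
      wk² t = trans (ren-ren suc suc t) (ren-sub _ t)

    comSg-snd-t : Ξ ⊢ snd a ∶ El (wk (c [ comSg-fill ]₀))
    comSg-snd-t = t-conv (t-snd x′)
      (tyeq≃ refl (cong El (sym (wk-[] c comSg-fill)))
        (tyES (T-El (wk₁t (ty-ok (wkT okΞ (T-El tb))) tc))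
              (instES (≡-sym comSg-fill-∂) comSg-fst-t (wkt okΞ comSg-fill-t))))

    comSg-inst : (c [ comSg-fill ]₀) [ r' ]₀ ≃ sub (com r r' s b (fst a) ∷ₛ r' ∷ₛ var) c
    comSg-inst = trans (sub-inst _ c _)
      (sub-ext (λ { zero → trans (comS-sub _ _ r (var 0) s b (fst a)) (comS-id r r' s b (fst a))
                  ; (suc x) → refl }) c)

    comSg-snd : Γ ⊢ snd (com r r' s (cSg b c) a) ≡ com r r' s (c [ comSg-fill ]₀) (snd a)
                  ∶ El (sub (com r r' s b (fst a) ∷ₛ r' ∷ₛ var) c)
    comSg-snd = bsep (tmS tc (t-com tb d d' e comSg-fst-t ∷TS instTS okΓ d')) e
      (t-conv (t-snd M-t) conv)
      (ty≃ (cong El comSg-inst) (t-com comSg-family d d' e comSg-snd-t))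
      (≡-trans
        (≡-conv (snd-cong (≡-conv (com-face (t-cSg tb tc) d d' e x) (wk-tyeq ok∂ (El-Sg d'))))
          (tyeq≃ (cong El (wk-[] (sub (liftS (r' ∷ₛ var)) c) (fst (com r r' s (cSg b c) a)))) refl (wk-tyeq ok∂ conv)))
        (≡-sym (eqt≃ (cong (El ∘ wk) comSg-inst) (com-face comSg-family d d' e comSg-snd-t))))
      where
      M-t = t-conv (t-com (t-cSg tb tc) d d' e x) (El-Sg d')
      conv : Γ ⊢ᵗ El (sub (liftS (r' ∷ₛ var)) c [ fst (com r r' s (cSg b c) a) ]₀) ≡
                  El (sub (com r r' s b (fst a) ∷ₛ r' ∷ₛ var) c)
      conv = tyeq≃ refl (cong El (lift-inst _ _ c))
        (tyES (T-El (fam-at d')) (instES comSg-fst (t-fst M-t) (t-com tb d d' e comSg-fst-t)))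

-- Coercions and composites of paths at a point.

module PathEqs {Γ : Ctx} {b x y r r' t : Tm}
  (tb : Γ ▷ dim ▷ dim ⊢ b ∶ U)
  (tx : Γ ▷ dim ⊢ x ∶ El (b [ i0 ]₀)) (ty : Γ ▷ dim ⊢ y ∶ El (b [ i1 ]₀))
  (d : Γ ⊢ᵈ r) (d' : Γ ⊢ᵈ r') (dt : Γ ⊢ᵈ t) where

  private
    okd : ⊢ Γ ▷ dim
    okd = ok-t tx

    okΓ : ⊢ Γ
    okΓ = ok-tail okd

    tP : Γ ▷ dim ⊢ cPath b x y ∶ U
    tP = t-cPath tb tx ty

    El-Path : Γ ▷ dim ⊢ᵗ El (cPath b x y) ≡ Path (El b) x y
    El-Path = El-cPath tb tx ty

    El-Path-at : ∀ {r} → Γ ⊢ᵈ r →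
      Γ ⊢ᵗ El (cPath b x y [ r ]₀) ≡ Path (El (sub (liftS (r ∷ₛ var)) b)) (x [ r ]₀) (y [ r ]₀)
    El-Path-at d = tyeqS El-Path (instTS okΓ d)

  -- `b` depends on the direction of coercion and on the path coordinate; here the latter is fixed
  -- to `t` and the former stays free.
  line : Tm
  line = b [ wk t ]₀

  line-t : Γ ▷ dim ⊢ line ∶ U
  line-t = tmI tb (wkD okd dt)

  line-inst : ∀ r → sub (liftS (r ∷ₛ var)) b [ t ]₀ ≃ line [ r ]₀
  line-inst r = trans (lift-inst t _ b) (sym (trans (sub-inst _ b _)
    (sub-ext (λ { zero → wk-inst r t ; (suc x) → refl }) b)))

  papp-t : ∀ {r p} → Γ ⊢ᵈ r → Γ ⊢ p ∶ El (cPath b x y [ r ]₀) → Γ ⊢ papp p t ∶ El (line [ r ]₀)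
  papp-t {r} d p = ty≃ (cong El (line-inst r)) (t-papp (t-conv p (El-Path-at d)) dt)

  coePath-fill : Tm → Tm
  coePath-fill p = papp (coeS (var ∘ suc) r (var 0) (cPath b x y) p) (wk t)

  coePath-fill-t : ∀ {p} → Γ ⊢ p ∶ El (cPath b x y [ r ]₀) → Γ ▷ dim ⊢ coePath-fill p ∶ El line
  coePath-fill-t p = t-papp (t-conv (fill-t tP d p) El-Path) (wkD okd dt)

  -- The composite of the line of coercions i ↦ coe^{r→i}(p)(t) has, by boundary separation,
  -- no choice but to be coe^{r→r'}(p)(t).
  coePath-papp : ∀ {p} → Γ ⊢ p ∶ El (cPath b x y [ r ]₀) →
    Γ ⊢ papp (coe r r' (cPath b x y) p) t ≡ com r r' t line (wk (coePath-fill p)) ∶ El (line [ r' ]₀)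
  coePath-papp {p} q = bsep (tmI line-t d') dt (papp-t d' (t-coe tP d d' q))
    (t-com line-t d d' dt a-t)
    (≡-sym (eq≃ refl face refl (com-face line-t d d' dt a-t)))
    where
    a-t = wkt (cof-ok (partialCof-form d dt)) (coePath-fill-t q)
    face : sub (i0 ∷ₛ wk r' ∷ₛ (var ∘ suc)) (wk (coePath-fill p)) ≃
           wk (papp (coe r r' (cPath b x y) p) t)
    face = trans (sub-∷-wk i0 _ (coePath-fill p)) (cong₂ papp
      (trans (coeS-sub _ _ r (var 0) (cPath b x y) p)
        (cong₄ coe (sym (ren-sub suc r)) refl
          (sym (ren-agree (liftR-agree λ _ → refl) (cPath b x y))) (sym (ren-sub suc p))))
      (trans (sub-∷-wk (wk r') _ t) (sym (ren-sub suc t))))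

  module _ {s a : Tm} (e : Γ ⊢ᵈ s)
           (ta : Γ ▷ dim ▷ cof (partialCof r s) ⊢ a ∶ El (wk (cPath b x y))) where

    comPath-arg-t : Γ ▷ dim ▷ cof (partialCof r s) ⊢ papp a (wk (wk t)) ∶ El (wk line)
    comPath-arg-t = ty≃ (cong El (sym (wk-[] b (wk t))))
      (t-papp (t-conv ta (wk-tyeq okΞ El-Path)) (wkD okΞ (wkD okd dt)))
      where okΞ = cof-ok (partialCof-form d e)

    comPath-papp : Γ ⊢ papp (com r r' s (cPath b x y) a) t ≡ com r r' s line (papp a (wk (wk t)))
                     ∶ El (line [ r' ]₀)
    comPath-papp = bsep (tmI line-t d') e (papp-t d' (t-com tP d d' e ta))
      (t-com line-t d d' e comPath-arg-t)
      (≡-trans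
        (eqt≃ (cong El (trans (sym (wk-[] (sub (liftS (r' ∷ₛ var)) b) t)) (cong wk (line-inst r'))))
          (papp-cong (≡-conv (com-face tP d d' e ta) (wk-tyeq ok∂ (El-Path-at d')))
            (wkD ok∂ dt) (wkD ok∂ dt) (⊨-refl (wkD ok∂ dt))))
        (≡-sym (eq≃ refl
          (cong (papp _) (trans (sub-∷-wk i0 _ (wk t))
            (trans (sub-∷-wk (wk r') _ t) (sym (ren-sub suc t))))) refl
          (com-face line-t d d' e comPath-arg-t))))
      where ok∂ = cof-ok (∂-form e)

-- Worlds: contexts of dimension variables.

D : ℕ → Ctx
D zero = ε
D (suc n) = D n ▷ dim

D-ok : ∀ n → ⊢ D n
D-ok zero = ε-ok
D-ok (suc n) = dim-ok (D-ok n)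

World : ℕ → Sub → ℕ → Set
World m σ n = TSub (D m) σ (D n)

idW : World n var n
idW = idTS (D-ok _)

wkW : World (suc n) (var ∘ suc) n
wkW = wkTS (D-ok _)

infixr 5 _∷W_
_∷W_ : D m ⊢ᵈ t → World m σ n → World m (t ∷ₛ σ) (suc n)
_∷W_ = _∷TS_ {e = dim}

liftW : World m σ n → World (suc m) (liftS σ) (suc n)
liftW w = liftTS dim w wf-dim

-- In a world nothing identifies distinct dimensions, so truth is a matter of syntax: an equation
-- holds when its sides coincide, and a disjunction when one disjunct does.
Holds : Tm → Set
Holds (r ≐ s) = r ≃ s
Holds (φ ∨ ψ) = Holds φ ⊎ Holds ψ
Holds _ = ⊥

HoldsE : Entry → Set
HoldsE (cof φ) = Holds φ
HoldsE _ = ⊤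

Validates : Sub → Ctx → Set
Validates σ Γ = ∀ {x e} → Γ ∋ x ⦂ e → HoldsE (subE σ e)

validates-∷ : ∀ {e} → HoldsE (subE σ e) → Validates σ Γ → Validates (t ∷ₛ σ) (Γ ▷ e)
validates-∷ {e = e} h V here = subst HoldsE (subE-wkE _ e) h
validates-∷ h V (there {e = e} v) = subst HoldsE (subE-wkE _ e) (V v)

-- Contexts with face assumptions have to be covered because `⊨-elim` introduces them. Its true
-- disjunct is known once the disjunction has been evaluated, and then validates the assumption of
-- that branch.
sound : Γ ⊨ φ → Validates σ Γ → Holds (sub σ φ)
sound (⊨-hyp ok v) V = V v
sound (⊨-refl r) V = refl
sound (⊨-sym h) V = sym (sound h V)
sound (⊨-trans h g) V = trans (sound h V) (sound g V)
sound (⊨-inl h F) V = inj₁ (sound h V)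
sound (⊨-inr F h) V = inj₂ (sound h V)
sound {σ = σ} (⊨-elim {φ = φ} {ψ} {χ} h F g₁ g₂) V with sound h V
... | inj₁ p = subst Holds (sub-∷-wk i0 σ χ) (sound g₁ (validates-∷ {e = cof φ} p V))
... | inj₂ p = subst Holds (sub-∷-wk i0 σ χ) (sound g₂ (validates-∷ {e = cof ψ} p V))
sound (⊨-abort h F) V = case sound h V of λ ()

D-dims : ∀ {x e} → D n ∋ x ⦂ e → e ≃ dim
D-dims {suc n} here = refl
D-dims {suc n} (there v) = cong wkE (D-dims v)

-- The disjunction property and the consistency of face formulas in a world; splits are reduced and
-- `abort` is excluded by it.
sound-D : D n ⊨ φ → Holds φ
sound-D {φ = φ} h = subst Holds (sub-id φ)
  (sound h λ v → subst (λ e → HoldsE (subE var e)) (sym (D-dims v)) _)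

-- Computable codes and elements.

data Code (n : ℕ) : Tm → Set
Computable : Code n a → Tm → Set

data Code n where
  code-Bool : D n ⊢ a ≡ cBool ∶ U → Code n a
  code-Fam  : ∀ {h} → Arrow h c a b → D n ⊢ t ≡ c ∶ U →
              D n ⊢ a ∶ U → D n ▷ ty (El a) ⊢ b ∶ U →
              -- Components carry codes at every later world. This builds in monotonicity, and it
              -- leaves the codes of all substituted components as subtrees for the later recursions
              -- on codes.
              (B : ∀ {m ρ} → World m ρ n → Code m (sub ρ a)) →
              (∀ {m ρ N} (w : World m ρ n) → D m ⊢ N ∶ El (sub ρ a) → Computable (B w) N →
               Code m (sub (N ∷ₛ ρ) b)) →
              Code n t
  code-Path : D n ⊢ t ≡ cPath a x y ∶ U → D (suc n) ⊢ a ∶ U →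
              D n ⊢ x ∶ El (a [ i0 ]₀) → D n ⊢ y ∶ El (a [ i1 ]₀) →
              (B : ∀ {m ρ} → World m ρ (suc n) → Code m (sub ρ a)) →
              -- Coercion of a path, evaluated at an end of its coordinate, yields an endpoint of
              -- the target path type; hence a code must know that its endpoints are computable.
              (∀ {m ρ} (w : World m ρ n) → Computable (B (d-0 (TSub.ok w) ∷W w)) (sub ρ x)) →
              (∀ {m ρ} (w : World m ρ n) → Computable (B (d-1 (TSub.ok w) ∷W w)) (sub ρ y)) →
              Code n t

Computable {n} (code-Bool e) M = Σ 𝔹 λ v → D n ⊢ M ≡ lit v ∶ Bool
Computable {n} (code-Fam {a = a} arrPi e ta tb B C) M =
  ∀ {m ρ N} (w : World m ρ n) (tN : D m ⊢ N ∶ El (sub ρ a)) (pN : Computable (B w) N) →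
  Computable (C w tN pN) (app (sub ρ M) N)
-- The typing of the first projection belongs to the predicate because the code of the fibre, `C`,
-- takes it as an argument.
Computable {n} (code-Fam {a = a} arrSg e ta tb B C) M =
  ∀ {m ρ} (w : World m ρ n) → Σ (D m ⊢ fst (sub ρ M) ∶ El (sub ρ a)) λ tF →
  Σ (Computable (B w) (fst (sub ρ M))) λ pF → Computable (C w tF pF) (snd (sub ρ M))
Computable {n} (code-Path e ta tˣ tʸ B X Y) M =
  ∀ {m ρ t} (w : World m ρ n) (d : D m ⊢ᵈ t) → Computable (B (d ∷W w)) (papp (sub ρ M) t)

coded : ∀ {h} → Arrow h c a b → Γ ⊢ a ∶ U → Γ ▷ ty (El a) ⊢ b ∶ U → Coded Γ h c
coded arrPi ta tb = pi ta tb
coded arrSg ta tb = sg ta tb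

arrow-sub : ∀ {h} → Arrow h c a b → Arrow h (sub σ c) (sub σ a) (sub (liftS σ) b)
arrow-sub arrPi = arrPi
arrow-sub arrSg = arrSg

-- Eliminations for codes known only up to judgmental equality.

module Decode {Γ : Ctx} {t a b : Tm} (ta : Γ ⊢ a ∶ U) (tb : Γ ▷ ty (El a) ⊢ b ∶ U) where

  decodePi : Γ ⊢ t ≡ cPi a b ∶ U → Γ ⊢ᵗ El t ≡ Pi (El a) (El b)
  decodePi e = Ty-trans (El-cong e) (El-cPi ta tb)

  decodeSg : Γ ⊢ t ≡ cSg a b ∶ U → Γ ⊢ᵗ El t ≡ Sg (El a) (El b)
  decodeSg e = Ty-trans (El-cong e) (El-cSg ta tb)

  Pi-app : Γ ⊢ t ≡ cPi a b ∶ U → Γ ⊢ M ≡ M' ∶ El t → TSub Δ σ Γ → Δ ⊢ N ≡ N' ∶ El (sub σ a) →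
           Δ ⊢ app (sub σ M) N ≡ app (sub σ M') N' ∶ El (sub (N ∷ₛ σ) b)
  Pi-app {N = N} e d w n = eqt≃ (cong El (lift-inst N _ b))
    (app-cong (eqS (≡-conv d (decodePi e)) w) n)

  Pi-app-t : Γ ⊢ t ≡ cPi a b ∶ U → Γ ⊢ M ∶ El t → TSub Δ σ Γ → Δ ⊢ N ∶ El (sub σ a) →
             Δ ⊢ app (sub σ M) N ∶ El (sub (N ∷ₛ σ) b)
  Pi-app-t {N = N} e d w n = ty≃ (cong El (lift-inst N _ b))
    (t-app (tmS (t-conv d (decodePi e)) w) n)

  Sg-fst : Γ ⊢ t ≡ cSg a b ∶ U → Γ ⊢ M ≡ M' ∶ El t → TSub Δ σ Γ →
           Δ ⊢ fst (sub σ M) ≡ fst (sub σ M') ∶ El (sub σ a)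
  Sg-fst e d w = fst-cong (eqS (≡-conv d (decodeSg e)) w)

  Sg-fst-t : Γ ⊢ t ≡ cSg a b ∶ U → Γ ⊢ M ∶ El t → TSub Δ σ Γ → Δ ⊢ fst (sub σ M) ∶ El (sub σ a)
  Sg-fst-t e d w = t-fst (tmS (t-conv d (decodeSg e)) w)

  Sg-snd : Γ ⊢ t ≡ cSg a b ∶ U → Γ ⊢ M ≡ M' ∶ El t → TSub Δ σ Γ →
           Δ ⊢ snd (sub σ M) ≡ snd (sub σ M') ∶ El (sub (fst (sub σ M) ∷ₛ σ) b)
  Sg-snd e d w = eqt≃ (cong El (lift-inst _ _ b)) (snd-cong (eqS (≡-conv d (decodeSg e)) w))

  Sg-snd-t : Γ ⊢ t ≡ cSg a b ∶ U → Γ ⊢ M ∶ El t → TSub Δ σ Γ →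
             Δ ⊢ snd (sub σ M) ∶ El (sub (fst (sub σ M) ∷ₛ σ) b)
  Sg-snd-t e d w = ty≃ (cong El (lift-inst _ _ b)) (t-snd (tmS (t-conv d (decodeSg e)) w))

fibre-t : Γ ▷ ty A ⊢ b ∶ U → TSub Δ σ Γ → Δ ⊢ N ∶ sub σ A → Δ ⊢ sub (N ∷ₛ σ) b ∶ U
fibre-t tb w n = tmS tb (n ∷TS w)

fibre-cong : Γ ▷ ty A ⊢ b ∶ U → TSub Δ σ Γ →
             Δ ⊢ N ≡ N' ∶ sub σ A → Δ ⊢ N ∶ sub σ A → Δ ⊢ N' ∶ sub σ A →
             Δ ⊢ sub (N ∷ₛ σ) b ≡ sub (N' ∷ₛ σ) b ∶ U
fibre-cong tb w e n n' = tmES tb ((e , n , n') ∷ES reflES w)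

module DecodePath {Γ : Ctx} {t a x y : Tm} (ta : Γ ▷ dim ⊢ a ∶ U)
  (tˣ : Γ ⊢ x ∶ El (a [ i0 ]₀)) (tʸ : Γ ⊢ y ∶ El (a [ i1 ]₀)) where

  decodePath : Γ ⊢ t ≡ cPath a x y ∶ U → Γ ⊢ᵗ El t ≡ Path (El a) x y
  decodePath e = Ty-trans (El-cong e) (El-cPath ta tˣ tʸ)

  Path-papp : Γ ⊢ t ≡ cPath a x y ∶ U → Γ ⊢ M ≡ M' ∶ El t → TSub Δ σ Γ → Δ ⊢ᵈ r →
              Δ ⊢ papp (sub σ M) r ≡ papp (sub σ M') r ∶ El (sub (r ∷ₛ σ) a)
  Path-papp {r = r} e d w dr = eqt≃ (cong El (lift-inst r _ a))
    (papp-cong (eqS (≡-conv d (decodePath e)) w) dr dr (⊨-refl dr))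

  Path-papp-t : Γ ⊢ t ≡ cPath a x y ∶ U → Γ ⊢ M ∶ El t → TSub Δ σ Γ → Δ ⊢ᵈ r →
                Δ ⊢ papp (sub σ M) r ∶ El (sub (r ∷ₛ σ) a)
  Path-papp-t {r = r} e d w dr = ty≃ (cong El (lift-inst r _ a))
    (t-papp (tmS (t-conv d (decodePath e)) w) dr)

decodeBool : Γ ⊢ a ≡ cBool ∶ U → Γ ⊢ᵗ El a ≡ Bool
decodeBool e = Ty-trans (El-cong e) (El-cBool (ok-e e))

-- Independence of the normal form, and stability under equality.

clash-computable : Clash (D n) → (c : Code n a) → D n ⊢ M ∶ El a → Computable c M
clash-computable k (code-Bool e) d = true , clash-Bool k (t-conv d (decodeBool e))
clash-computable k (code-Fam arrPi e ta tb B C) d w tN pN =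
  clash-computable (eqS k w) (C w tN pN) (Decode.Pi-app-t ta tb e d w tN)
clash-computable k (code-Fam arrSg e ta tb B C) d w =
  tF , pF , clash-computable (eqS k w) (C w tF pF) (Decode.Sg-snd-t ta tb e d w)
  where
  tF = Decode.Sg-fst-t ta tb e d w
  pF = clash-computable (eqS k w) (B w) tF
clash-computable k (code-Path e ta tˣ tʸ B X Y) d w dr =
  clash-computable (eqS k w) (B (dr ∷W w)) (DecodePath.Path-papp-t ta tˣ tʸ e d w dr)

code-conv : Code n a → D n ⊢ a' ≡ a ∶ U → Code n a'
code-conv (code-Bool e) e' = code-Bool (≡-trans e' e)
code-conv (code-Fam A e ta tb B C) e' = code-Fam A (≡-trans e' e) ta tb B C
code-conv (code-Path e ta tˣ tʸ B X Y) e' = code-Path (≡-trans e' e) ta tˣ tʸ B X Y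

code-refl : Code n a → D n ⊢ a ≡ a ∶ U
code-refl (code-Bool e) = ≡-trans e (≡-sym e)
code-refl (code-Fam A e ta tb B C) = ≡-trans e (≡-sym e)
code-refl (code-Path e ta tˣ tʸ B X Y) = ≡-trans e (≡-sym e)

between : Γ ⊢ a ≡ c ∶ U → Γ ⊢ a' ≡ c' ∶ U → Γ ⊢ a ≡ a' ∶ U → Γ ⊢ c ≡ c' ∶ U
between e e' h = ≡-trans (≡-sym e) (≡-trans h e')

head-of : Code n a → Σ Head λ h → Σ Tm λ c → (D n ⊢ a ≡ c ∶ U) × Coded (D n) h c
head-of (code-Bool e) = hBool , _ , e , bool (ok-e e)
head-of (code-Fam A e ta tb _ _) = _ , _ , e , coded A ta tb
head-of (code-Path e ta tˣ tʸ _ _ _) = hPath , _ , e , path ta tˣ tʸ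

clashing : (C : Code n a) (C' : Code n a') → (proj₁ (head-of C) == proj₁ (head-of C')) ≃ false →
           D n ⊢ a ≡ a' ∶ U → D n ⊢ M ∶ El a → Computable C' M
clashing C C' h≠h' h d =
  let _ , _ , e , H = head-of C ; _ , _ , e' , H' = head-of C'
  in clash-computable (heads-clash (between e e' h) H H' h≠h') C' (t-conv d (El-cong h))

irrelevant : (C : Code n a) (C' : Code n a') → D n ⊢ a ≡ a' ∶ U → D n ⊢ M ∶ El a →
             Computable C M → Computable C' M
irrelevant (code-Bool e) (code-Bool e') h d p = p
irrelevant (code-Fam arrPi e ta tb B C) (code-Fam arrPi e' ta' tb' B' C') h d p w tN' pN' =
  irrelevant (C w tN pN) (C' w tN' pN') (fib w tN) (Decode.Pi-app-t ta tb e d w tN) (p w tN pN)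
  where
  inj = arrow-inj (between e e' h) (pi ta tb) (pi ta' tb') arrPi arrPi
  fib = proj₂ inj
  tN = t-conv tN' (El-cong (≡-sym (eqS (proj₁ inj) w)))
  -- The argument is computable for the second domain and is needed for the first, so the recursive
  -- call exchanges the two codes.
  pN = irrelevant (B' w) (B w) (≡-sym (eqS (proj₁ inj) w)) tN' pN'
irrelevant (code-Fam arrSg e ta tb B C) (code-Fam arrSg e' ta' tb' B' C') h d p w =
  let tF , pF , pS = p w
      tF' = t-conv tF (El-cong (eqS (proj₁ inj) w))
      pF' = irrelevant (B w) (B' w) (eqS (proj₁ inj) w) tF pF
  in tF' , pF' , irrelevant (C w tF pF) (C' w tF' pF') (proj₂ inj w tF) (Decode.Sg-snd-t ta tb e d w) pS
  where inj = arrow-inj (between e e' h) (sg ta tb) (sg ta' tb') arrSg arrSg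
irrelevant (code-Path e ta tˣ tʸ B X Y) (code-Path e' ta' tˣ' tʸ' B' X' Y') h d p w dr =
  irrelevant (B (dr ∷W w)) (B' (dr ∷W w))
    (cPath-inj (between e e' h) (path ta tˣ tʸ) (path ta' tˣ' tʸ') w dr)
    (DecodePath.Path-papp-t ta tˣ tʸ e d w dr) (p w dr)
irrelevant C@(code-Bool _) C'@(code-Fam arrPi _ _ _ _ _) h d _ = clashing C C' refl h d
irrelevant C@(code-Bool _) C'@(code-Fam arrSg _ _ _ _ _) h d _ = clashing C C' refl h d
irrelevant C@(code-Bool _) C'@(code-Path _ _ _ _ _ _ _) h d _ = clashing C C' refl h d
irrelevant C@(code-Fam arrPi _ _ _ _ _) C'@(code-Bool _) h d _ = clashing C C' refl h d
irrelevant C@(code-Fam arrSg _ _ _ _ _) C'@(code-Bool _) h d _ = clashing C C' refl h d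
irrelevant C@(code-Fam arrPi _ _ _ _ _) C'@(code-Fam arrSg _ _ _ _ _) h d _ = clashing C C' refl h d
irrelevant C@(code-Fam arrSg _ _ _ _ _) C'@(code-Fam arrPi _ _ _ _ _) h d _ = clashing C C' refl h d
irrelevant C@(code-Fam arrPi _ _ _ _ _) C'@(code-Path _ _ _ _ _ _ _) h d _ = clashing C C' refl h d
irrelevant C@(code-Fam arrSg _ _ _ _ _) C'@(code-Path _ _ _ _ _ _ _) h d _ = clashing C C' refl h d
irrelevant C@(code-Path _ _ _ _ _ _ _) C'@(code-Fam arrPi _ _ _ _ _) h d _ = clashing C C' refl h d
irrelevant C@(code-Path _ _ _ _ _ _ _) C'@(code-Fam arrSg _ _ _ _ _) h d _ = clashing C C' refl h d
irrelevant C@(code-Path _ _ _ _ _ _ _) C'@(code-Bool _) h d _ = clashing C C' refl h d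

computable-≡ : (C : Code n a) → D n ⊢ M ≡ M' ∶ El a → D n ⊢ M' ∶ El a →
               Computable C M → Computable C M'
computable-≡ (code-Bool e) h d (v , p) = v , ≡-trans (≡-sym (≡-conv h (decodeBool e))) p
computable-≡ (code-Fam arrPi e ta tb B C) h d p w tN pN =
  computable-≡ (C w tN pN) (Decode.Pi-app ta tb e h w (≡-refl tN)) (Decode.Pi-app-t ta tb e d w tN)
    (p w tN pN)
computable-≡ (code-Fam arrSg e ta tb B C) h d p w =
  let tF , pF , pS = p w
      eF = Decode.Sg-fst ta tb e h w
      tF' = Decode.Sg-fst-t ta tb e d w
      pF' = computable-≡ (B w) eF tF' pF
      fib = fibre-cong tb w eF tF tF'
      tS = t-conv (Decode.Sg-snd-t ta tb e d w) (El-cong (≡-sym fib))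
  -- Equal first projections yield fibre codes that agree only judgmentally; irrelevance moves the
  -- second projection from one to the other.
  in tF' , pF' , irrelevant (C w tF pF) (C w tF' pF') fib tS
                   (computable-≡ (C w tF pF) (Decode.Sg-snd ta tb e h w) tS pS)
computable-≡ (code-Path e ta tˣ tʸ B X Y) h d p w dr =
  computable-≡ (B (dr ∷W w)) (DecodePath.Path-papp ta tˣ tʸ e h w dr)
    (DecodePath.Path-papp-t ta tˣ tʸ e d w dr) (p w dr)

-- By irrelevance the code can be hidden: a bundled element is computable for whichever code of the
-- same type is at hand (`Cmp-in`).
record Cmp (n : ℕ) (a M : Tm) : Set where
  constructor cmp
  field
    tm   : D n ⊢ M ∶ El a
    code : Code n a
    comp : Computable code M
open Cmp

Cmp≃ : a ≃ a' → M ≃ M' → Cmp n a M → Cmp n a' M'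
Cmp≃ refl refl c = c

Code≃ : a ≃ a' → Code n a → Code n a'
Code≃ refl c = c

Cmp-in : Cmp n a M → (C : Code n a) → Computable C M
Cmp-in c C = irrelevant (code c) C (code-refl C) (tm c) (comp c)

Cmp-conv : D n ⊢ a ≡ a' ∶ U → Cmp n a M → Cmp n a' M
Cmp-conv e (cmp d C p) = cmp (t-conv d (El-cong e)) C' (irrelevant C C' e d p)
  where C' = code-conv C (≡-sym e)

Cmp-≡ : D n ⊢ M ≡ M' ∶ El a → D n ⊢ M' ∶ El a → Cmp n a M → Cmp n a M'
Cmp-≡ e d' (cmp d C p) = cmp d' C (computable-≡ C e d' p)

-- Introduction, elimination and monotonicity of computable elements.

lift-∷-sub : ∀ N τ σ t → sub (N ∷ₛ τ) (sub (liftS σ) t) ≃ sub (N ∷ₛ (σ ⨟ τ)) t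
lift-∷-sub N τ σ t = trans (sub-sub _ (liftS σ) t) (sub-ext (lift-∷ N σ τ) t)

lit-sub : ∀ v → sub σ (lit v) ≃ lit v
lit-sub true = refl
lit-sub false = refl

-- In `code-Fam` the fibre depends on computability for one particular code of the domain. With
-- `Cmp` instead, families can be substituted without tracking that code.
record Fam (n : ℕ) (b c : Tm) : Set where
  field
    dom-t : D n ⊢ b ∶ U
    fib-t : D n ▷ ty (El b) ⊢ c ∶ U
    dom   : ∀ {m ρ} → World m ρ n → Code m (sub ρ b)
    fib   : ∀ {m ρ N} → World m ρ n → Cmp m (sub ρ b) N → Code m (sub (N ∷ₛ ρ) c)
open Fam

Fam-sub : Fam n b c → World m σ n → Fam m (sub σ b) (sub (liftS σ) c)
Fam-sub {b = b} {c} {σ = σ} F w = record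
  { dom-t = tmS (dom-t F) w
  ; fib-t = tmS (fib-t F) (liftTS (ty _) w (wf-ty (T-El (tmS (dom-t F) w))))
  ; dom = λ v → Code≃ (sym (sub-sub _ σ b)) (dom F (w ⨟TS v))
  ; fib = λ v cN → Code≃ (sym (lift-∷-sub _ _ σ c)) (fib F (w ⨟TS v) (Cmp≃ (sub-sub _ σ b) refl cN))
  }

arrow-t : ∀ {h} → Arrow h t b c → Γ ⊢ b ∶ U → Γ ▷ ty (El b) ⊢ c ∶ U → Γ ⊢ t ∶ U
arrow-t arrPi = t-cPi
arrow-t arrSg = t-cSg

Fam-code : ∀ {h} → Arrow h t b c → Fam n b c → Code n t
Fam-code A F = code-Fam A (≡-refl (arrow-t A (dom-t F) (fib-t F))) (dom-t F) (fib-t F) (dom F)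
  (λ w tN pN → fib F w (cmp tN (dom F w) pN))

code-fam : D n ⊢ b ∶ U → D n ▷ ty (El b) ⊢ c ∶ U →
           (B : ∀ {m ρ} → World m ρ n → Code m (sub ρ b)) →
           (∀ {m ρ N} (w : World m ρ n) → D m ⊢ N ∶ El (sub ρ b) → Computable (B w) N →
            Code m (sub (N ∷ₛ ρ) c)) → Fam n b c
code-fam tb tc B C = record
  { dom-t = tb ; fib-t = tc ; dom = B ; fib = λ w cN → C w (tm cN) (Cmp-in cN (B w)) }

pi-intro : Fam n b c → D n ⊢ M ∶ El (cPi b c) →
           (∀ {m ρ N} → World m ρ n → Cmp m (sub ρ b) N → Cmp m (sub (N ∷ₛ ρ) c) (app (sub ρ M) N)) →
           Cmp n (cPi b c) M
pi-intro F d h = cmp d (Fam-code arrPi F) λ w tN pN →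
  let cN = cmp tN (dom F w) pN in Cmp-in (h w cN) (fib F w cN)

pi-elim : Fam n b c → Cmp n (cPi b c) M → World m σ n → Cmp m (sub σ b) N →
          Cmp m (sub (N ∷ₛ σ) c) (app (sub σ M) N)
pi-elim F cM w cN = cmp (Decode.Pi-app-t (dom-t F) (fib-t F) (code-refl C) (tm cM) w (tm cN)) _
  (Cmp-in cM C w (tm cN) (Cmp-in cN (dom F w)))
  where C = Fam-code arrPi F

sg-introW : Fam n b c → D n ⊢ M ∶ El (cSg b c) →
            (∀ {m ρ} → World m ρ n → Cmp m (sub ρ b) (fst (sub ρ M))) →
            (∀ {m ρ} → World m ρ n → Cmp m (sub (fst (sub ρ M) ∷ₛ ρ) c) (snd (sub ρ M))) →
            Cmp n (cSg b c) M
sg-introW F d h g = cmp d (Fam-code arrSg F) λ w →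
  let cF = h w ; pF = Cmp-in cF (dom F w)
  in tm cF , pF , Cmp-in (g w) (fib F w (cmp (tm cF) (dom F w) pF))

sg-elim-fst : Fam n b c → Cmp n (cSg b c) M → World m σ n → Cmp m (sub σ b) (fst (sub σ M))
sg-elim-fst F cM w = let tF , pF , _ = Cmp-in cM (Fam-code arrSg F) w in cmp tF (dom F w) pF

sg-elim-snd : Fam n b c → Cmp n (cSg b c) M → World m σ n →
              Cmp m (sub (fst (sub σ M) ∷ₛ σ) c) (snd (sub σ M))
sg-elim-snd F cM w = let _ , _ , pS = Cmp-in cM C w in
  cmp (Decode.Sg-snd-t (dom-t F) (fib-t F) (code-refl C) (tm cM) w) _ pS
  where C = Fam-code arrSg F

record PathFam (n : ℕ) (b x y : Tm) : Set where
  field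
    line-t  : D (suc n) ⊢ b ∶ U
    left-t  : D n ⊢ x ∶ El (b [ i0 ]₀)
    right-t : D n ⊢ y ∶ El (b [ i1 ]₀)
    line    : ∀ {m ρ} → World m ρ (suc n) → Code m (sub ρ b)
    left    : ∀ {m ρ} → World m ρ n → Cmp m (sub (i0 ∷ₛ ρ) b) (sub ρ x)
    right   : ∀ {m ρ} → World m ρ n → Cmp m (sub (i1 ∷ₛ ρ) b) (sub ρ y)
open PathFam renaming (left to leftP; right to rightP)

PathFam-sub : PathFam n b x y → World m σ n → PathFam m (sub (liftS σ) b) (sub σ x) (sub σ y)
PathFam-sub {b = b} {x} {y} {σ = σ} F w = record
  { line-t = tmS (line-t F) (liftW w)
  ; left-t = ty≃ (cong El (inst {t = b})) (tmS (left-t F) w)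
  ; right-t = ty≃ (cong El (inst {t = b})) (tmS (right-t F) w)
  ; line = λ v → Code≃ (sym (sub-sub _ _ b)) (line F (liftW w ⨟TS v))
  ; left = λ v → Cmp≃ (sym (lift-∷-sub _ _ σ b)) (sym (sub-sub _ σ x)) (leftP F (w ⨟TS v))
  ; right = λ v → Cmp≃ (sym (lift-∷-sub _ _ σ b)) (sym (sub-sub _ σ y)) (rightP F (w ⨟TS v))
  }

Path-code : PathFam n b x y → Code n (cPath b x y)
Path-code F = code-Path (≡-refl (t-cPath (line-t F) (left-t F) (right-t F)))
  (line-t F) (left-t F) (right-t F) (line F)
  (λ w → Cmp-in (leftP F w) (line F (d-0 (TSub.ok w) ∷W w)))
  (λ w → Cmp-in (rightP F w) (line F (d-1 (TSub.ok w) ∷W w)))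

code-path : D (suc n) ⊢ b ∶ U → D n ⊢ x ∶ El (b [ i0 ]₀) → D n ⊢ y ∶ El (b [ i1 ]₀) →
            (B : ∀ {m ρ} → World m ρ (suc n) → Code m (sub ρ b)) →
            (∀ {m ρ} (w : World m ρ n) → Computable (B (d-0 (TSub.ok w) ∷W w)) (sub ρ x)) →
            (∀ {m ρ} (w : World m ρ n) → Computable (B (d-1 (TSub.ok w) ∷W w)) (sub ρ y)) →
            PathFam n b x y
code-path {b = b} tb tx₁ ty₁ B X Y = record
  { line-t = tb ; left-t = tx₁ ; right-t = ty₁ ; line = B
  ; left = λ w → cmp (ty≃ (cong El (sub-inst _ b _)) (tmS tx₁ w)) _ (X w)
  ; right = λ w → cmp (ty≃ (cong El (sub-inst _ b _)) (tmS ty₁ w)) _ (Y w) }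

path-intro : PathFam n b x y → D n ⊢ M ∶ El (cPath b x y) →
             (∀ {m ρ t} → World m ρ n → D m ⊢ᵈ t → Cmp m (sub (t ∷ₛ ρ) b) (papp (sub ρ M) t)) →
             Cmp n (cPath b x y) M
path-intro F d h = cmp d (Path-code F) λ w dt → Cmp-in (h w dt) (line F (dt ∷W w))

path-elim : PathFam n b x y → Cmp n (cPath b x y) M → World m σ n → D m ⊢ᵈ t →
            Cmp m (sub (t ∷ₛ σ) b) (papp (sub σ M) t)
path-elim F cM w dt = cmp
  (DecodePath.Path-papp-t (line-t F) (left-t F) (right-t F) (code-refl C) (tm cM) w dt) _
  (Cmp-in cM C w dt)
  where C = Path-code F

-- The components already have codes at every later world, so moving to one is precomposition and
-- not an induction.
code-mono : Code n a → World m σ n → Code m (sub σ a)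
code-mono (code-Bool e) w = code-Bool (eqS e w)
code-mono (code-Fam A e ta tb B C) w =
  code-conv (Fam-code (arrow-sub A) (Fam-sub (code-fam ta tb B C) w)) (eqS e w)
code-mono (code-Path e ta tx₁ ty₁ B X Y) w =
  code-conv (Path-code (PathFam-sub (code-path ta tx₁ ty₁ B X Y) w)) (eqS e w)

Cmp-mono : Cmp n a M → World m σ n → Cmp m (sub σ a) (sub σ M)
Cmp-mono (cmp d (code-Bool e) (v , p)) w =
  cmp (tmS d w) (code-Bool (eqS e w)) (v , eq≃ refl (lit-sub v) refl (eqS p w))
Cmp-mono {M = M} {σ = σ} (cmp d (code-Fam {a = b} {b = c} arrPi e ta tb B C) p) w =
  Cmp-conv (≡-sym (eqS e w))
    (pi-intro (Fam-sub F w) (tmS (t-conv d (El-cong e)) w) λ {_} {_} {N} v cN →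
      Cmp≃ (sym (lift-∷-sub _ _ σ c)) (cong (λ f → app f N) (sym (sub-sub _ σ M)))
        (pi-elim F (Cmp-conv e (cmp d (code-Fam arrPi e ta tb B C) p)) (w ⨟TS v)
          (Cmp≃ (sub-sub _ σ b) refl cN)))
  where F = code-fam ta tb B C
Cmp-mono {M = M} {σ = σ} (cmp d (code-Fam {a = b} {b = c} arrSg e ta tb B C) p) w =
  Cmp-conv (≡-sym (eqS e w))
    (sg-introW (Fam-sub F w) (tmS (t-conv d (El-cong e)) w)
      (λ v → Cmp≃ (sym (sub-sub _ σ b)) (cong fst (sym (sub-sub _ σ M)))
        (sg-elim-fst F cM (w ⨟TS v)))
      (λ v → Cmp≃
        (trans (sym (lift-∷-sub _ _ σ c))
          (cong (λ N → sub (fst N ∷ₛ _) (sub (liftS σ) c)) (sym (sub-sub _ σ M))))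
        (cong snd (sym (sub-sub _ σ M))) (sg-elim-snd F cM (w ⨟TS v))))
  where
  F = code-fam ta tb B C
  cM = Cmp-conv e (cmp d (code-Fam arrSg e ta tb B C) p)
Cmp-mono {M = M} {σ = σ} (cmp d (code-Path {a = b} e ta tx₁ ty₁ B X Y) p) w =
  Cmp-conv (≡-sym (eqS e w))
    (path-intro (PathFam-sub F w) (tmS (t-conv d (El-cong e)) w) λ {_} {_} {t} v dt →
      Cmp≃ (sym (lift-∷-sub _ _ σ b)) (cong (λ f → papp f t) (sym (sub-sub _ σ M)))
        (path-elim F (Cmp-conv e (cmp d (code-Path e ta tx₁ ty₁ B X Y) p)) (w ⨟TS v) dt))
  where F = code-path ta tx₁ ty₁ B X Y

pi-elim₀ : Fam n b c → Cmp n (cPi b c) M → Cmp n b N → Cmp n (c [ N ]₀) (app M N)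
pi-elim₀ {b = b} {M = M} {N} F cM cN = Cmp≃ refl (cong (λ f → app f N) (sub-id M))
  (pi-elim F cM idW (Cmp≃ (sym (sub-id b)) refl cN))

sg-elim-fst₀ : Fam n b c → Cmp n (cSg b c) M → Cmp n b (fst M)
sg-elim-fst₀ {b = b} {M = M} F cM = Cmp≃ (sub-id b) (cong fst (sub-id M)) (sg-elim-fst F cM idW)

sg-elim-snd₀ : Fam n b c → Cmp n (cSg b c) M → Cmp n (c [ fst M ]₀) (snd M)
sg-elim-snd₀ {c = c} {M} F cM = Cmp≃ (cong (λ N → c [ fst N ]₀) (sub-id M)) (cong snd (sub-id M))
  (sg-elim-snd F cM idW)

sg-intro : Fam n b c → D n ⊢ M ∶ El (cSg b c) → Cmp n b (fst M) → Cmp n (c [ fst M ]₀) (snd M) →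
           Cmp n (cSg b c) M
sg-intro {c = c} F d cF cS = sg-introW F d (Cmp-mono cF)
  (λ w → Cmp≃ (sub-inst _ c _) refl (Cmp-mono cS w))

-- Coercion and composition along computable lines of codes.

record Partial (n : ℕ) (r s A a : Tm) : Set where
  field
    ptm   : D n ▷ dim ▷ cof (partialCof r s) ⊢ a ∶ El (wk A)
    pcomp : ∀ {m σ} → TSub (D m) σ (D n ▷ dim ▷ cof (partialCof r s)) →
            Cmp m (sub (σ ∘ suc) A) (sub σ a)
open Partial

-- The closure properties at a single world. Where later worlds matter, they are requested for each
-- dimension substitution separately.
record LineOK (n : ℕ) (A : Tm) : Set where
  field
    coe-ok : ∀ {r r' M} → D n ⊢ᵈ r → D n ⊢ᵈ r' → Cmp n (A [ r ]₀) M → Cmp n (A [ r' ]₀) (coe r r' A M)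
    com-ok : ∀ {r r' s a} → D n ⊢ᵈ r → D n ⊢ᵈ r' → D n ⊢ᵈ s → Partial n r s A a →
             Cmp n (A [ r' ]₀) (com r r' s A a)
open LineOK

LineOK≃ : A ≃ A' → LineOK n A → LineOK n A'
LineOK≃ refl c = c

Partial-sub : D n ⊢ᵈ r → D n ⊢ᵈ s → Partial n r s A a → World m σ n →
              Partial m (sub σ r) (sub σ s) (sub (liftS σ) A) (sub (liftSⁿ 2 σ) a)
Partial-sub {A = A} {a = a} {σ = σ} d e P w = record
  { ptm = ty≃ (cong El (liftS-wk (liftS σ) A)) (tmS (ptm P) w₂)
  ; pcomp = λ {_} {τ} v → Cmp≃
      (sym (trans (sub-sub _ _ A) (sub-ext (λ x → sym (sub-ren τ suc (liftS σ x))) A)))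
      (sym (sub-sub τ _ a)) (pcomp P (w₂ ⨟TS v)) }
  where w₂ = liftCof w (dimS d w) (dimS e w)

LineOK-conv : D (suc n) ⊢ A ≡ A' ∶ U → D (suc n) ⊢ A ∶ U → LineOK n A' → LineOK n A
LineOK-conv {n} {A} {A'} e tA L = record
  { coe-ok = λ d d' cM → Cmp-≡
      (≡-sym (coe-cong e d d (⊨-refl d) d' d' (⊨-refl d') (≡-refl (tm cM)))) (t-coe tA d d' (tm cM))
      (Cmp-conv (≡-sym (at d')) (coe-ok L d d' (Cmp-conv (at d) cM)))
  ; com-ok = λ d d' f P →
      let okΞ = cof-ok (partialCof-form d f)
          tA' = t-conv (ptm P) (El-cong (wke okΞ e))
      in Cmp-≡
           (≡-sym (com-cong e d d (⊨-refl d) d' d' (⊨-refl d') f f (⊨-refl f) (≡-refl (ptm P)) tA'))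
           (t-com tA d d' f (ptm P))
           (Cmp-conv (≡-sym (at d')) (com-ok L d d' f record
             { ptm = tA' ; pcomp = λ w → Cmp-conv (eqS e (tailTS w)) (pcomp P w) })) }
  where
  at : D n ⊢ᵈ r → D n ⊢ A [ r ]₀ ≡ A' [ r ]₀ ∶ U
  at d = eqS e (d ∷W idW)

-- Composites of booleans.

bool-value : Cmp n cBool M → Σ 𝔹 λ v → D n ⊢ M ≡ lit v ∶ Bool
bool-value {n} c = Cmp-in c (code-Bool (≡-refl (t-cBool (D-ok n))))

lits-clash : ∀ {v v'} → Γ ⊢ lit v ≡ lit v' ∶ Bool → (v ≃ v') ⊎ Clash Γ
lits-clash {v = true} {true} e = inj₁ refl
lits-clash {v = false} {false} e = inj₁ refl
lits-clash {v = true} {false} e = inj₂ e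
lits-clash {v = false} {true} e = inj₂ (≡-sym e)

Bool-El : ⊢ Γ → Γ ⊢ᵗ Bool ≡ El cBool
Bool-El ok = Ty-sym (El-cBool ok)

lit-t : ∀ v → ⊢ Γ → Γ ⊢ lit v ∶ Bool
lit-t true = t-tt
lit-t false = t-ff

-- Turns the dimension `k` into a fresh last variable, so that an endpoint or `k` itself can be put
-- in its place.
abstract-at : ℕ → Sub
abstract-at k x with k ≟ x
... | yes _ = var 0
... | no _ = var (suc x)

abstract-at-inst : ∀ k → abstract-at k ⨟ (var k ∷ₛ var) ≗ var
abstract-at-inst k x with k ≟ x
... | yes refl = refl
... | no _ = refl

abstract-at-self : ∀ k → abstract-at k k ≃ var 0
abstract-at-self k with k ≟ k
... | yes _ = refl
... | no k≢k = ⊥-elim (k≢k refl)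

abstract-at-W : ∀ k → World (suc n) (abstract-at k) n
abstract-at-W {n} k = record { ok = D-ok (suc n) ; inh = go }
  where
  go : ∀ {x e} → D n ∋ x ⦂ e → Inhabits (D (suc n)) (abstract-at k x) (subE (abstract-at k) e)
  go {x} v with D-dims v
  ... | refl with k ≟ x
  ...   | yes _ = d-var (D-ok (suc n)) here
  ...   | no _ = d-var (D-ok (suc n)) (there v)

-- If `s` is an endpoint, the composite is its tube. If `s` is a variable, boundary separation along
-- `s` compares the composite with the literal of the cap. On either face the tube has one literal
-- as its value, and at `r` it meets the cap, so the literals agree or else `tt` and `ff` are
-- identified.
comBool-ok : D n ⊢ᵈ r → D n ⊢ᵈ r' → D n ⊢ᵈ s → Partial n r s cBool a → Cmp n cBool (com r r' s cBool a)
comBool-ok {n} {r} {r'} {s} {a} d d' e P = go e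
  where
  ok = D-ok n
  okd = D-ok (suc n)
  tB = t-cBool okd
  K : Tm
  K = com r r' s cBool a
  tK : D n ⊢ K ∶ El cBool
  tK = t-com tB d d' e (ptm P)
  done : ∀ v → D n ⊢ K ≡ lit v ∶ El cBool → Cmp n cBool K
  done v h = cmp tK (code-Bool (≡-refl (t-cBool ok))) (v , ≡-conv h (El-cBool ok))
  face : ∀ {m t σ} → World m σ n → D m ⊢ᵈ t → D m ⊨ (t ≐ sub σ r) ∨ ∂ (sub σ s) →
         TSub (D m) (i0 ∷ₛ t ∷ₛ σ) (D n ▷ dim ▷ cof (partialCof r s))
  face {t = t} {σ} w dt h =
    _∷TS_ {e = cof _} (cof≃ (sym (cong₂ (λ r s → (t ≐ r) ∨ ∂ s) (sub-∷-wk t σ r) (sub-∷-wk t σ s))) h)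
                      (dt ∷W w)
  onto-∂ : D n ⊨ (r' ≐ r) ∨ ∂ s → Cmp n cBool K
  onto-∂ h = Cmp-≡ (≡-sym (com-∂ tB d d' e (ptm P) h)) tK
    (pcomp P (face idW d' (cof≃ (cong₂ (λ r s → (r' ≐ r) ∨ ∂ s) (sym (sub-id r)) (sym (sub-id s))) h)))
  go : D n ⊢ᵈ s → Cmp n cBool K
  go (d-0 _) = onto-∂ (⊨-inr (f-eq d' d) (⊨-inl (⊨-refl e) (f-eq e (d-1 ok))))
  go (d-1 _) = onto-∂ (⊨-inr (f-eq d' d) (⊨-inr (f-eq e (d-0 ok)) (⊨-refl e)))
  go (d-var {x = k} _ _) = decide
    where
    K₁ : Tm
    K₁ = sub (abstract-at k) K
    tK₁ : D (suc n) ⊢ K₁ ∶ El cBool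
    tK₁ = tmS tK (abstract-at-W k)
    K₁-inst : K₁ [ var k ]₀ ≃ K
    K₁-inst = trans (sub-sub _ (abstract-at k) K) (sub-id′ (abstract-at-inst k) K)
    start : Σ 𝔹 λ v → D n ⊢ sub (i0 ∷ₛ r ∷ₛ var) a ≡ lit v ∶ Bool
    start = bool-value (pcomp P (face idW d
      (⊨-inl (subst (λ t → D n ⊨ r ≐ t) (sym (sub-id r)) (⊨-refl d))
             (subst (λ s → D n ⊢ᶠ ∂ s) (sym (sub-id s)) (∂-form e)))))
    -- With s replaced by an endpoint, a is a closed line of booleans, hence constant.
    module End {o : Tm} (d° : ∀ {Γ} → ⊢ Γ → Γ ⊢ᵈ o)
               (o-∂ : ∀ {Γ} → ⊢ Γ → Γ ⊨ ∂ o) (o-sub : ∀ σ → sub σ o ≃ o) where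
      θ : Sub
      θ = abstract-at k ⨟ (o ∷ₛ var)
      wθ : World n θ n
      wθ = abstract-at-W k ⨟TS (d° ok ∷W idW)
      θ-s : sub θ (var k) ≃ o
      θ-s = cong (sub (o ∷ₛ var)) (abstract-at-self k)
      at-end : ∀ {m t σ} → World m σ n → D m ⊢ᵈ t →
               D m ⊨ (t ≐ sub (θ ⨟ σ) r) ∨ ∂ (sub (θ ⨟ σ) (var k))
      at-end {σ = σ} w dt = ⊨-inr (f-eq dt (dimS d (wθ ⨟TS w)))
        (subst (λ s → _ ⊨ ∂ s) (sym (trans (cong (sub σ) θ-s) (o-sub σ))) (o-∂ (TSub.ok w)))
      v₀ : D (suc n) ⊢ᵈ var 0
      v₀ = d-var okd here
      -- The tube is evaluated at a fresh dimension. Its value is a literal, which no substitution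
      -- changes, so every instance has the same value.
      generic : Σ 𝔹 λ v → D (suc n) ⊢ sub (i0 ∷ₛ var 0 ∷ₛ (θ ⨟ (var ∘ suc))) a ≡ lit v ∶ Bool
      generic = bool-value (pcomp P (face (wθ ⨟TS wkW) v₀ (at-end wkW v₀)))
      value : 𝔹
      value = proj₁ generic
      at-dim : ∀ {t} → D n ⊢ᵈ t → D n ⊢ sub (i0 ∷ₛ t ∷ₛ θ) a ≡ lit value ∶ Bool
      at-dim {t} dt = eq≃
        (trans (sub-sub _ _ a) (sub-ext (λ { zero → refl ; (suc zero) → refl
          ; (suc (suc x)) → trans (sub-sub _ _ (θ x)) (sub-id (θ x)) }) a))
        (lit-sub value) refl (eqS (proj₂ generic) (dt ∷W idW))
      -- The tube at `r` and the cap with `s` replaced by the endpoint are the same term.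
      agrees : (value ≃ proj₁ start) ⊎ Clash (D n)
      agrees = lits-clash (≡-trans (≡-sym (at-dim (dimS d wθ)))
        (eq≃ (trans (sub-sub θ _ a) (sub-ext (λ { zero → refl ; (suc zero) → refl
                                                  ; (suc (suc x)) → refl }) a))
             (lit-sub (proj₁ start)) refl (eqS (proj₂ start) wθ)))
      K₁-end : D n ⊢ K₁ [ o ]₀ ≡ lit value ∶ El cBool
      K₁-end = ≡-conv (≡-trans
        (eq≃ (sym (sub-sub _ (abstract-at k) K)) refl refl
          (≡-conv (comS-∂ tB d e (ptm P) wθ (dimS d' wθ)
            (⊨-inr (f-eq (dimS d' wθ) (dimS d wθ)) (subst (λ s → D n ⊨ ∂ s) (sym θ-s) (o-∂ ok))))
            (El-cBool ok)))
        (at-dim (dimS d' wθ))) (Bool-El ok)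
      K-end : D n ▷ cof (var k ≐ o) ⊢ wk K ≡ wk (lit value) ∶ El cBool
      K-end = ≡-trans
        (eq≃ (trans (sym (wk-[]′ K₁ (var k))) (cong wk K₁-inst)) wk-inst-o refl
          -- Functionality does not cover dimensions that are equal only by assumption. The
          -- composite is therefore written as a path applied to `k`, and `papp-cong` exchanges `k`
          -- for the endpoint.
          (≡-trans (≡-sym (Path-β tK₂ (wkD okφ e)))
            (≡-trans (papp-cong (≡-refl (t-plam tK₂)) (wkD okφ e) (d° okφ)
                       (cof≃ (cong (var (suc k) ≐_) (trans (ren-sub suc o) (o-sub _))) (⊨-hyp okφ here)))
                     (Path-β tK₂ (d° okφ)))))
        (wke okφ K₁-end)
        where
        okφ = cof-ok (f-eq e (d° ok))
        K₂ : Tm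
        K₂ = sub (liftS (var ∘ suc)) K₁
        tK₂ = tmS tK₁ (liftTS dim (wkTS okφ) wf-dim)
        wk-inst-o : K₂ [ o ]₀ ≃ wk (K₁ [ o ]₀)
        wk-inst-o = sym (trans (wk-[]′ K₁ o) (cong (K₂ [_]₀) (trans (ren-sub suc o) (o-sub _))))
    module E₀ = End d-0 (λ ok → ⊨-inl (⊨-refl (d-0 ok)) (f-eq (d-0 ok) (d-1 ok))) (λ _ → refl)
    module E₁ = End d-1 (λ ok → ⊨-inr (f-eq (d-1 ok) (d-0 ok)) (⊨-refl (d-1 ok))) (λ _ → refl)
    by-clash : Clash (D n) → Cmp n cBool K
    by-clash k = done true (≡-conv (clash-Bool k (t-conv tK (El-cBool ok))) (Bool-El ok))
    decide : Cmp n cBool K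
    decide with E₀.agrees | E₁.agrees
    ... | inj₂ k | _ = by-clash k
    ... | inj₁ _ | inj₂ k = by-clash k
    ... | inj₁ p | inj₁ q = done (proj₁ start) (bsep∂ (t-cBool ok) e tK
      (t-conv (lit-t (proj₁ start) ok) (Bool-El ok))
      (subst (λ v → _ ⊢ wk K ≡ wk (lit v) ∶ El cBool) p E₀.K-end)
      (subst (λ v → _ ⊢ wk K ≡ wk (lit v) ∶ El cBool) q E₁.K-end))

-- Lines of codes for Π and Σ.

record LineFam (n : ℕ) (b c : Tm) : Set where
  field
    fam    : Fam (suc n) b c
    -- The last variable of the world `suc m` is the direction. The identity gives the line itself,
    -- and a lifted weakening gives its copy in a larger world, where fillers live.
    dom-ok : ∀ {m ρ} → World (suc m) ρ (suc n) → LineOK m (sub ρ b)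
    fib-ok : ∀ {m ρ N} → World (suc m) ρ (suc n) → Cmp (suc m) (sub ρ b) N →
             LineOK m (sub (N ∷ₛ ρ) c)
open LineFam

LineFam-sub : LineFam n b c → World m σ n → LineFam m (sub (liftS σ) b) (sub (liftSⁿ 2 σ) c)
LineFam-sub {b = b} {c} L w = record
  { fam = Fam-sub (fam L) (liftW w)
  ; dom-ok = λ v → LineOK≃ (sym (sub-sub _ _ b)) (dom-ok L (liftW w ⨟TS v))
  ; fib-ok = λ v cN → LineOK≃ (sym (lift-∷-sub _ _ _ c))
      (fib-ok L (liftW w ⨟TS v) (Cmp≃ (sub-sub _ _ b) refl cN)) }

module LineFamily {n : ℕ} {b c : Tm} (L : LineFam n b c) where

  tb : D (suc n) ⊢ b ∶ U
  tb = dom-t (fam L)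

  tc : D (suc n) ▷ ty (El b) ⊢ c ∶ U
  tc = fib-t (fam L)

  open Family tb tc
  open CoercionEqs tb tc

  v₀ : D (suc n) ⊢ᵈ var 0
  v₀ = d-var (D-ok (suc n)) here

  dom₀ : LineOK n b
  dom₀ = LineOK≃ (sub-id b) (dom-ok L idW)

  domᵂ : LineOK (suc n) (sub (liftS (var ∘ suc)) b)
  domᵂ = dom-ok L (liftW wkW)

  fib₀ : Cmp (suc n) b N → LineOK n (c [ N ]₀)
  fib₀ cN = fib-ok L idW (Cmp≃ (sym (sub-id b)) refl cN)

  fam-at-dim : D n ⊢ᵈ r → Fam n (b [ r ]₀) (sub (liftS (r ∷ₛ var)) c)
  fam-at-dim d = Fam-sub (fam L) (d ∷W idW)

  fibre-at : D n ⊢ᵈ r → D n ⊢ M ≡ N ∶ El (b [ r ]₀) → D n ⊢ M ∶ El (b [ r ]₀) →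
             D n ⊢ N ∶ El (b [ r ]₀) → D n ⊢ sub (M ∷ₛ r ∷ₛ var) c ≡ sub (N ∷ₛ r ∷ₛ var) c ∶ U
  fibre-at d = fibre-cong tc (d ∷W idW)

  at-var₀ : sub (liftS (var ∘ suc)) b [ var 0 ]₀ ≃ b
  at-var₀ = trans (lift-inst (var 0) (var ∘ suc) b) (sub-id-cons b)

  -- A filler is a coercion towards the new variable, in a world with one more dimension and along
  -- the weakened line.
  coe-fill : D n ⊢ᵈ r → Cmp n (b [ r ]₀) N → Cmp (suc n) b (coeS (var ∘ suc) r (var 0) b N)
  coe-fill d cN = Cmp≃ at-var₀ refl
    (coe-ok domᵂ (dimS d wkW) v₀ (Cmp≃ (inst {t = b}) refl (Cmp-mono cN wkW)))

  coePi-elim : D n ⊢ᵈ r → D n ⊢ᵈ r' → Cmp n (cPi b c [ r ]₀) M → Cmp n (b [ r' ]₀) N →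
               Cmp n (sub (N ∷ₛ r' ∷ₛ var) c) (app (coe r r' (cPi b c) M) N)
  coePi-elim {r} {r'} {M} {N} d d' cM cN = Cmp-≡ (≡-sym (coePi-app d d' (tm cM) (tm cN)))
    (app-t d' (t-coe (t-cPi tb tc) d d' (tm cM)) (tm cN))
    (Cmp-conv (fibre-at d' (coe-refl tb d' d' (⊨-refl d') (tm cN)) (t-coe tb d' d' (tm cN)) (tm cN))
      (Cmp≃ (fill-inst′ r' r' b N c) refl
        (coe-ok (fib₀ (coe-fill d' cN)) d d'
          (Cmp≃ (trans (lift-inst _ _ c) (sym (fill-inst′ r r' b N c))) refl
            (pi-elim₀ (fam-at-dim d) cM (coe-ok dom₀ d' d cN))))))

  coeSg-ok : D n ⊢ᵈ r → D n ⊢ᵈ r' → Cmp n (cSg b c [ r ]₀) M →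
             Cmp n (cSg b c [ r' ]₀) (coe r r' (cSg b c) M)
  coeSg-ok {r} {r'} {M} d d' cM = sg-intro (fam-at-dim d') tC
    (Cmp-≡ (≡-sym (coeSg-fst d d' (tm cM))) (fst-t d' tC) cF')
    (Cmp≃ (sym (lift-inst _ _ c)) refl
      (Cmp-≡ (≡-conv (≡-sym (coeSg-snd d d' (tm cM))) (El-cong move)) (snd-t d' tC)
        (Cmp-conv move (Cmp≃ (fill-inst′ r' r b (fst M) c) refl
          (coe-ok (fib₀ (coe-fill d cF)) d d'
            (Cmp≃ (sym (fill-inst′ r r b (fst M) c)) refl
              (Cmp-conv (fibre-at d (≡-sym (coe-refl tb d d (⊨-refl d) (tm cF))) (tm cF)
                                    (t-coe tb d d (tm cF)))
                (Cmp≃ (lift-inst _ _ c) refl (sg-elim-snd₀ (fam-at-dim d) cM)))))))))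
    where
    tC = t-coe (t-cSg tb tc) d d' (tm cM)
    cF = sg-elim-fst₀ (fam-at-dim d) cM
    cF' = coe-ok dom₀ d d' cF
    move = fibre-at d' (≡-sym (coeSg-fst d d' (tm cM))) (tm cF') (fst-t d' tC)

  module _ {r r' s a : Tm} (d : D n ⊢ᵈ r) (d' : D n ⊢ᵈ r') (e : D n ⊢ᵈ s) where

    open CompositionEqs {r = r} {r'} {s} {a} tb tc d d' e

    comPi-elim : Partial n r s (cPi b c) a → Cmp n (b [ r' ]₀) N →
                 Cmp n (sub (N ∷ₛ r' ∷ₛ var) c) (app (com r r' s (cPi b c) a) N)
    comPi-elim {N} P cN = Cmp-≡ (≡-sym (comPi-app (ptm P) (tm cN)))
      (app-t d' (t-com (t-cPi tb tc) d d' e (ptm P)) (tm cN))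
      (Cmp-conv (fibre-at d' (coe-refl tb d' d' (⊨-refl d') (tm cN)) (t-coe tb d' d' (tm cN)) (tm cN))
        (Cmp≃ (fill-inst′ r' r' b N c) refl
          (com-ok (fib₀ g) d d' e record
            { ptm = comPi-arg-t (ptm P) (fill-t tb d' (tm cN))
            ; pcomp = λ {_} {σ} w → Cmp≃ (sym (inst {t = c}))
                (cong (app (sub σ a)) (sym (sub-ren σ suc G)))
                (pi-elim₀ (Fam-sub (fam L) (tailTS w)) (pcomp P w) (Cmp-mono g (tailTS w))) })))
      where
      G : Tm
      G = coeS (var ∘ suc) r' (var 0) b N
      g = coe-fill d' cN

    comSg-ok : Partial n r s (cSg b c) a → Cmp n (cSg b c [ r' ]₀) (com r r' s (cSg b c) a)
    comSg-ok P = sg-intro (fam-at-dim d') tC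
      (Cmp-≡ (≡-sym (comSg-fst (ptm P))) (fst-t d' tC) cF)
      (Cmp≃ (sym (lift-inst _ _ c)) refl
        (Cmp-≡ (≡-conv (≡-sym (comSg-snd (ptm P))) (El-cong move)) (snd-t d' tC)
          (Cmp-conv move (Cmp≃ (comSg-inst (ptm P)) refl (com-ok (fib₀ h) d d' e record
            { ptm = comSg-snd-t (ptm P)
            ; pcomp = λ {_} {σ} w → Cmp≃ (sym (sub-inst _ c _)) refl
                -- At a point of the tube the second component lies over `fst a`, while the line of
                -- fibres is taken over the filler; the two agree there only judgmentally.
                (Cmp-conv (fibre-cong tc (tailTS w) (≡-sym (fill-at w))
                            (tm (cF-at w)) (tmS (comSg-fill-t (ptm P)) (tailTS w)))
                  (Cmp≃ (lift-inst _ _ c) refl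
                    (sg-elim-snd₀ (Fam-sub (fam L) (tailTS w)) (pcomp P w)))) })))))
      where
      tC = t-com (t-cSg tb tc) d d' e (ptm P)
      cF-at : ∀ {m σ} → TSub (D m) σ Ξ → Cmp m (sub (σ ∘ suc) b) (fst (sub σ a))
      cF-at w = sg-elim-fst₀ (Fam-sub (fam L) (tailTS w)) (pcomp P w)
      PF : Partial n r s b (fst a)
      PF = record { ptm = comSg-fst-t (ptm P) ; pcomp = cF-at }
      cF = com-ok dom₀ d d' e PF
      move = fibre-at d' (≡-sym (comSg-fst (ptm P))) (tm cF) (fst-t d' tC)
      h : Cmp (suc n) b (comSg-fill (ptm P))
      h = Cmp≃ at-var₀ refl (com-ok domᵂ (dimS d wkW) v₀ (dimS e wkW) (Partial-sub d e PF wkW))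
      fill-at : ∀ {m σ} → TSub (D m) σ Ξ →
                D m ⊢ sub (σ ∘ suc) (comSg-fill (ptm P)) ≡ fst (sub σ a) ∶ El (sub (σ ∘ suc) b)
      fill-at {σ = σ} w = eq≃ (sub-ren σ suc (comSg-fill (ptm P))) refl (cong El (sub-ren σ suc b))
        (eqS (comSg-fill-∂ (ptm P)) w)

private
  at-world : ∀ N r σ c → sub (N ∷ₛ sub σ r ∷ₛ var) (sub (liftSⁿ 2 σ) c) ≃
                         sub (N ∷ₛ σ) (sub (liftS (r ∷ₛ var)) c)
  at-world N r σ c = trans (∷-lift₂ N (sub σ r) σ c)
    (sym (trans (lift-∷-sub N σ (r ∷ₛ var) c)
                    (sub-ext (λ { zero → refl ; (suc zero) → refl ; (suc (suc x)) → refl }) c)))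

coePi-ok : LineFam n b c → D n ⊢ᵈ r → D n ⊢ᵈ r' → Cmp n (cPi b c [ r ]₀) M →
           Cmp n (cPi b c [ r' ]₀) (coe r r' (cPi b c) M)
coePi-ok {b = b} {c} {r' = r'} L d d' cM = pi-intro (LineFamily.fam-at-dim L d')
  (t-coe (t-cPi (dom-t (fam L)) (fib-t (fam L))) d d' (tm cM))
  λ {_} {σ} {N} w cN → Cmp≃ (at-world N r' σ c) refl
    (LineFamily.coePi-elim (LineFam-sub L w) (dimS d w) (dimS d' w)
      (Cmp≃ (inst {t = cPi b c}) refl (Cmp-mono cM w)) (Cmp≃ (inst {t = b}) refl cN))

comPi-ok : LineFam n b c → D n ⊢ᵈ r → D n ⊢ᵈ r' → D n ⊢ᵈ s → Partial n r s (cPi b c) a →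
           Cmp n (cPi b c [ r' ]₀) (com r r' s (cPi b c) a)
comPi-ok {b = b} {c} {r' = r'} L d d' e P = pi-intro (LineFamily.fam-at-dim L d')
  (t-com (t-cPi (dom-t (fam L)) (fib-t (fam L))) d d' e (ptm P))
  λ {_} {σ} {N} w cN → Cmp≃ (at-world N r' σ c) refl
    (LineFamily.comPi-elim (LineFam-sub L w) (dimS d w) (dimS d' w) (dimS e w)
      (Partial-sub d e P w) (Cmp≃ (inst {t = b}) refl cN))

-- Lines of codes for Path.

record LinePath (n : ℕ) (b x y : Tm) : Set where
  field
    pfam    : PathFam (suc n) b x y
    line-ok : ∀ {m ρ} → World (suc m) ρ (suc (suc n)) → LineOK m (sub ρ b)
open LinePath

LinePath-sub : LinePath n b x y → World m σ n →
               LinePath m (sub (liftSⁿ 2 σ) b) (sub (liftS σ) x) (sub (liftS σ) y)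
LinePath-sub {b = b} L w = record
  { pfam = PathFam-sub (pfam L) (liftW w)
  ; line-ok = λ v → LineOK≃ (sym (sub-sub _ _ b)) (line-ok L (liftW (liftW w) ⨟TS v)) }

module LinePathFamily {n : ℕ} {b x y r r' t : Tm} (L : LinePath n b x y)
  (d : D n ⊢ᵈ r) (d' : D n ⊢ᵈ r') (dt : D n ⊢ᵈ t) where

  private
    tb = line-t (pfam L)
    tP : D (suc n) ⊢ cPath b x y ∶ U
    tP = t-cPath tb (left-t (pfam L)) (right-t (pfam L))

  open PathEqs {t = t} tb (left-t (pfam L)) (right-t (pfam L)) d d' dt
    renaming (line to lineₜ; line-t to lineₜ-t)

  line₀ : LineOK n lineₜ
  line₀ = line-ok L (wkD (D-ok (suc n)) dt ∷W idW)

  line-sub : ∀ σ → sub σ lineₜ ≃ sub (sub (σ ∘ suc) t ∷ₛ σ) b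
  line-sub σ = trans (sub-inst σ b (wk t)) (cong (λ t → sub (t ∷ₛ σ) b) (sub-ren σ suc t))

  comPath-elim : ∀ {s a} → D n ⊢ᵈ s → Partial n r s (cPath b x y) a →
                 Cmp n (lineₜ [ r' ]₀) (papp (com r r' s (cPath b x y) a) t)
  comPath-elim {a = a} e P = Cmp-≡ (≡-sym (comPath-papp e (ptm P)))
    (papp-t d' (t-com tP d d' e (ptm P)))
    (com-ok line₀ d d' e record
      { ptm = comPath-arg-t e (ptm P)
      ; pcomp = λ {_} {σ} w → Cmp≃
          (trans (lift-inst _ _ b) (sym (line-sub (σ ∘ suc))))
          (cong₂ papp (sub-id (sub σ a))
            (sym (trans (sub-ren σ suc (wk t)) (sub-ren (σ ∘ suc) suc t))))
          (path-elim (PathFam-sub (pfam L) (tailTS w)) (pcomp P w) idW (dimS dt (tailTS (tailTS w)))) })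

  module _ {p : Tm} (cp : Cmp n (cPath b x y [ r ]₀) p) where

    -- The points where the tube of `coePath-papp` is defined. If `u` is `r` nothing is coerced and
    -- the given path is evaluated; if the coordinate is an end, the value is an endpoint of the
    -- path type over `u`.
    coe-at-face : ∀ {m σ u} → World m σ n → D m ⊢ᵈ u →
      Holds ((u ≐ sub σ r) ∨ ∂ (sub σ t)) →
      Cmp m (sub (sub σ t ∷ₛ u ∷ₛ σ) b) (papp (coeS σ r u (cPath b x y) p) (sub σ t))
    coe-at-face {m} {σ} {u} w du (inj₁ refl) = Cmp-≡ (≡-sym eq) (tC (dimS dt w))
      (Cmp≃ (trans (lift-∷-sub _ _ _ b) (sub-ext (λ { zero → refl ; (suc zero) → refl
                                                      ; (suc (suc x)) → refl }) b)) refl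
        (path-elim (PathFam-sub (pfam L) (d ∷W idW)) cp w (dimS dt w)))
      where
      El-Path : D m ⊢ᵗ El (sub (u ∷ₛ σ) (cPath b x y)) ≡
                       Path (El (sub (liftS (u ∷ₛ σ)) b)) (sub (u ∷ₛ σ) x) (sub (u ∷ₛ σ) y)
      El-Path = tyeqS (El-cPath tb (left-t (pfam L)) (right-t (pfam L))) (du ∷W w)
      tC : D m ⊢ᵈ M → D m ⊢ papp (coeS σ r u (cPath b x y) p) M ∶ El (sub (M ∷ₛ u ∷ₛ σ) b)
      tC dM = ty≃ (cong El (lift-inst _ _ b)) (t-papp (t-conv (coeS-t tP d (tm cp) w du) El-Path) dM)
      eq = eqt≃ (cong El (lift-inst _ _ b))
        (papp-cong (≡-conv (coeS-refl tP d (tm cp) w du (⊨-refl du)) El-Path)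
                   (dimS dt w) (dimS dt w) (⊨-refl (dimS dt w)))
    coe-at-face {m} {σ} {u} w du (inj₂ h) = go h
      where
      C = t-conv (coeS-t tP d (tm cp) w du)
        (tyeqS (El-cPath tb (left-t (pfam L)) (right-t (pfam L))) (du ∷W w))
      end : ∀ {M} → D m ⊢ᵈ M → D m ⊢ papp (coeS σ r u (cPath b x y) p) M ∶ El (sub (M ∷ₛ u ∷ₛ σ) b)
      end dM = ty≃ (cong El (lift-inst _ _ b)) (t-papp C dM)
      go : Holds (∂ (sub σ t)) →
           Cmp m (sub (sub σ t ∷ₛ u ∷ₛ σ) b) (papp (coeS σ r u (cPath b x y) p) (sub σ t))
      go (inj₁ q) = subst (λ t → Cmp m (sub (t ∷ₛ u ∷ₛ σ) b) (papp (coeS σ r u (cPath b x y) p) t))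
        (sym q) (Cmp-≡ (≡-sym (eqt≃ (cong El (lift-inst _ _ b)) (Path-∂₀ C)))
                         (end (d-0 (D-ok m))) (leftP (pfam L) (du ∷W w)))
      go (inj₂ q) = subst (λ t → Cmp m (sub (t ∷ₛ u ∷ₛ σ) b) (papp (coeS σ r u (cPath b x y) p) t))
        (sym q) (Cmp-≡ (≡-sym (eqt≃ (cong El (lift-inst _ _ b)) (Path-∂₁ C)))
                         (end (d-1 (D-ok m))) (rightP (pfam L) (du ∷W w)))

    coePath-elim : Cmp n (lineₜ [ r' ]₀) (papp (coe r r' (cPath b x y) p) t)
    coePath-elim = Cmp-≡ (≡-sym (coePath-papp (tm cp))) (papp-t d' (t-coe tP d d' (tm cp)))
      (com-ok line₀ d d' dt record
        { ptm = wkt (cof-ok (partialCof-form d dt)) (coePath-fill-t (tm cp))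
        ; pcomp = λ {_} {σ} w → Cmp≃
            (sym (trans (line-sub (σ ∘ suc))
              (sub-ext (λ { zero → refl ; (suc zero) → refl ; (suc (suc x)) → refl }) b)))
            (sym (trans (sub-ren σ suc (coePath-fill p))
              (cong₂ papp (coeS-sub (σ ∘ suc) (var ∘ suc) r (var 0) (cPath b x y) p)
                          (sub-ren (σ ∘ suc) suc t))))
            (coe-at-face (tailTS (tailTS w)) (headTS (tailTS w))
              (subst₂ (λ r t → Holds ((σ 1 ≐ r) ∨ ∂ t)) (sub-ren _ suc r) (sub-ren _ suc t)
                (sound-D (headTS w)))) })

private
  line-at-world : ∀ t r σ b → (sub (liftSⁿ 2 σ) b [ wk t ]₀) [ sub σ r ]₀ ≃
                              sub (t ∷ₛ σ) (sub (liftS (r ∷ₛ var)) b)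
  line-at-world t r σ b = trans (sub-inst _ (sub (liftSⁿ 2 σ) b) _)
    (trans (cong (λ t → sub (t ∷ₛ sub σ r ∷ₛ var) (sub (liftSⁿ 2 σ) b)) (wk-inst (sub σ r) t))
             (at-world t r σ b))

coePath-ok : LinePath n b x y → D n ⊢ᵈ r → D n ⊢ᵈ r' → Cmp n (cPath b x y [ r ]₀) p →
             Cmp n (cPath b x y [ r' ]₀) (coe r r' (cPath b x y) p)
coePath-ok {b = b} {x} {y} {r} {r'} L d d' cp = path-intro (PathFam-sub (pfam L) (d' ∷W idW))
  (t-coe (t-cPath (line-t (pfam L)) (left-t (pfam L)) (right-t (pfam L))) d d' (tm cp))
  λ {_} {σ} {t} w dt → Cmp≃ (line-at-world t r' σ b) refl
    (LinePathFamily.coePath-elim (LinePath-sub L w) (dimS d w) (dimS d' w) dt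
      (Cmp≃ (inst {t = cPath b x y}) refl (Cmp-mono cp w)))

comPath-ok : LinePath n b x y → D n ⊢ᵈ r → D n ⊢ᵈ r' → D n ⊢ᵈ s → Partial n r s (cPath b x y) a →
             Cmp n (cPath b x y [ r' ]₀) (com r r' s (cPath b x y) a)
comPath-ok {b = b} {x} {y} {r} {r'} L d d' e P = path-intro (PathFam-sub (pfam L) (d' ∷W idW))
  (t-com (t-cPath (line-t (pfam L)) (left-t (pfam L)) (right-t (pfam L))) d d' e (ptm P))
  λ {_} {σ} {t} w dt → Cmp≃ (line-at-world t r' σ b) refl
    (LinePathFamily.comPath-elim (LinePath-sub L w) (dimS d w) (dimS d' w) dt (dimS e w)
      (Partial-sub d e P w))

-- A code in the world with the extra dimension has one head for the whole line, so one code former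
-- is treated at a time. The substituted components are subtrees, which makes the recursion
-- structural; `cBool` is a constant line, where regularity settles coercion.
computable-line : Code (suc n) A → D (suc n) ⊢ A ∶ U → LineOK n A
computable-line {n} (code-Bool e) tA = LineOK-conv e tA record
  { coe-ok = λ d d' c → Cmp-≡ (≡-sym (coe-reg (t-cBool (D-ok n)) d d' (tm c)))
                              (t-coe (t-cBool (D-ok (suc n))) d d' (tm c)) c
  ; com-ok = comBool-ok }
computable-line {n} (code-Fam {a = b} {b = c} A e ta tb B C) tA = LineOK-conv e tA (arrow A)
  where
  L : LineFam n b c
  L = record
    { fam = code-fam ta tb B C
    ; dom-ok = λ w → computable-line (B w) (tmS ta w)
    ; fib-ok = λ w cN → computable-line (C w (tm cN) (Cmp-in cN (B w))) (fibre-t tb w (tm cN)) }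
  arrow : ∀ {h t} → Arrow h t b c → LineOK n t
  arrow arrPi = record { coe-ok = coePi-ok L ; com-ok = comPi-ok L }
  arrow arrSg = record
    { coe-ok = LineFamily.coeSg-ok L ; com-ok = LineFamily.comSg-ok L }
computable-line {n} (code-Path e ta tx₁ ty₁ B X Y) tA = LineOK-conv e tA
  record { coe-ok = coePath-ok L ; com-ok = comPath-ok L }
  where
  L : LinePath n _ _ _
  L = record
    { pfam = code-path ta tx₁ ty₁ B X Y
    ; line-ok = λ w → computable-line (B w) (tmS ta w) }

-- The computability predicate of an open type at a closing substitution.

⟦_⟧ : Tm → ℕ → Sub → Tm → Set
⟦ Pi A B ⟧ n σ M = ∀ {m ρ N} → World m ρ n → D m ⊢ N ∶ sub (σ ⨟ ρ) A → ⟦ A ⟧ m (σ ⨟ ρ) N →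
  ⟦ B ⟧ m (N ∷ₛ (σ ⨟ ρ)) (app (sub ρ M) N)
-- Membership in a derivable judgment does not entail that its type is well-formed, hence the
-- functionality of B is part of the predicate, and so is its independence of the choice of
-- a representative of the first component.
⟦ Sg A B ⟧ n σ M = ∀ {m ρ} → World m ρ n → ⟦ A ⟧ m (σ ⨟ ρ) (fst (sub ρ M)) ×
  (∀ {F F'} → D m ⊢ F ≡ F' ∶ sub (σ ⨟ ρ) A → D m ⊢ F ∶ sub (σ ⨟ ρ) A → D m ⊢ F' ∶ sub (σ ⨟ ρ) A →
   D m ⊢ᵗ sub (F ∷ₛ (σ ⨟ ρ)) B ≡ sub (F' ∷ₛ (σ ⨟ ρ)) B) ×
  (∀ {F} → D m ⊢ F ≡ fst (sub ρ M) ∶ sub (σ ⨟ ρ) A → D m ⊢ F ∶ sub (σ ⨟ ρ) A →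
   ⟦ B ⟧ m (F ∷ₛ (σ ⨟ ρ)) (snd (sub ρ M)))
⟦ Path A x y ⟧ n σ M = ∀ {m ρ t} → World m ρ n → D m ⊢ᵈ t →
  ⟦ A ⟧ m (t ∷ₛ (σ ⨟ ρ)) (papp (sub ρ M) t)
⟦ Bool ⟧ n σ M = Σ 𝔹 λ v → D n ⊢ M ≡ lit v ∶ Bool
⟦ U ⟧ n σ M = Code n M
⟦ El a ⟧ n σ M = Cmp n (sub σ a) M
⟦ _ ⟧ n σ M = ⊥

-- A substitute for well-formedness that the type of every derivable term does satisfy (`shape-t`).
-- It excludes the clause of the interpretation that is empty and carries the inductions on types.
data Shape : Tm → Set where
  sPi   : Shape A → Shape B → Shape (Pi A B)
  sSg   : Shape A → Shape B → Shape (Sg A B)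
  sPath : Shape A → Shape (Path A x y)
  sBool : Shape Bool
  sU    : Shape U
  sEl   : Shape (El a)

shape-sub : ∀ σ → Shape A → Shape (sub σ A)
shape-sub σ (sPi S T) = sPi (shape-sub σ S) (shape-sub (liftS σ) T)
shape-sub σ (sSg S T) = sSg (shape-sub σ S) (shape-sub (liftS σ) T)
shape-sub σ (sPath S) = sPath (shape-sub (liftS σ) S)
shape-sub σ sBool = sBool
shape-sub σ sU = sU
shape-sub σ sEl = sEl

shape-wk : Shape A → Shape (wk A)
shape-wk {A} S = subst Shape (sym (ren-sub suc A)) (shape-sub (var ∘ suc) S)

-- The premises of `t-split` mention its type only in weakened form.
shape-unren : ∀ ρ A → Shape (ren ρ A) → Shape A
shape-unren ρ (Pi A B) (sPi S T) = sPi (shape-unren ρ A S) (shape-unren (liftR ρ) B T)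
shape-unren ρ (Sg A B) (sSg S T) = sSg (shape-unren ρ A S) (shape-unren (liftR ρ) B T)
shape-unren ρ (Path A x y) (sPath S) = sPath (shape-unren (liftR ρ) A S)
shape-unren ρ Bool sBool = sBool
shape-unren ρ U sU = sU
shape-unren ρ (El a) sEl = sEl

-- Semantic substitution, monotonicity and stability under equality.

≗-sym : σ ≗ τ → τ ≗ σ
≗-sym e x = sym (e x)

⨟-ext : σ ≗ τ → ∀ {υ} → σ ⨟ υ ≗ τ ⨟ υ
⨟-ext e {υ} x = cong (sub υ) (e x)

sub-ext-ty : σ ≗ τ → Γ ⊢ a ∶ sub σ A → Γ ⊢ a ∶ sub τ A
sub-ext-ty {A = A} e = ty≃ (sub-ext e A)

⟦⟧-ext : Shape A → σ ≗ τ → ⟦ A ⟧ n σ M → ⟦ A ⟧ n τ M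
⟦⟧-ext {Pi A B} (sPi S T) e p w tN pN =
  ⟦⟧-ext T (∷-ext (⨟-ext e)) (p w (sub-ext-ty {A = A} (≗-sym (⨟-ext e)) tN) (⟦⟧-ext S (≗-sym (⨟-ext e)) pN))
⟦⟧-ext {Sg A B} (sSg S T) e p w =
  let p₁ , f , p₂ = p w
      A≃ = sub-ext (≗-sym (⨟-ext e)) A
  in ⟦⟧-ext S (⨟-ext e) p₁
   , (λ h t t' → tyeq≃ (sub-ext (∷-ext (⨟-ext e)) B) (sub-ext (∷-ext (⨟-ext e)) B)
                   (f (eqt≃ A≃ h) (ty≃ A≃ t) (ty≃ A≃ t')))
   , (λ h t → ⟦⟧-ext T (∷-ext (⨟-ext e)) (p₂ (eqt≃ A≃ h) (ty≃ A≃ t)))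
⟦⟧-ext (sPath S) e p w dt = ⟦⟧-ext S (∷-ext (⨟-ext e)) (p w dt)
⟦⟧-ext sBool e p = p
⟦⟧-ext sU e p = p
⟦⟧-ext {El a} sEl e p = Cmp≃ (sub-ext e a) refl p

⨟-assoc : ∀ σ τ υ → σ ⨟ (τ ⨟ υ) ≗ (σ ⨟ τ) ⨟ υ
⨟-assoc σ τ υ x = sym (sub-sub υ τ (σ x))

lift-∷-⨟ : ∀ N τ σ υ → liftS τ ⨟ (N ∷ₛ (σ ⨟ υ)) ≗ N ∷ₛ ((τ ⨟ σ) ⨟ υ)
lift-∷-⨟ N τ σ υ x = trans (lift-∷ N τ (σ ⨟ υ) x) (∷-ext (⨟-assoc τ σ υ) x)

under : ∀ τ σ υ A → sub (σ ⨟ υ) (sub τ A) ≃ sub ((τ ⨟ σ) ⨟ υ) A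
under τ σ υ A = trans (sub-sub (σ ⨟ υ) τ A) (sub-ext (⨟-assoc τ σ υ) A)

under-∷ : ∀ N τ σ υ B → sub (N ∷ₛ (σ ⨟ υ)) (sub (liftS τ) B) ≃ sub (N ∷ₛ ((τ ⨟ σ) ⨟ υ)) B
under-∷ N τ σ υ B = trans (sub-sub _ (liftS τ) B) (sub-ext (lift-∷-⨟ N τ σ υ) B)

-- The two directions are mutual because the domain of Π is contravariant.
⟦⟧-sub : Shape A → ⟦ sub τ A ⟧ n σ M → ⟦ A ⟧ n (τ ⨟ σ) M
⟦⟧-unsub : Shape A → ⟦ A ⟧ n (τ ⨟ σ) M → ⟦ sub τ A ⟧ n σ M

⟦⟧-sub {Pi A B} {τ} {n} {σ} (sPi S T) p {ρ = ρ} w tN pN = ⟦⟧-ext T (lift-∷-⨟ _ τ σ ρ)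
  (⟦⟧-sub T (p w (ty≃ (sym (under τ σ ρ A)) tN) (⟦⟧-unsub S (⟦⟧-ext S (≗-sym (⨟-assoc τ σ ρ)) pN))))
⟦⟧-sub {Sg A B} {τ} {n} {σ} (sSg S T) p {ρ = ρ} w =
  let p₁ , f , p₂ = p w
      A≃ = sym (under τ σ ρ A)
  in ⟦⟧-ext S (⨟-assoc τ σ ρ) (⟦⟧-sub S p₁)
   , (λ h t t' → tyeq≃ (under-∷ _ τ σ ρ B) (under-∷ _ τ σ ρ B) (f (eqt≃ A≃ h) (ty≃ A≃ t) (ty≃ A≃ t')))
   , (λ h t → ⟦⟧-ext T (lift-∷-⨟ _ τ σ ρ) (⟦⟧-sub T (p₂ (eqt≃ A≃ h) (ty≃ A≃ t))))
⟦⟧-sub {Path A x y} {τ} {n} {σ} (sPath S) p {ρ = ρ} w dt =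
  ⟦⟧-ext S (lift-∷-⨟ _ τ σ ρ) (⟦⟧-sub S (p w dt))
⟦⟧-sub sBool p = p
⟦⟧-sub sU p = p
⟦⟧-sub {El a} sEl p = Cmp≃ (sub-sub _ _ a) refl p

⟦⟧-unsub {Pi A B} {n} {τ} {σ} (sPi S T) p {ρ = ρ} w tN pN = ⟦⟧-unsub T
  (⟦⟧-ext T (≗-sym (lift-∷-⨟ _ τ σ ρ))
    (p w (ty≃ (under τ σ ρ A) tN) (⟦⟧-ext S (⨟-assoc τ σ ρ) (⟦⟧-sub S pN))))
⟦⟧-unsub {Sg A B} {n} {τ} {σ} (sSg S T) p {ρ = ρ} w =
  let p₁ , f , p₂ = p w
      A≃ = under τ σ ρ A
  in ⟦⟧-unsub S (⟦⟧-ext S (≗-sym (⨟-assoc τ σ ρ)) p₁)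
   , (λ h t t' → tyeq≃ (sym (under-∷ _ τ σ ρ B)) (sym (under-∷ _ τ σ ρ B))
                   (f (eqt≃ A≃ h) (ty≃ A≃ t) (ty≃ A≃ t')))
   , (λ h t → ⟦⟧-unsub T (⟦⟧-ext T (≗-sym (lift-∷-⨟ _ τ σ ρ)) (p₂ (eqt≃ A≃ h) (ty≃ A≃ t))))
⟦⟧-unsub {Path A x y} {n} {τ} {σ} (sPath S) p {ρ = ρ} w dt =
  ⟦⟧-unsub S (⟦⟧-ext S (≗-sym (lift-∷-⨟ _ τ σ ρ)) (p w dt))
⟦⟧-unsub sBool p = p
⟦⟧-unsub sU p = p
⟦⟧-unsub {El a} sEl p = Cmp≃ (sym (sub-sub _ _ a)) refl p

⟦⟧-inst : Shape B → ⟦ B [ N ]₀ ⟧ n σ M → ⟦ B ⟧ n (sub σ N ∷ₛ σ) M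
⟦⟧-inst {N = N} {σ = σ} S p = ⟦⟧-ext S (∷-⨟ N var σ) (⟦⟧-sub S p)

⟦⟧-uninst : Shape B → ⟦ B ⟧ n (sub σ N ∷ₛ σ) M → ⟦ B [ N ]₀ ⟧ n σ M
⟦⟧-uninst {σ = σ} {N} S p = ⟦⟧-unsub S (⟦⟧-ext S (≗-sym (∷-⨟ N var σ)) p)

⟦⟧-wk : Shape A → ⟦ A ⟧ n (σ ∘ suc) M → ⟦ wk A ⟧ n σ M
⟦⟧-wk {A} {n} {σ} {M} S p = subst (λ A → ⟦ A ⟧ n σ M) (sym (ren-sub suc A)) (⟦⟧-unsub S p)

⟦⟧-unwk : Shape A → ⟦ wk A ⟧ n σ M → ⟦ A ⟧ n (σ ∘ suc) M
⟦⟧-unwk {A} {n} {σ} {M} S p = ⟦⟧-sub S (subst (λ A → ⟦ A ⟧ n σ M) (ren-sub suc A) p)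

⟦⟧≃ : ∀ A → M ≃ M' → ⟦ A ⟧ n σ M → ⟦ A ⟧ n σ M'
⟦⟧≃ A refl p = p

⟦⟧-mono : Shape A → ⟦ A ⟧ n σ M → World m τ n → ⟦ A ⟧ m (σ ⨟ τ) (sub τ M)
⟦⟧-mono {Pi A B} {n} {σ} {M} {τ = τ} (sPi S T) p w {ρ = ρ} {N} v tN pN =
  ⟦⟧≃ B (cong (λ f → app f N) (sym (sub-sub ρ τ M)))
    (⟦⟧-ext T (∷-ext (⨟-assoc σ τ ρ))
      (p (w ⨟TS v) (sub-ext-ty {A = A} (≗-sym (⨟-assoc σ τ ρ)) tN)
                   (⟦⟧-ext S (≗-sym (⨟-assoc σ τ ρ)) pN)))
⟦⟧-mono {Sg A B} {n} {σ} {M} {τ = τ} (sSg S T) p w {ρ = ρ} v =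
  let p₁ , f , p₂ = p (w ⨟TS v)
      A≃ = sub-ext (≗-sym (⨟-assoc σ τ ρ)) A
      M≃ = sym (sub-sub ρ τ M)
  in ⟦⟧≃ A (cong fst M≃) (⟦⟧-ext S (⨟-assoc σ τ ρ) p₁)
   , (λ h t t' → tyeq≃ (sub-ext (∷-ext (⨟-assoc σ τ ρ)) B) (sub-ext (∷-ext (⨟-assoc σ τ ρ)) B)
                   (f (eqt≃ A≃ h) (ty≃ A≃ t) (ty≃ A≃ t')))
   , (λ h t → ⟦⟧≃ B (cong snd M≃) (⟦⟧-ext T (∷-ext (⨟-assoc σ τ ρ))
                (p₂ (eq≃ refl (cong fst (sym M≃)) A≃ h) (ty≃ A≃ t))))
⟦⟧-mono {Path A x y} {n} {σ} {M} {τ = τ} (sPath S) p w {ρ = ρ} {t} v dt =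
  ⟦⟧≃ A (cong (λ f → papp f t) (sym (sub-sub ρ τ M)))
    (⟦⟧-ext S (∷-ext (⨟-assoc σ τ ρ)) (p (w ⨟TS v) dt))
⟦⟧-mono sBool (v , p) w = v , eq≃ refl (lit-sub v) refl (eqS p w)
⟦⟧-mono sU p w = code-mono p w
⟦⟧-mono {El a} sEl p w = Cmp≃ (sub-sub _ _ a) refl (Cmp-mono p w)

fam-inst : ∀ N σ ρ B → sub (liftS ρ) (sub (liftS σ) B) [ N ]₀ ≃ sub (N ∷ₛ (σ ⨟ ρ)) B
fam-inst N σ ρ B = trans (lift-inst N ρ (sub (liftS σ) B)) (lift-∷-sub N ρ σ B)

⟦⟧-≡ : Shape A → D n ⊢ M ≡ M' ∶ sub σ A → D n ⊢ M ∶ sub σ A → D n ⊢ M' ∶ sub σ A →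
       ⟦ A ⟧ n σ M → ⟦ A ⟧ n σ M'
⟦⟧-≡ {Pi A B} {n} {M} {M'} {σ} (sPi S T) e d d' p {ρ = ρ} {N} w tN pN = ⟦⟧-≡ T
  (eqt≃ (fam-inst N σ ρ B) (app-cong (eqS e w) (≡-refl tN')))
  (ty≃ (fam-inst N σ ρ B) (t-app (tmS d w) tN')) (ty≃ (fam-inst N σ ρ B) (t-app (tmS d' w) tN'))
  (p w tN pN)
  where tN' = ty≃ (sym (sub-sub ρ σ A)) tN
⟦⟧-≡ {Sg A B} {n} {M} {M'} {σ} (sSg S T) e d d' p {m} {ρ} w =
  let p₁ , f , p₂ = p w in
    ⟦⟧-≡ S (eqt≃ A≃ (fst-cong (eqS e w))) fM fM' p₁
  , f
  -- A shape yields no derivation of `B`, so the second projections are converted by the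
  -- functionality `f` stored in the predicate.
  , λ h t → let h' = ≡-trans h (≡-sym (eqt≃ A≃ (fst-cong (eqS e w)))) in
      ⟦⟧-≡ T (≡-conv (eqt≃ (fam-inst _ σ ρ B) (snd-cong (eqS e w))) (f (≡-sym h') fM t))
             (t-conv (ty≃ (fam-inst _ σ ρ B) (t-snd (tmS d w))) (f (≡-sym h') fM t))
             (t-conv (ty≃ (fam-inst _ σ ρ B) (t-snd (tmS d' w))) (f (≡-sym h) fM' t))
             (p₂ h' t)
  where
  A≃ = sub-sub ρ σ A
  fM = ty≃ A≃ (t-fst (tmS d w))
  fM' = ty≃ A≃ (t-fst (tmS d' w))
⟦⟧-≡ {Path A x y} {n} {M} {M'} {σ} (sPath S) e d d' p {ρ = ρ} {t} w dt = ⟦⟧-≡ S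
  (eqt≃ (fam-inst t σ ρ A) (papp-cong (eqS e w) dt dt (⊨-refl dt)))
  (ty≃ (fam-inst t σ ρ A) (t-papp (tmS d w) dt)) (ty≃ (fam-inst t σ ρ A) (t-papp (tmS d' w) dt))
  (p w dt)
⟦⟧-≡ sBool e d d' (v , p) = v , ≡-trans (≡-sym e) p
⟦⟧-≡ sU e d d' p = code-conv p (≡-sym e)
⟦⟧-≡ sEl e d d' p = Cmp-≡ e d' p

-- Judgmentally equal closing substitutions.

monoES : ESub (D n) σ σ' Γ → World m τ n → ESub (D m) (σ ⨟ τ) (σ' ⨟ τ) Γ
monoES {n} {σ} {σ'} {m = m} {τ} w v = record
  { left = left w ⨟TS v ; right = right w ⨟TS v
  ; rel = λ {_} {e} x → Related≃ refl refl (subE-sub τ σ e) (go (subE σ e) (rel w x)) }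
  where
  go : ∀ {t u} e → Related (D n) t u e → Related (D m) (sub τ t) (sub τ u) (subE τ e)
  go dim e = cong (sub τ) e
  go (cof φ) _ = _
  go (ty A) e = eqS e v

dimES : D n ⊢ᵈ t → ESub (D n) σ σ' Γ → ESub (D n) (t ∷ₛ σ) (t ∷ₛ σ') (Γ ▷ dim)
dimES d w = record
  { left = d ∷TS left w ; right = d ∷TS right w
  ; rel = λ { here → refl ; (there {e = e'} v) → Related≃ refl refl (subE-wkE _ e') (rel w v) } }

shape-T : Γ ⊢ᵗ A → Shape A
shape-T (T-Pi S T) = sPi (shape-T S) (shape-T T)
shape-T (T-Sg S T) = sSg (shape-T S) (shape-T T)
shape-T (T-Bool ok) = sBool
shape-T (T-Path T x y) = sPath (shape-T T)
shape-T (T-U ok) = sU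
shape-T (T-El a) = sEl

-- A shape is too weak here: the values of variables change within their equality class, and the
-- conversions between instances come from functionality of a derivation of the type.
⟦⟧-cong : Γ ⊢ᵗ A → ESub (D n) σ σ' Γ → ⟦ A ⟧ n σ M → ⟦ A ⟧ n σ' M
⟦⟧-cong⁻ : Γ ⊢ᵗ A → ESub (D n) σ σ' Γ → ⟦ A ⟧ n σ' M → ⟦ A ⟧ n σ M

⟦⟧-cong (T-Pi S T) es p w tN pN =
  let es' = monoES es w ; tN' = t-conv tN (Ty-sym (tyES S es'))
  in ⟦⟧-cong T ((≡-refl tN' , tN' , tN) ∷ES es') (p w tN' (⟦⟧-cong⁻ S es' pN))
⟦⟧-cong (T-Sg S T) es p w =
  let p₁ , _ , p₂ = p w ; es' = monoES es w ; e = Ty-sym (tyES S es')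
  in ⟦⟧-cong S es' p₁
   , (λ h t t' → tyES T ((h , t , t') ∷ES reflES (right es')))
   , (λ h t → let t' = t-conv t e in ⟦⟧-cong T ((≡-refl t' , t' , t) ∷ES es') (p₂ (≡-conv h e) t'))
⟦⟧-cong (T-Path T x y) es p w dt = ⟦⟧-cong T (dimES dt (monoES es w)) (p w dt)
⟦⟧-cong (T-Bool _) es p = p
⟦⟧-cong (T-U _) es p = p
⟦⟧-cong (T-El a) es p = Cmp-conv (tmES a es) p

⟦⟧-cong⁻ (T-Pi S T) es p w tN pN =
  let es' = monoES es w ; tN' = t-conv tN (tyES S es')
  in ⟦⟧-cong⁻ T ((≡-refl tN , tN , tN') ∷ES es') (p w tN' (⟦⟧-cong S es' pN))
⟦⟧-cong⁻ (T-Sg S T) es p w =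
  let p₁ , _ , p₂ = p w ; es' = monoES es w ; e = tyES S es'
  in ⟦⟧-cong⁻ S es' p₁
   , (λ h t t' → tyES T ((h , t , t') ∷ES reflES (left es')))
   , (λ h t → let t' = t-conv t e in ⟦⟧-cong⁻ T ((≡-refl t , t , t') ∷ES es') (p₂ (≡-conv h e) t'))
⟦⟧-cong⁻ (T-Path T x y) es p w dt = ⟦⟧-cong⁻ T (dimES dt (monoES es w)) (p w dt)
⟦⟧-cong⁻ (T-Bool _) es p = p
⟦⟧-cong⁻ (T-U _) es p = p
⟦⟧-cong⁻ (T-El a) es p = Cmp-conv (≡-sym (tmES a es)) p

-- Shapes of the types in derivable judgments.

ShapeE : Entry → Set
ShapeE (ty A) = Shape A
ShapeE _ = ⊤

shapeE-wk : ∀ e → ShapeE e → ShapeE (wkE e)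
shapeE-wk dim _ = _
shapeE-wk (cof φ) _ = _
shapeE-wk (ty A) S = shape-wk S

shape-C : ∀ {x e} → ⊢ Γ → Γ ∋ x ⦂ e → ShapeE e
shape-C (dim-ok _) here = _
shape-C (cof-ok _) here = _
shape-C (ty-ok T) here = shape-wk (shape-T T)
shape-C ok (there {e = e} v) = shapeE-wk e (shape-C (ok-tail ok) v)

shape-TE : Γ ⊢ᵗ A ≡ B → Shape A × Shape B
shape-TE (Ty-refl T) = shape-T T , shape-T T
shape-TE (Ty-sym e) = let a , b = shape-TE e in b , a
shape-TE (Ty-trans e e') = proj₁ (shape-TE e) , proj₂ (shape-TE e')
shape-TE (Pi-cong _ e e') =
  let a , a' = shape-TE e ; b , b' = shape-TE e' in sPi a b , sPi a' b'
shape-TE (Sg-cong _ e e') =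
  let a , a' = shape-TE e ; b , b' = shape-TE e' in sSg a b , sSg a' b'
shape-TE (Path-cong e _ _) = let a , a' = shape-TE e in sPath a , sPath a'
shape-TE (El-cong e) = sEl , sEl
shape-TE (El-cPi _ _) = sEl , sPi sEl sEl
shape-TE (El-cSg _ _) = sEl , sSg sEl sEl
shape-TE (El-cPath _ _ _) = sEl , sPath sEl
shape-TE (El-cBool _) = sEl , sBool

shape-t : Γ ⊢ a ∶ A → Shape A
shape-t (t-var ok v) = shape-C ok v
shape-t (t-conv a e) = proj₂ (shape-TE e)
shape-t (t-lam T b) = sPi (shape-T T) (shape-t b)
shape-t (t-app f a) with shape-t f
... | sPi _ T = shape-sub _ T
shape-t (t-pair T a b) = sSg (shape-t a) (shape-T T)
shape-t (t-fst p) with shape-t p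
... | sSg S _ = S
shape-t (t-snd p) with shape-t p
... | sSg _ T = shape-sub _ T
shape-t (t-tt _) = sBool
shape-t (t-ff _) = sBool
shape-t (t-if T _ _ _) = shape-sub _ (shape-T T)
shape-t (t-plam d) = sPath (shape-t d)
shape-t (t-papp p _) with shape-t p
... | sPath S = shape-sub _ S
shape-t (t-abort _ T) = shape-T T
shape-t (t-split {A = A} _ d _ _) = shape-unren suc A (shape-t d)
shape-t (t-cPi _ _) = sU
shape-t (t-cSg _ _) = sU
shape-t (t-cBool _) = sU
shape-t (t-cPath _ _ _) = sU
shape-t (t-coe _ _ _ _) = sEl
shape-t (t-com _ _ _ _ _) = sEl
shape-t (t-tcase T _ _ _ _ _) = shape-sub _ (shape-T T)

-- Computable closing substitutions.

SemE : ℕ → Sub → Entry → Tm → Set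
SemE n σ (ty A) M = ⟦ A ⟧ n σ M
SemE n σ _ M = ⊤

record Env (n : ℕ) (σ : Sub) (Γ : Ctx) : Set where
  field
    wS  : TSub (D n) σ Γ
    sem : ∀ {x e} → Γ ∋ x ⦂ e → SemE n σ e (σ x)
open Env

semE-wk : ∀ e → ShapeE e → SemE n (σ ∘ suc) e M → SemE n σ (wkE e) M
semE-wk dim _ _ = _
semE-wk (cof φ) _ _ = _
semE-wk (ty A) S p = ⟦⟧-wk S p

semE-mono : ∀ e → ShapeE e → SemE n σ e M → World m τ n → SemE m (σ ⨟ τ) e (sub τ M)
semE-mono dim _ _ _ = _
semE-mono (cof φ) _ _ _ = _
semE-mono (ty A) S p w = ⟦⟧-mono S p w

Env-∷ : ∀ {e} → ⊢ Γ ▷ e → Inhabits (D n) M (subE σ e) → SemE n σ e M → Env n σ Γ → Env n (M ∷ₛ σ) (Γ ▷ e)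
Env-∷ {n = n} {M} {σ} {e} ok d p ρ = record { wS = _∷TS_ {e = e} d (wS ρ) ; sem = go ok p }
  where
  go : ∀ {e x e'} → ⊢ _ ▷ e → SemE n σ e M → (_ ▷ e) ∋ x ⦂ e' → SemE n (M ∷ₛ σ) e' ((M ∷ₛ σ) x)
  go (dim-ok _) _ here = _
  go (cof-ok _) _ here = _
  go (ty-ok T) p here = ⟦⟧-wk (shape-T T) p
  go ok _ (there {e = e} v) = semE-wk e (shape-C (ok-tail ok) v) (sem ρ v)

Env-mono : ⊢ Γ → Env n σ Γ → World m τ n → Env m (σ ⨟ τ) Γ
Env-mono ok ρ w = record
  { wS = wS ρ ⨟TS w ; sem = λ {_} {e} v → semE-mono e (shape-C ok v) (sem ρ v) w }

-- Once a disjunct has been found true in a world, this returns the derivation that `split-β₁` and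
-- `split-β₂` require.
complete : Γ ⊢ᶠ φ → Holds φ → Γ ⊨ φ
complete (f-eq r s) refl = ⊨-refl r
complete (f-or F G) (inj₁ h) = ⊨-inl (complete F h) G
complete (f-or F G) (inj₂ h) = ⊨-inr F (complete G h)

∷-lift₅ : ∀ M₁ M₂ M₃ M₄ M₅ σ t → sub (M₁ ∷ₛ M₂ ∷ₛ M₃ ∷ₛ M₄ ∷ₛ M₅ ∷ₛ var) (sub (liftSⁿ 5 σ) t) ≃
                                 sub (M₁ ∷ₛ M₂ ∷ₛ M₃ ∷ₛ M₄ ∷ₛ M₅ ∷ₛ σ) t
∷-lift₅ M₁ M₂ M₃ M₄ M₅ σ t = trans (lift-∷-sub M₁ _ (liftSⁿ 4 σ) t)
  (sub-ext (∷-ext (step M₂ (step M₃ (step M₄ (step M₅ (⨟-var σ)))))) t)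
  where
  step : ∀ N {σ τ υ} → σ ⨟ τ ≗ υ → liftS σ ⨟ (N ∷ₛ τ) ≗ (N ∷ₛ υ)
  step N {σ} {τ} h x = trans (lift-∷ N σ τ x) (∷-ext h x)

-- The fundamental theorem.

Pi-unfold : World m τ n → D n ⊢ M ∶ sub σ (Pi A B) → D m ⊢ N ∶ sub (σ ⨟ τ) A →
            D m ⊢ app (sub τ M) N ∶ sub (N ∷ₛ (σ ⨟ τ)) B
Pi-unfold {τ = τ} {σ = σ} {A = A} {B} v d tN =
  ty≃ (fam-inst _ σ τ B) (t-app (tmS d v) (ty≃ (sym (sub-sub τ σ A)) tN))

Sg-fst-at : World m τ n → D n ⊢ M ∶ sub σ (Sg A B) → D m ⊢ fst (sub τ M) ∶ sub (σ ⨟ τ) A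
Sg-fst-at {τ = τ} {σ = σ} {A = A} v d = ty≃ (sub-sub τ σ A) (t-fst (tmS d v))

Sg-snd-at : World m τ n → D n ⊢ M ∶ sub σ (Sg A B) →
            D m ⊢ snd (sub τ M) ∶ sub (fst (sub τ M) ∷ₛ (σ ⨟ τ)) B
Sg-snd-at {τ = τ} {σ = σ} {B = B} v d = ty≃ (fam-inst _ σ τ B) (t-snd (tmS d v))

-- What `t-conv` requires. Both inclusions are proved together since symmetry and the domain of Π
-- exchange them. The elements come with their typing because computability at a code includes it.
fund-TE : Γ ⊢ᵗ A ≡ B → Env n σ Γ →
  (∀ {M} → D n ⊢ M ∶ sub σ A → ⟦ A ⟧ n σ M → ⟦ B ⟧ n σ M) ×
  (∀ {M} → D n ⊢ M ∶ sub σ B → ⟦ B ⟧ n σ M → ⟦ A ⟧ n σ M)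
fund-t : Γ ⊢ a ∶ A → Env n σ Γ → ⟦ A ⟧ n σ (sub σ a)
fund-fam : Γ ⊢ a ∶ U → Γ ▷ ty (El a) ⊢ b ∶ U → Env n σ Γ → Fam n (sub σ a) (sub (liftS σ) b)
fund-line : Γ ▷ dim ⊢ a ∶ U → Env n σ Γ → ∀ {m ρ} → World m ρ (suc n) → Code m (sub ρ (sub (liftS σ) a))
fund-path : Γ ▷ dim ⊢ a ∶ U → Γ ⊢ x ∶ El (a [ i0 ]₀) → Γ ⊢ y ∶ El (a [ i1 ]₀) → Env n σ Γ →
            PathFam n (sub (liftS σ) a) (sub σ x) (sub σ y)

fund-fam {a = a} {b} {σ = σ} d d' ρ = record
  { dom-t = tmS d (wS ρ)
  ; fib-t = tmS d' (liftTS (ty (El a)) (wS ρ) (wf-ty (T-El (tmS d (wS ρ)))))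
  ; dom = λ w → Code≃ (sym (sub-sub _ σ a)) (fund-t d (Env-mono ok ρ w))
  ; fib = λ w cN → let cN' = Cmp≃ (sub-sub _ σ a) refl cN in
      Code≃ (sym (lift-∷-sub _ _ σ b)) (fund-t d' (Env-∷ (ok-t d') (tm cN') cN' (Env-mono ok ρ w))) }
  where ok = ok-t d

fund-line {a = a} {σ = σ} d ρ {ρ = υ} w = Code≃
  (trans (sub-ext (λ { zero → refl ; (suc x) → sym (sub-ren υ suc (σ x)) }) a)
           (sym (sub-sub υ (liftS σ) a)))
  (fund-t d (Env-∷ (ok-t d) (headTS w) _ (Env-mono (ok-tail (ok-t d)) ρ (tailTS w))))

fund-path {a = a} {x} {y} {σ = σ} d d₀ d₁ ρ = record
  { line-t = tmS d (liftTS dim (wS ρ) wf-dim)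
  ; left-t = ty≃ (cong El (inst {t = a})) (tmS d₀ (wS ρ))
  ; right-t = ty≃ (cong El (inst {t = a})) (tmS d₁ (wS ρ))
  ; line = fund-line d ρ
  ; left = λ w → Cmp≃ (at i0) (sym (sub-sub _ σ x)) (fund-t d₀ (Env-mono (ok-t d₀) ρ w))
  ; right = λ w → Cmp≃ (at i1) (sym (sub-sub _ σ y)) (fund-t d₁ (Env-mono (ok-t d₀) ρ w)) }
  where
  at : ∀ r {τ} → sub (σ ⨟ τ) (a [ r ]₀) ≃ sub (sub (σ ⨟ τ) r ∷ₛ τ) (sub (liftS σ) a)
  at r {τ} = trans (sub-inst _ a r) (sym (lift-∷-sub _ τ σ a))

fund-TE (Ty-refl T) ρ = (λ _ p → p) , (λ _ p → p)
fund-TE (Ty-sym e) ρ = let f , g = fund-TE e ρ in g , f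
fund-TE (Ty-trans e e') ρ =
  let f , g = fund-TE e ρ ; f' , g' = fund-TE e' ρ
  in (λ d p → f' (t-conv d (tyeqS e (wS ρ))) (f d p))
   , (λ d p → g (t-conv d (Ty-sym (tyeqS e' (wS ρ)))) (g' d p))
fund-TE (Pi-cong {A = A} {A'} {B} {B'} T e e') ρ =
    (λ d p w tN pN →
      let ρ' = Env-mono ok ρ w
          tN' = t-conv tN (Ty-sym (tyeqS e (wS ρ')))
          pN' = proj₂ (fund-TE e ρ') tN pN
      in proj₁ (fund-TE e' (Env-∷ (ty-ok T) tN' pN' ρ')) (Pi-unfold {A = A} {B} w d tN') (p w tN' pN'))
  , (λ d p w tN pN →
      let ρ' = Env-mono ok ρ w
          tN' = t-conv tN (tyeqS e (wS ρ'))
          pN' = proj₁ (fund-TE e ρ') tN pN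
      in proj₂ (fund-TE e' (Env-∷ (ty-ok T) tN pN ρ')) (Pi-unfold {A = A'} {B'} w d tN') (p w tN' pN'))
  where ok = ok-T T
fund-TE (Sg-cong {A = A} {A'} {B} {B'} T e e') ρ =
    (λ {M} d p {m} {τ} w →
      let ρ' = Env-mono ok ρ w
          p₁ , f , p₂ = p w
          E = Ty-sym (tyeqS e (wS ρ'))
          fM = Sg-fst-at {A = A} {B} w d
          at = λ {F} (t : D m ⊢ F ∶ sub _ A) → tyeqS e' (t ∷TS wS ρ')
      in proj₁ (fund-TE e ρ') fM p₁
       -- `B'` inherits functionality from `B`, as `e'` equates their instances at both elements.
       , (λ h t t' → let t = t-conv t E ; t' = t-conv t' E in
            Ty-trans (Ty-sym (at t)) (Ty-trans (f (≡-conv h E) t t') (at t')))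
       , (λ h t → let t = t-conv t E ; h = ≡-conv h E in
            proj₁ (fund-TE e' (Env-∷ (ty-ok T) t (⟦⟧-≡ (shape-T T) (≡-sym h) fM t p₁) ρ'))
              (t-conv (Sg-snd-at {A = A} {B} w d) (f (≡-sym h) fM t)) (p₂ h t)))
  , (λ {M} d p {m} {τ} w →
      let ρ' = Env-mono ok ρ w
          p₁ , f , p₂ = p w
          E = tyeqS e (wS ρ')
          fM = Sg-fst-at {A = A'} {B'} w d
          fM₀ = t-conv fM (Ty-sym E)
          p₁' = proj₂ (fund-TE e ρ') fM p₁
          at = λ {F} (t : D m ⊢ F ∶ sub _ A) → tyeqS e' (t ∷TS wS ρ')
      in p₁'
       , (λ h t t' → Ty-trans (at t)
            (Ty-trans (f (≡-conv h E) (t-conv t E) (t-conv t' E)) (Ty-sym (at t'))))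
       , (λ h t → let h' = ≡-conv h E ; t' = t-conv t E in
            proj₂ (fund-TE e' (Env-∷ (ty-ok T) t (⟦⟧-≡ (shape-T T) (≡-sym h) fM₀ t p₁') ρ'))
              (t-conv (Sg-snd-at {A = A'} {B'} w d) (f (≡-sym h') fM t')) (p₂ h' t')))
  where ok = ok-T T
fund-TE {σ = σ} (Path-cong {A = A} {A'} e x y) ρ =
    (λ {M} d p {ρ = τ} w dt → proj₁ (fund-TE e (Env-∷ (dim-ok ok) dt _ (Env-mono ok ρ w)))
      (ty≃ (fam-inst _ σ τ A) (t-papp (tmS d w) dt)) (p w dt))
  , (λ {M} d p {ρ = τ} w dt → proj₂ (fund-TE e (Env-∷ (dim-ok ok) dt _ (Env-mono ok ρ w)))
      (ty≃ (fam-inst _ σ τ A') (t-papp (tmS d w) dt)) (p w dt))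
  where ok = ok-e x
fund-TE (El-cong e) ρ =
  (λ _ p → Cmp-conv (eqS e (wS ρ)) p) , (λ _ p → Cmp-conv (≡-sym (eqS e (wS ρ))) p)
fund-TE {σ = σ} (El-cPi {a = a} {b} d d') ρ =
    (λ _ p {_} {τ} w tN pN → Cmp≃ (lift-∷-sub _ τ σ b) refl
      (pi-elim F p w (Cmp≃ (sym (sub-sub τ σ a)) refl pN)))
  , (λ t p → pi-intro F (t-conv t (Ty-sym (El-cPi (dom-t F) (fib-t F)))) λ {_} {τ} w cN →
      let cN' = Cmp≃ (sub-sub τ σ a) refl cN in
      Cmp≃ (sym (lift-∷-sub _ τ σ b)) refl (p w (tm cN') cN'))
  where F = fund-fam d d' ρ
fund-TE {σ = σ} (El-cSg {a = a} {b} d d') ρ =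
    (λ _ p {_} {τ} w →
      let w' = wS ρ ⨟TS w
          cF = Cmp≃ (sub-sub τ σ a) refl (sg-elim-fst F p w)
      in cF
       , (λ h t t' → El-cong (fibre-cong d' w' h t t'))
       , (λ h t → Cmp-conv (fibre-cong d' w' (≡-sym h) (tm cF) t)
            (Cmp≃ (lift-∷-sub _ τ σ b) refl (sg-elim-snd F p w))))
  , (λ t p → sg-introW F (t-conv t (Ty-sym (El-cSg (dom-t F) (fib-t F))))
      (λ {_} {τ} w → Cmp≃ (sym (sub-sub τ σ a)) refl (proj₁ (p w)))
      (λ {_} {τ} w → let cF , _ , cS = p w in
        Cmp≃ (sym (lift-∷-sub _ τ σ b)) refl (cS (≡-refl (tm cF)) (tm cF))))
  where F = fund-fam d d' ρ
fund-TE {σ = σ} (El-cPath {a = a} d x y) ρ =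
    (λ _ p {_} {τ} w dt → Cmp≃ (lift-∷-sub _ τ σ a) refl (path-elim F p w dt))
  , (λ t p → path-intro F (t-conv t (Ty-sym (El-cPath (line-t F) (left-t F) (right-t F))))
      λ {_} {τ} w dt → Cmp≃ (sym (lift-∷-sub _ τ σ a)) refl (p w dt))
  where F = fund-path d x y ρ
fund-TE (El-cBool _) ρ =
    (λ _ p → bool-value p)
  , (λ t (v , p) → cmp (t-conv t (Bool-El (TSub.ok (wS ρ))))
                       (code-Bool (≡-refl (t-cBool (TSub.ok (wS ρ))))) (v , p))
fund-t (t-var ok v) ρ = sem ρ v
fund-t (t-conv a e) ρ = proj₁ (fund-TE e ρ) (tmS a (wS ρ)) (fund-t a ρ)
fund-t {σ = σ} (t-lam {A = A} {B} {b} T d) ρ {ρ = τ} {N} w tN pN =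
  ⟦⟧-≡ (shape-t d)
    (≡-sym (eq≃ (cong (λ f → app f N) (sym (sub-sub τ σ (lam b)))) (lift-inst N _ b)
                (lift-inst N _ B) (Pi-β (tmS d w₁) tN)))
    (tmS d (tN ∷TS wS ρ'))
    (tm≃ (cong (λ f → app f N) (sym (sub-sub τ σ (lam b)))) (lift-inst N _ B)
      (t-app (t-lam (tyS T (wS ρ')) (tmS d w₁)) tN))
    (fund-t d (Env-∷ (ok-t d) tN pN ρ'))
  where
  ρ' = Env-mono (ok-T T) ρ w
  w₁ = liftTS (ty A) (wS ρ') (wf-ty (tyS T (wS ρ')))
fund-t {σ = σ} (t-app {A = A} {B} {f} {a} d e) ρ with shape-t d
... | sPi S T = ⟦⟧-uninst T (⟦⟧-ext T (∷-ext (⨟-var σ))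
  (⟦⟧≃ B (cong (λ f → app f (sub σ a)) (sub-id (sub σ f)))
    (fund-t d ρ idW (sub-ext-ty {A = A} (≗-sym (⨟-var σ)) (tmS e (wS ρ)))
                    (⟦⟧-ext S (≗-sym (⨟-var σ)) (fund-t e ρ)))))
fund-t {n = n} {σ} (t-pair {A = A} {B} {a} {b} T d e) ρ {m} {τ} w =
    ⟦⟧-≡ S (≡-sym β₁) ta (t-fst tp) pa
  -- The pairing rule has the family as a premise, and this is where the functionality demanded by
  -- the Σ clause originates.
  , (λ h t t' → tyES T ((h , t , t') ∷ES reflES w'))
  , (λ h t → ⟦⟧-≡ (shape-T T)
      (≡-conv (≡-sym β₂) (conv (≡-sym (≡-trans h β₁)) ta t)) (t-conv tb (conv (≡-sym (≡-trans h β₁)) ta t))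
      (t-conv (ty≃ (lift-inst _ _ B) (t-snd tp)) (conv (≡-sym h) (t-fst tp) t))
      (⟦⟧-cong T ((≡-sym (≡-trans h β₁) , ta , t) ∷ES reflES w') pb))
  where
  S = shape-t d
  w' = wS ρ ⨟TS w
  pa : ⟦ A ⟧ m (σ ⨟ τ) (sub τ (sub σ a))
  pa = ⟦⟧-mono S (fund-t d ρ) w
  pb : ⟦ B ⟧ m (sub τ (sub σ a) ∷ₛ (σ ⨟ τ)) (sub τ (sub σ b))
  pb = ⟦⟧-ext (shape-T T) (∷-⨟ (sub σ a) σ τ) (⟦⟧-mono (shape-T T) (⟦⟧-inst (shape-T T) (fund-t e ρ)) w)
  ta : D m ⊢ sub τ (sub σ a) ∶ sub (σ ⨟ τ) A
  ta = ty≃ (sub-sub τ σ A) (tmS (tmS d (wS ρ)) w)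
  tb : D m ⊢ sub τ (sub σ b) ∶ sub (sub τ (sub σ a) ∷ₛ (σ ⨟ τ)) B
  tb = ty≃ (trans (cong (sub τ) (sub-inst σ B a))
         (trans (sub-sub τ _ B) (sub-ext (∷-⨟ (sub σ a) σ τ) B))) (tmS (tmS e (wS ρ)) w)
  tB = tyS T (liftTS (ty A) w' (wf-ty (tyS (ty-of (ok-T T)) w')))
  tb′ = ty≃ (sym (lift-inst _ _ B)) tb
  tp = t-pair tB ta tb′
  β₁ = Sg-β₁ tB ta tb′
  β₂ = eqt≃ (lift-inst _ _ B) (Sg-β₂ tB ta tb′)
  conv : ∀ {F F'} → D m ⊢ F ≡ F' ∶ sub (σ ⨟ τ) A → D m ⊢ F ∶ sub (σ ⨟ τ) A →
         D m ⊢ F' ∶ sub (σ ⨟ τ) A → D m ⊢ᵗ sub (F ∷ₛ (σ ⨟ τ)) B ≡ sub (F' ∷ₛ (σ ⨟ τ)) B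
  conv h t t' = tyES T ((h , t , t') ∷ES reflES w')
fund-t {σ = σ} (t-fst {A = A} {p = p} d) ρ with shape-t d
... | sSg S T = ⟦⟧-ext S (⨟-var σ)
  (⟦⟧≃ A (cong fst (sub-id (sub σ p))) (proj₁ (fund-t d ρ idW)))
fund-t {σ = σ} (t-snd {A = A} {B} {p} d) ρ with shape-t d
... | sSg S T = let _ , _ , p₂ = fund-t d ρ idW
                    tF = sub-ext-ty {A = A} (≗-sym (⨟-var σ)) (t-fst (tmS d (wS ρ)))
                    id≃ = sub-id (sub σ p)
  in ⟦⟧-uninst T (⟦⟧-ext T (∷-ext (⨟-var σ)) (⟦⟧≃ B (cong snd id≃)
       (p₂ (eq≃ refl (cong fst (sym id≃)) refl (≡-refl tF)) tF)))
fund-t (t-tt _) ρ = true , ≡-refl (t-tt (TSub.ok (wS ρ)))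
fund-t (t-ff _) ρ = false , ≡-refl (t-ff (TSub.ok (wS ρ)))
fund-t {n = n} {σ} (t-if {C = C} {b} {x} {y} T d d₁ d₀) ρ = go (fund-t d ρ)
  where
  w = wS ρ
  S = shape-T T
  ok = TSub.ok w
  TC = tyS T (liftTS (ty Bool) w (wf-ty (T-Bool ok)))
  dx = ty≃ (inst {t = C}) (tmS d₁ w)
  dy = ty≃ (inst {t = C}) (tmS d₀ w)
  whole = ty≃ (sub-inst σ C b) (tmS (t-if T d d₁ d₀) w)
  branch : ∀ v {z} → D n ⊢ sub σ b ≡ lit v ∶ Bool → ⟦ C ⟧ n (lit v ∷ₛ σ) z → D n ⊢ z ∶ sub (lit v ∷ₛ σ) C →
           D n ⊢ if (sub (liftS σ) C) (lit v) (sub σ x) (sub σ y) ≡ z ∶ sub (liftS σ) C [ lit v ]₀ →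
           ⟦ C [ b ]₀ ⟧ n σ (sub σ (if C b x y))
  branch v e p tz β = ⟦⟧-uninst S (⟦⟧-≡ S
    (≡-sym (≡-trans
      (eqt≃ (lift-inst _ σ C) (if-cong (Ty-refl TC) e (≡-refl dx) (≡-refl dy)))
      (≡-conv (eqt≃ (lift-inst _ σ C) β) E)))
    (t-conv tz E) whole (⟦⟧-cong T es p))
    where
    -- The branch is computable over the literal; `C` is carried from there to the scrutinee, which
    -- equals that literal.
    es = (≡-sym e , lit-t v ok , tmS d w) ∷ES reflES w
    E = tyES T es
  go : (Σ 𝔹 λ v → D n ⊢ sub σ b ≡ lit v ∶ Bool) → _
  go (true , e) = branch true e (⟦⟧-inst S (fund-t d₁ ρ)) (ty≃ (sub-inst σ C tt) (tmS d₁ w)) (if-βtt TC dx dy)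
  go (false , e) = branch false e (⟦⟧-inst S (fund-t d₀ ρ)) (ty≃ (sub-inst σ C ff) (tmS d₀ w)) (if-βff TC dx dy)
fund-t {σ = σ} (t-plam {A = A} {a} d) ρ {ρ = τ} {t} w dt =
  ⟦⟧-≡ (shape-t d)
    (≡-sym (eq≃ (cong (λ f → papp f t) (sym (sub-sub τ σ (plam a)))) (lift-inst t _ a)
                (lift-inst t _ A) (Path-β d' dt)))
    (tmS d (dt ∷TS wS ρ'))
    (tm≃ (cong (λ f → papp f t) (sym (sub-sub τ σ (plam a)))) (lift-inst t _ A) (t-papp (t-plam d') dt))
    (fund-t d (Env-∷ (ok-t d) dt _ ρ'))
  where
  ρ' = Env-mono (ok-tail (ok-t d)) ρ w
  d' = tmS d (liftTS dim (wS ρ') wf-dim)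
fund-t {σ = σ} (t-papp {A = A} {p = p} {r} d e) ρ with shape-t d
... | sPath S = ⟦⟧-uninst S (⟦⟧-ext S (∷-ext (⨟-var σ))
  (⟦⟧≃ A (cong (λ f → papp f (sub σ r)) (sub-id (sub σ p))) (fund-t d ρ idW (dimS e (wS ρ)))))
-- No world satisfies 0 = 1, whose sides are different terms.
fund-t (t-abort h T) ρ = case sound-D (holdsS h (wS ρ)) of λ ()
fund-t {n = n} {σ} D₀@(t-split {A = A} {φ} {ψ} {a} {b} h d e g) ρ with sound-D (holdsS h (wS ρ))
... | inj₁ p = ⟦⟧-≡ (shape-t D₀)
  (≡-sym (eq≃ refl (lift-inst i0 σ a) refl (split-β₁ hφ whole)))
  (ty≃ (sub-∷-wk i0 σ A) (tmS d (wS ρ'))) whole (⟦⟧-unwk (shape-t D₀) (fund-t d ρ'))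
  where
  whole = tmS D₀ (wS ρ)
  hφ = complete (formS (form-of (ok-t d)) (wS ρ)) p
  -- The face slot receives `i0`, as in `instF`, so that the instance of the branch is the reduct of
  -- the split.
  ρ' = Env-∷ (ok-t d) hφ _ ρ
... | inj₂ p = ⟦⟧-≡ (shape-t D₀)
  (≡-sym (eq≃ refl (lift-inst i0 σ b) refl (split-β₂ hψ whole)))
  (ty≃ (sub-∷-wk i0 σ A) (tmS e (wS ρ'))) whole (⟦⟧-unwk (shape-t D₀) (fund-t e ρ'))
  where
  whole = tmS D₀ (wS ρ)
  hψ = complete (formS (form-of (ok-t e)) (wS ρ)) p
  ρ' = Env-∷ (ok-t e) hψ _ ρ
fund-t (t-cPi a b) ρ = Fam-code arrPi (fund-fam a b ρ)
fund-t (t-cSg a b) ρ = Fam-code arrSg (fund-fam a b ρ)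
fund-t (t-cBool _) ρ = code-Bool (≡-refl (t-cBool (TSub.ok (wS ρ))))
fund-t (t-cPath a x y) ρ = Path-code (fund-path a x y ρ)
fund-t (t-coe {A = A} T r r' a) ρ = Cmp≃ (sym (inst {t = A})) refl
  (coe-ok (computable-line (Code≃ (sub-id _) (fund-line T ρ idW)) (tmS T (liftTS dim (wS ρ) wf-dim)))
    (dimS r (wS ρ)) (dimS r' (wS ρ)) (Cmp≃ (inst {t = A}) refl (fund-t a ρ)))
fund-t {σ = σ} (t-com {A = A} {r} {r'} {s} {a} T d d' e x) ρ = Cmp≃ (sym (inst {t = A})) refl
  (com-ok (computable-line (Code≃ (sub-id _) (fund-line T ρ idW)) (tmS T (liftTS dim w wf-dim)))
    (dimS d w) (dimS d' w) (dimS e w) record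
      { ptm = ty≃ (cong El (liftS-wk (liftS σ) A)) (tmS x w₂)
      ; pcomp = λ {_} {τ} v → Cmp≃
          (trans (sub-∷-wk _ _ A) (trans
            (sub-ext (λ { zero → refl ; (suc x) → sym (sub-ren (τ ∘ suc) suc (σ x)) }) A)
            (sym (sub-sub _ (liftS σ) A))))
          (trans (sub-ext (same τ) a) (sym (sub-sub τ _ a)))
          (fund-t x (Env-∷ (ok-t x) (face v) _
            (Env-∷ (dim-ok (ok-D d)) (headTS (tailTS v)) _ (Env-mono (ok-D d) ρ (tailTS (tailTS v)))))) })
  where
  w = wS ρ
  w₂ = liftCof w (dimS d w) (dimS e w)
  same : ∀ τ → τ 0 ∷ₛ τ 1 ∷ₛ (σ ⨟ (τ ∘ suc ∘ suc)) ≗ liftSⁿ 2 σ ⨟ τ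
  same τ zero = refl
  same τ (suc zero) = refl
  same τ (suc (suc x)) = sym (trans (sub-ren τ suc (wk (σ x))) (sub-ren (τ ∘ suc) suc (σ x)))
  face : ∀ {m τ} → TSub (D m) τ _ → D m ⊨ sub (τ 1 ∷ₛ (σ ⨟ (τ ∘ suc ∘ suc))) (partialCof r s)
  face {τ = τ} v = cof≃
    (cong₂ (λ r s → (τ 1 ≐ r) ∨ ∂ s) (at r) (at s)) (headTS v)
    where
    at : ∀ t → sub (τ ∘ suc) (wk (sub σ t)) ≃ sub (τ 1 ∷ₛ (σ ⨟ (τ ∘ suc ∘ suc))) (wk t)
    at t = trans (sub-ren (τ ∘ suc) suc (sub σ t))
      (trans (sub-sub _ σ t) (sym (sub-∷-wk _ _ t)))
fund-t {n = n} {σ} D₀@(t-tcase {C = C} {P} {S} {Q} {B} {X} T p s q b x) ρ = go (fund-t x ρ)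
  where
  w = wS ρ
  ok = TSub.ok w
  K = proj₂ (sub-cases T p s q b) w
  TC = Cases.motive K
  dp = Cases.pi-t K
  ds = Cases.sg-t K
  dq = Cases.path-t K
  db = Cases.bool-t K
  CaseOf : Tm → Tm
  CaseOf = tcase (sub (liftS σ) C) (sub (liftSⁿ 2 σ) P) (sub (liftSⁿ 2 σ) S) (sub (liftSⁿ 5 σ) Q) (sub σ B)
  -- c is the code in the type of the branch K, which is only judgmentally equal to the
  -- head normal form x' of the scrutinee.
  branch : ∀ {x' c K} → D n ⊢ sub σ X ≡ x' ∶ U → D n ⊢ x' ∶ U → D n ⊢ x' ≡ c ∶ U → D n ⊢ c ∶ U →
           D n ⊢ CaseOf x' ≡ K ∶ sub (liftS σ) C [ x' ]₀ →
           D n ⊢ K ∶ sub (c ∷ₛ σ) C → ⟦ C ⟧ n (c ∷ₛ σ) K →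
           ⟦ C [ X ]₀ ⟧ n σ (CaseOf (sub σ X))
  branch e tx' e' tc β tK pK = ⟦⟧-uninst (shape-T T) (⟦⟧-≡ (shape-T T)
    (≡-sym (≡-trans
      (eqt≃ (lift-inst _ σ C)
        (tcase-cong (Ty-refl TC) (≡-refl dp) (≡-refl ds) (≡-refl dq) (≡-refl db) e))
      (≡-conv (eqt≃ (lift-inst _ σ C) β) (tyES T ((≡-sym e , tx' , tmS x w) ∷ES reflES w)))))
    (t-conv tK (tyES T es)) (ty≃ (sub-inst σ C X) (tmS D₀ w)) (⟦⟧-cong T es pK))
    where es = (≡-sym (≡-trans e e') , tc , tmS x w) ∷ES reflES w
  go : Code n (sub σ X) → ⟦ C [ X ]₀ ⟧ n σ (CaseOf (sub σ X))
  go (code-Bool e) = branch e (t-cBool ok) (≡-refl (t-cBool ok)) (t-cBool ok) (tc-Bool TC dp ds dq db)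
    (ty≃ (sub-inst σ C cBool) (tmS b w)) (⟦⟧-inst (shape-T T) (fund-t b ρ))
  go (code-Fam {a = a} {b = c} {h = h} A e ta tc Dom Fib) = arrow A e
    where
    ok₁ = ty-ok (T-El ta)
    tlam : D n ⊢ lam c ∶ Pi (El a) U
    tlam = t-lam (T-El ta) tc
    -- The type of the branch mentions the code whose family is `B` applied to a variable; with
    -- `lam c` for `B` the family appears as a β-redex.
    reduct : Tm
    reduct = app (wk (lam c)) (var 0)
    η : D n ▷ ty (El a) ⊢ c ≡ reduct ∶ U
    η = ≡-sym (eq≃ refl unlift refl
      (Pi-β (wk₁t (ty-ok (wkT ok₁ (T-El ta))) tc) (t-var ok₁ here)))
      where
      unlift : ren (liftR suc) c [ var 0 ]₀ ≃ c
      unlift = trans (sub-ren _ _ c) (sub-id′ (λ { zero → refl ; (suc x) → refl }) c)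
    tred : D n ▷ ty (El a) ⊢ reduct ∶ U
    tred = t-app (wkt ok₁ tlam) (t-var ok₁ here)
    okΓ = ok-t x
    -- `lam c` satisfies the predicate of the function type into `U` because each fibre of a
    -- computable code over a computable element is again a computable code.
    env : Env n (lam c ∷ₛ a ∷ₛ σ) (ctxPi _)
    env = Env-∷ (ctxPi-ok okΓ) tlam
      (λ {_} {τ} w' tN pN → code-conv (Fib w' tN (Cmp-in pN (Dom w')))
        (eq≃ refl (lift-inst _ τ c) refl
          (Pi-β (tmS tc (liftTS (ty (El a)) w' (wf-ty (tyS (T-El ta) w')))) tN)))
      (Env-∷ (ty-ok (T-U okΓ)) ta (Code≃ (sub-id a) (Dom idW)) ρ)
    arrow : ∀ {x'} → Arrow h x' a c → D n ⊢ sub σ X ≡ x' ∶ U → ⟦ C [ X ]₀ ⟧ n σ (CaseOf (sub σ X))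
    arrow arrPi e = branch e (t-cPi ta tc) (cPi-cong ta (≡-refl ta) η) (t-cPi ta tred)
      (eq≃ refl (∷-lift₂ (lam c) a σ P) refl (tc-Pi TC dp ds dq db ta tc))
      (ty≃ (trans (sub-sub _ σtcPi C) (sub-ext same C)) (tmS p (wS env)))
      (⟦⟧-ext (shape-T T) same (⟦⟧-sub (shape-T T) (fund-t p env)))
      where
      same : σtcPi ⨟ (lam c ∷ₛ a ∷ₛ σ) ≗ cPi a reduct ∷ₛ σ
      same zero = refl
      same (suc x) = refl
    arrow arrSg e = branch e (t-cSg ta tc) (cSg-cong ta (≡-refl ta) η) (t-cSg ta tred)
      (eq≃ refl (∷-lift₂ (lam c) a σ S) refl (tc-Sg TC dp ds dq db ta tc))
      (ty≃ (trans (sub-sub _ σtcSg C) (sub-ext same C)) (tmS s (wS env)))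
      (⟦⟧-ext (shape-T T) same (⟦⟧-sub (shape-T T) (fund-t s env)))
      where
      same : σtcSg ⨟ (lam c ∷ₛ a ∷ₛ σ) ≗ cSg a reduct ∷ₛ σ
      same zero = refl
      same (suc x) = refl
  go (code-Path {a = a} {l} {r} e ta tl tr Line L R) =
    branch e (t-cPath ta tl tr) (cPath-cong η (≡-refl tl) (≡-refl tr)) (t-cPath tred (t-conv tl (El-cong (eqS η (d-0 ok ∷W idW))))
                                    (t-conv tr (El-cong (eqS η (d-1 ok ∷W idW)))))
      (eq≃ refl (∷-lift₅ r l (plam a) (a [ i1 ]₀) (a [ i0 ]₀) σ Q) refl
        (tc-Path TC dp ds dq db ta tl tr))
      (ty≃ (trans (sub-sub _ σtcPath C) (sub-ext same C)) (tmS q (wS env)))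
      (⟦⟧-ext (shape-T T) same (⟦⟧-sub (shape-T T) (fund-t q env)))
    where
    okd = ok-t ta
    v₀ = d-var okd here
    reduct : Tm
    reduct = papp (wk (plam a)) (var 0)
    tplam = t-plam ta
    η : D (suc n) ⊢ a ≡ reduct ∶ U
    η = ≡-sym (eq≃ refl unlift refl (Path-β (wk₁t (dim-ok okd) ta) v₀))
      where
      unlift : ren (liftR suc) a [ var 0 ]₀ ≃ a
      unlift = trans (sub-ren _ _ a) (sub-id′ (λ { zero → refl ; (suc x) → refl }) a)
    tred : D (suc n) ⊢ reduct ∶ U
    tred = t-papp (wkt okd tplam) v₀
    okΓ = ok-t x
    F = code-path ta tl tr Line L R
    ok₅ = ctxPath-ok okΓ
    ok₄ = ok-tail ok₅
    ok₃ = ok-tail ok₄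
    ok₂ = ok-tail ok₃
    env : Env n (r ∷ₛ l ∷ₛ plam a ∷ₛ a [ i1 ]₀ ∷ₛ a [ i0 ]₀ ∷ₛ σ) (ctxPath _)
    env =
      Env-∷ ok₅ tr (Cmp≃ refl (sub-id r) (rightP F idW))
      (Env-∷ ok₄ tl (Cmp≃ refl (sub-id l) (leftP F idW))
      (Env-∷ ok₃ tplam (λ {_} {τ} {t} w' dt → code-conv (Line (dt ∷W w'))
          (eq≃ refl (lift-inst t τ a) refl (Path-β (tmS ta (liftW w')) dt)))
      (Env-∷ ok₂ (tmI ta (d-1 ok)) (Line (d-1 ok ∷W idW))
      (Env-∷ (ty-ok (T-U okΓ)) (tmI ta (d-0 ok)) (Line (d-0 ok ∷W idW)) ρ))))
    same : σtcPath ⨟ (r ∷ₛ l ∷ₛ plam a ∷ₛ a [ i1 ]₀ ∷ₛ a [ i0 ]₀ ∷ₛ σ) ≗ cPath reduct l r ∷ₛ σ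
    same zero = refl
    same (suc x) = cong (sub (r ∷ₛ l ∷ₛ plam a ∷ₛ a [ i1 ]₀ ∷ₛ a [ i0 ]₀ ∷ₛ σ)) (σtcPath-suc x)

theorem7p9 : (M : Tm) → ε ⊢ M ∶ Bool → (ε ⊢ M ≡ tt ∶ Bool) ⊎ (ε ⊢ M ≡ ff ∶ Bool)
theorem7p9 M d with fund-t d record { wS = idTS ε-ok ; sem = λ () }
... | true , e = inj₁ (eq≃ (sub-id M) refl refl e)
... | false , e = inj₂ (eq≃ (sub-id M) refl refl e)
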